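{- $G\in\mathcal{B}_2$ if and only if $G$ is a $5$-group of exponent $5$ or the Sylow $5$-subgroup of $G$ is a group of exponent $5$ and has index $2$ in $G$.
   Context: All groups are finite, and $G$ denotes a group. For a group $G$ and a subset $S\subseteq G$ with $1_G\notin S=S^{ -1}$, $\mathrm{Cay}(G,S)$ is the undirected graph with vertex set $G$ in which $g,h$ are adjacent if and only if $hg^{ -1}\in S$. A graph $\Gamma$ is $2$-integral if $[\mathbb{SF}(\Gamma):\mathbb{Q}]=2$, where $\mathbb{SF}(\Gamma)$ is the smallest field extension of $\mathbb{Q}$ containing all eigenvalues of the adjacency matrix of $\Gamma$. For an integer $k\geq 2$, $\mathcal{B}_k$ is the set of all groups $G$ such that $\mathrm{Cay}(G,S)$ is $2$-integral whenever $S\subset G$ satisfies $1_G\notin S=S^{ -1}$ and $2\leq|S|\leq k$.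
   Formalization: "Exponent 5" is taken as "x^5=1 for every element", so the trivial group satisfies it; with exponent exactly 5 the claim fails for the trivial group and the group of order 2, which lie vacuously in B_2. For all groups of order at least 3 the two readings agree. -}

module Defs where

open import Algebra.Bundles using (CommutativeRing; Group)
import Algebra.Definitions as AlgDefs
import Algebra.Definitions.RawMonoid as RawMonoidDefs
open import Algebra.Morphism.Structures using (module RingMorphisms)
import Algebra.Properties.Group as GroupProperties
import Algebra.Properties.Semiring.Sum as SemiringSum
open import Data.Bool.Base using (if_then_else_)
open import Data.Fin.Base using (Fin)
open import Data.Fin.Subset as Subset using (Subset; _⊆_; ∣_∣)
open import Data.Fin.Subset.Properties using (_∈?_)
open import Data.Nat.Base using (ℕ; _≤_; _^_)
open import Data.Product using (Σ-syntax; ∃; ∃-syntax; ∃!; _×_; _,_)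
import Data.Rational.Base as ℚ
import Data.Rational.Properties as ℚₚ
open import Function.Bundles using (Inverse; _⇔_; Equivalence)
open import Level using (Level; 0ℓ; _⊔_) renaming (suc to lsuc)
open import Relation.Binary.Core using (Rel)
open import Relation.Binary.Definitions using (Decidable; Symmetric; Irreflexive; _Respects_)
open import Relation.Binary.PropositionalEquality as ≡ using (_≡_)
open import Relation.Nullary.Decidable using (does)
open import Relation.Nullary.Negation using (¬_)
open import Relation.Unary using (Pred)

private
  variable
    c ℓ : Level

-- Fields have decidable equality, so that "nonzero" can be read as in
-- classical algebra.
record Field : Set₁ where
  field
    commutativeRing : CommutativeRing 0ℓ 0ℓ
  open CommutativeRing commutativeRing public
  open AlgDefs _≈_ using (Invertible)
  field
    _≟_     : Decidable _≈_
    0≉1     : ¬ (0# ≈ 1#)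
    inverse : ∀ x → ¬ (x ≈ 0#) → Invertible 1# _*_ x
  open SemiringSum semiring public using (sum)

ℚ-field : Field
ℚ-field = record
  { commutativeRing = ℚₚ.+-*-commutativeRing
  ; _≟_             = ℚₚ._≟_
  ; 0≉1             = λ ()
  ; inverse         = λ x x≢0 →
      let instance nonZero = ℚ.≢-nonZero x≢0
      in ℚ.1/ x , ℚₚ.*-inverseˡ x , ℚₚ.*-inverseʳ x
  }

record Extension (F : Field) : Set₁ where
  field
    top : Field
  private
    module F = Field F
    module E = Field top
  field
    ι                  : F.Carrier → E.Carrier
    isRingHomomorphism : RingMorphisms.IsRingHomomorphism F.rawRing E.rawRing ι

module _ {F : Field} (E : Extension F) where
  open Extension E
  private
    module F = Field F
  open Field top

  combination : ∀ {d} → (Fin d → F.Carrier) → (Fin d → Carrier) → Carrier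
  combination a b = sum (λ i → ι (a i) * b i)

  record IsBasis {d} (b : Fin d → Carrier) : Set where
    field
      spanning    : ∀ x → ∃[ a ] (x ≈ combination a b)
      independent : ∀ a → combination a b ≈ 0# → ∀ i → a i F.≈ F.0#

  HasDegree : ℕ → Set
  HasDegree d = ∃ (IsBasis {d})

  record IsIntermediateField (P : Pred Carrier 0ℓ) : Set where
    field
      respects  : P Respects _≈_
      base      : ∀ a → P (ι a)
      +-closed  : ∀ {x y} → P x → P y → P (x + y)
      *-closed  : ∀ {x y} → P x → P y → P (x * y)
      -‿closed  : ∀ {x} → P x → P (- x)
      ⁻¹-closed : ∀ {x y} → P x → x * y ≈ 1# → P y

record Graph (n : ℕ) : Set₁ where
  field
    _∼_    : Rel (Fin n) 0ℓ
    _∼?_   : Decidable _∼_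
    sym    : Symmetric _∼_
    irrefl : Irreflexive _≡_ _∼_

module _ {n : ℕ} (Γ : Graph n) where

  module _ (F : Field) where
    open Field F
    open Graph Γ using (_∼?_)

    adjacencyMatrix : Fin n → Fin n → Carrier
    adjacencyMatrix i j = if does (i ∼? j) then 1# else 0#

    IsEigenvalue : Carrier → Set
    IsEigenvalue μ = Σ[ v ∈ (Fin n → Carrier) ]
      (¬ (∀ i → v i ≈ 0#)) ×
      (∀ i → sum (λ j → adjacencyMatrix i j * v j) ≈ μ * v i)

  -- Without an ambient algebraically closed field, "K contains all
  -- eigenvalues" says that no extension of K has an eigenvalue outside K.
  -- The second condition makes K smallest: it is the only intermediate field
  -- containing all of them.  Such a K is unique up to isomorphism over ℚ.
  record IsSplittingField (K : Extension ℚ-field) : Set₁ where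
    open Extension K using (top)
    open Field top using (Carrier)
    field
      containsEigenvalues : (L : Extension top) →
        let open Extension L renaming (top to L′)
            open Field L′ using (_≈_)
        in ∀ μ → IsEigenvalue L′ μ → ∃[ x ] (ι x ≈ μ)
      smallest : (P : Pred Carrier 0ℓ) → IsIntermediateField K P →
        (∀ μ → IsEigenvalue top μ → P μ) → ∀ x → P x

  Is2Integral : Set₁
  Is2Integral = Σ[ K ∈ Extension ℚ-field ] IsSplittingField K × HasDegree K 2

record FiniteGroup (c ℓ : Level) : Set (lsuc (c ⊔ ℓ)) where
  field
    group : Group c ℓ
  open Group group public
  field
    order       : ℕ
    enumeration : Inverse setoid (≡.setoid (Fin order))
  open Inverse enumeration public
    using () renaming (to to index; from to element; to-cong to index-cong)
  open RawMonoidDefs rawMonoid public using () renaming (_×_ to power)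

-- Subsets of G are subsets of the set of indices of its elements.
module _ (G : FiniteGroup c ℓ) where
  open FiniteGroup G

  infix 4 _∈_
  _∈_ : Carrier → Subset order → Set
  g ∈ S = index g Subset.∈ S

  record IsConnectionSet (S : Subset order) : Set c where
    field
      1∉S   : ¬ (ε ∈ S)
      S≡S⁻¹ : ∀ g → (g ∈ S) ⇔ (g ⁻¹ ∈ S)

  Cay : (S : Subset order) → IsConnectionSet S → Graph order
  Cay S conn = record
    { _∼_    = λ i j → (element j ∙ element i ⁻¹) ∈ S
    ; _∼?_   = λ i j → index (element j ∙ element i ⁻¹) ∈? S
    ; sym    = λ {i} {j} p →
        ≡.subst (Subset._∈ S) (index-cong (hg⁻¹⁻¹ (element j) (element i)))
          (Equivalence.to (S≡S⁻¹ _) p)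
    ; irrefl = λ { {i} ≡.refl p →
        1∉S (≡.subst (Subset._∈ S) (index-cong (inverseʳ (element i))) p) }
    }
    where
    open IsConnectionSet conn
    open GroupProperties group using (⁻¹-anti-homo-//)
    hg⁻¹⁻¹ : ∀ h g → (h ∙ g ⁻¹) ⁻¹ ≈ g ∙ h ⁻¹
    hg⁻¹⁻¹ h g = ⁻¹-anti-homo-// h g

  𝓑 : ℕ → Set (lsuc 0ℓ ⊔ c)
  𝓑 k = (S : Subset order) (conn : IsConnectionSet S) →
    2 ≤ ∣ S ∣ → ∣ S ∣ ≤ k → Is2Integral (Cay S conn)

  record IsSubgroup (H : Subset order) : Set c where
    field
      ε-closed  : ε ∈ H
      ∙-closed  : ∀ {g h} → g ∈ H → h ∈ H → g ∙ h ∈ H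
      ⁻¹-closed : ∀ {g} → g ∈ H → g ⁻¹ ∈ H

  -- The order of every element is a power of p.
  IsPGroup : ℕ → Subset order → Set (c ⊔ ℓ)
  IsPGroup p H = ∀ g → g ∈ H → ∃[ k ] (power (p ^ k) g ≈ ε)

  -- "Exponent m" means that the law x ^ m = 1 holds; thus the trivial group
  -- counts as a group of exponent m.
  HasExponent : ℕ → Subset order → Set (c ⊔ ℓ)
  HasExponent m H = ∀ g → g ∈ H → power m g ≈ ε

  record IsSylow (p : ℕ) (P : Subset order) : Set (c ⊔ ℓ) where
    field
      isSubgroup : IsSubgroup P
      isPGroup   : IsPGroup p P
      maximal    : ∀ Q → IsSubgroup Q → IsPGroup p Q → P ⊆ Q → Q ⊆ P

  -- The elements r i represent each of the left cosets of H exactly once.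
  HasIndex : Subset order → ℕ → Set c
  HasIndex H m = Σ[ r ∈ (Fin m → Carrier) ]
    (∀ g → ∃! _≡_ (λ i → r i ⁻¹ ∙ g ∈ H))

-- For a connection set of size 2 the Cayley graph is a union of cycles of
-- some length N, and its eigenvalues are the numbers 2cos(2πj/N).
--
-- If G ∈ 𝓑₂, then an element of order 4 and a pair of commuting involutions
-- give only rational eigenvalues.  For an element of odd prime order
-- p = 2k + 1, an eigenvalue μ ≠ 2 is a root of V_k, which is Eisenstein at p
-- in the variable y = μ - 2; if k ≥ 3, then yʲ ∈ pℤ[μ] and p ∈ y³ℤ[μ], and
-- norms from a field K of degree 2 are integers with p | N(y) and
-- N(y)³ | p², which is absurd.  So K contains no eigenvalue but 2 and
-- rational ones, and is ℚ by minimality.  For order 25 minimality does not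
-- help, because K = ℚ(√5) contains some irrational eigenvalues.  Instead, K
-- contains all eigenvalues lying in extensions of K, hence (up to double
-- negation) a root μ of the polynomial of 2cos(2π/25), and the same norm
-- argument applies with p = 5.  So all element orders divide 10 and distinct
-- involutions do not commute.  If there is an involution t, let
-- χ : G → ℤ/2 be the transfer into {1, t}: χ(t) is the parity of the number
-- of x with x⁵ = 1 commuting with t, which is odd, and the kernel of χ is the
-- Sylow 5-subgroup.
--
-- Conversely, all cycles have length 5 or 10, and the splitting field is
-- ℚ(ψ) with ψ² + ψ = 1.
module Submission where

open import Algebra.Bundles using (CommutativeMonoid; CommutativeRing)
import Algebra.Definitions.RawMonoid as RawMonoidDefinitions
open import Algebra.Module.Bundles using (LeftModule)
import Algebra.Module.Construct.DirectProduct as DirectProduct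
import Algebra.Module.Construct.TensorUnit as TensorUnit
import Algebra.Module.Properties.LeftModule as LeftModuleProperties
open import Algebra.Morphism.Structures using (module RingMorphisms)
import Algebra.Properties.CommutativeSemigroup as CommutativeSemigroupProperties
import Algebra.Properties.Group as GroupProperties
import Algebra.Properties.Monoid.Mult as MonoidMultiples
import Algebra.Properties.Ring as RingProperties
import Algebra.Properties.Semiring.Mult.TCOptimised as Multiples
import Algebra.Properties.Semiring.Sum as SemiringSum
import Algebra.Solver.Ring as RingSolver
open import Algebra.Solver.Ring.AlmostCommutativeRing using (fromCommutativeRing; _-Raw-AlmostCommutative⟶_)
open import Data.Bool.Base using (Bool; true; false; if_then_else_; not; _∧_; _xor_)
import Data.Bool.Properties as Boolₚ
open import Data.Empty using (⊥; ⊥-elim)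
open import Data.Fin.Base as Fin using (Fin; zero; suc)
open import Data.Fin.Permutation using (permutation)
import Data.Fin.Properties as Finₚ
open import Data.Fin.Subset as Subset using (Subset; ⊤; ⁅_⁆; _∪_; inside; outside)
import Data.Fin.Subset.Properties as Subsetₚ
open import Data.Integer.Base as ℤ using (ℤ; +_; -[1+_]; ∣_∣)
open import Data.Integer.Divisibility.Signed using (∣ᵤ⇒∣) renaming (divides to dividesℤ)
import Data.Integer.Properties as ℤₚ
open import Data.List.Base as List using (List; []; _∷_; _++_)
open import Data.List.Relation.Unary.All using (All; []; _∷_)
import Data.Maybe.Base as Maybe
open import Data.Nat.Base as ℕ using (ℕ; zero; suc)
open import Data.Nat.Coprimality as Coprimality using (Coprime; coprime-divisor)
open import Data.Nat.Divisibility as Div using (_∣_; divides; ∣⇒≤; ∣-trans; m∣m*n)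
open import Data.Nat.GCD as GCD using (gcd; gcd-GCD)
open import Data.Nat.Induction using (<-rec)
open import Data.Nat.ListAction using (product)
open import Data.Nat.Primality using (Prime; prime?; euclidsLemma; prime⇒nonTrivial; prime⇒nonZero; prime⇒irreducible)
open import Data.Nat.Primality.Factorisation using (factorise; PrimeFactorisation)
import Data.Nat.Properties as ℕₚ
open import Data.Nat.Solver using (module +-*-Solver)
open import Data.Product using (∃₂; ∃-syntax; ∃!; _×_; _,_; proj₁; proj₂)
open import Data.Product.Relation.Binary.Pointwise.NonDependent using (×-decidable)
open import Data.Rational.Base as ℚ using (ℚ; mkℚ; toℚᵘ; 0ℚ; 1ℚ)
import Data.Rational.Properties as ℚₚ
open import Data.Rational.Unnormalised.Base as ℚᵘ using (mkℚᵘ; *≡*)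
import Data.Rational.Unnormalised.Properties as ℚᵘₚ
open import Data.Sum.Base using (_⊎_; inj₁; inj₂; [_,_]; [_,_]′; swap)
open import Data.Vec.Base as Vec using (Vec; []; _∷_; _∷ʳ_; here; there; initLast; tabulate; toList)
import Data.Vec.Properties as Vecₚ
open import Defs
open import Function.Base using (_∘_)
open import Function.Bundles using (_⇔_; mk⇔; Equivalence; Inverse)
open import Level using (Level; 0ℓ)
open import Relation.Binary.Definitions using (Decidable; tri<; tri≈; tri>)
open import Relation.Binary.PropositionalEquality as ≡ using (_≡_; _≢_; module ≡-Reasoning)
import Relation.Binary.Reasoning.Setoid as SetoidReasoning
open import Relation.Nullary.Decidable using (Dec; yes; no; does; dec⇒maybe; dec-true; dec-false; from-yes; map′; ¬?; _×-dec_; _⊎-dec_)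
open import Relation.Nullary.Negation using (¬_)
open import Relation.Unary using (Pred)

-- Degree 2 enters through the exponent 3 in the norm argument: `p` has norm p², so a field of
-- degree 2 has no room for an element y with p | N(y) and y³ | p. For p = 5 the polynomial V₂ is
-- only quadratic and the obstruction disappears; it returns for order 25, where 2cos(2π/25) has
-- degree 10. Rings of integers are avoided. The entries of an eigenvector span a finitely generated
-- group in K, preserved by μ because the adjacency matrix is integral. Hence the norms of all
-- powers of an element of ℤ[μ] share one denominator, and a rational number whose powers do so is
-- an integer. Decidable equality alone gives no factorisation of polynomials over K, so no
-- irreducible factor is available for adjoining a root. The absence of a root is refuted instead;
-- as the goal is a contradiction anyway, the double negation does no harm. The transfer is a sum in
-- the field of two elements over all of G, weighted by a Boolean function that picks one element
-- from each coset of {1, t}; sums vanish by fixed-point-free involutions.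

-- The homomorphism from ℤ to a commutative ring

module IntegerCoefficients {a ℓ : Level} (R : CommutativeRing a ℓ) where
  open CommutativeRing R
  open Multiples semiring renaming (_×_ to _·_)
  open RingProperties ring
  open SetoidReasoning setoid

  -- The optimised multiples make `1 · 1#` reduce to `1#`, so numerals in solver goals agree with
  -- `0#` and `1#` definitionally.
  fromℤ : ℤ → Carrier
  fromℤ (+ n)    = n · 1#
  fromℤ -[1+ n ] = - (suc n · 1#)

  private
    fromℤ-⊖ : ∀ m n → fromℤ (m ℤ.⊖ n) ≈ m · 1# - n · 1#
    fromℤ-⊖ zero    zero    = sym (-‿inverseʳ 0#)
    fromℤ-⊖ zero    (suc n) = sym (+-identityˡ _)
    fromℤ-⊖ (suc m) zero    = sym (trans (+-congˡ -0#≈0#) (+-identityʳ _))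
    fromℤ-⊖ (suc m) (suc n) = begin
      fromℤ (suc m ℤ.⊖ suc n)              ≡⟨ ≡.cong fromℤ (ℤₚ.[1+m]⊖[1+n]≡m⊖n m n) ⟩
      fromℤ (m ℤ.⊖ n)                      ≈⟨ fromℤ-⊖ m n ⟩
      m · 1# - n · 1#                      ≈⟨ +-congʳ (+-identityʳ _) ⟨
      (m · 1# + 0#) - n · 1#               ≈⟨ +-congʳ (+-congˡ (-‿inverseʳ 1#)) ⟨
      (m · 1# + (1# - 1#)) - n · 1#        ≈⟨ +-congʳ (+-assoc _ _ _) ⟨
      ((m · 1# + 1#) - 1#) - n · 1#        ≈⟨ +-assoc _ _ _ ⟩
      (m · 1# + 1#) + (- 1# - n · 1#)      ≈⟨ +-cong (+-comm _ _) (-‿+-comm _ _) ⟩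
      (1# + m · 1#) - (1# + n · 1#)        ≈⟨ +-cong (1+× m 1#) (-‿cong (1+× n 1#)) ⟨
      suc m · 1# - suc n · 1#              ∎

  fromℤ-neg : ∀ i → fromℤ (ℤ.- i) ≈ - fromℤ i
  fromℤ-neg (+ zero)  = sym -0#≈0#
  fromℤ-neg (+ suc n) = refl
  fromℤ-neg -[1+ n ]  = sym (-‿involutive _)

  fromℤ-+ : ∀ i j → fromℤ (i ℤ.+ j) ≈ fromℤ i + fromℤ j
  fromℤ-+ (+ m)    (+ n)    = ×-homo-+ 1# m n
  fromℤ-+ (+ m)    -[1+ n ] = fromℤ-⊖ m (suc n)
  fromℤ-+ -[1+ m ] (+ n)    = trans (fromℤ-⊖ n (suc m)) (+-comm _ _)
  fromℤ-+ -[1+ m ] -[1+ n ] = begin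
    - (suc (suc (m ℕ.+ n)) · 1#)        ≡⟨ ≡.cong (λ k → - (k · 1#)) (≡.cong suc (ℕₚ.+-suc m n)) ⟨
    - ((suc m ℕ.+ suc n) · 1#)          ≈⟨ -‿cong (×-homo-+ 1# (suc m) (suc n)) ⟩
    - (suc m · 1# + suc n · 1#)         ≈⟨ -‿+-comm _ _ ⟨
    - (suc m · 1#) - (suc n · 1#)       ∎

  private
    fromℤ-+* : ∀ m j → fromℤ (+ m ℤ.* j) ≈ m · 1# * fromℤ j
    fromℤ-+* m (+ n)    = trans (reflexive (≡.cong fromℤ (≡.sym (ℤₚ.pos-* m n)))) (×1-homo-* m n)
    fromℤ-+* m -[1+ n ] = begin
      fromℤ (+ m ℤ.* -[1+ n ])          ≡⟨ ≡.cong fromℤ (ℤₚ.neg-distribʳ-* (+ m) (+ suc n)) ⟨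
      fromℤ (ℤ.- (+ m ℤ.* + suc n))     ≈⟨ fromℤ-neg (+ m ℤ.* + suc n) ⟩
      - fromℤ (+ m ℤ.* + suc n)         ≈⟨ -‿cong (fromℤ-+* m (+ suc n)) ⟩
      - (m · 1# * suc n · 1#)           ≈⟨ -‿distribʳ-* _ _ ⟩
      m · 1# * - (suc n · 1#)           ∎

  fromℤ-* : ∀ i j → fromℤ (i ℤ.* j) ≈ fromℤ i * fromℤ j
  fromℤ-* (+ m)    j = fromℤ-+* m j
  fromℤ-* -[1+ m ] j = begin
    fromℤ (-[1+ m ] ℤ.* j)              ≡⟨ ≡.cong fromℤ (ℤₚ.neg-distribˡ-* (+ suc m) j) ⟨
    fromℤ (ℤ.- (+ suc m ℤ.* j))         ≈⟨ fromℤ-neg (+ suc m ℤ.* j) ⟩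
    - fromℤ (+ suc m ℤ.* j)             ≈⟨ -‿cong (fromℤ-+* (suc m) j) ⟩
    - (suc m · 1# * fromℤ j)            ≈⟨ -‿distribˡ-* _ _ ⟩
    - (suc m · 1#) * fromℤ j            ∎

  private
    morphism : ℤ.+-*-rawRing -Raw-AlmostCommutative⟶ fromCommutativeRing R
    morphism = record
      { ⟦_⟧ = fromℤ ; +-homo = fromℤ-+ ; *-homo = fromℤ-* ; -‿homo = fromℤ-neg
      ; 0-homo = refl ; 1-homo = refl }

  open RingSolver ℤ.+-*-rawRing (fromCommutativeRing R) morphism
    (λ i j → Maybe.map (λ i≡j → reflexive (≡.cong fromℤ i≡j)) (dec⇒maybe (i ℤₚ.≟ j)))
    public using (Polynomial; solve; _:=_; con; _:+_; _:*_; _:-_; :-_)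

-- Adjoining roots

module _ (F : Field) where
  open Field F

  -- The coefficient map `φ` is a parameter so that one list of coefficients can be evaluated in `F`
  -- and in every extension of it.
  evaluate : {A : Set} → (A → Carrier) → List A → Carrier → Carrier
  evaluate φ []      x = 0#
  evaluate φ (a ∷ p) x = φ a + x * evaluate φ p x

  evaluate-cong : {A : Set} (φ : A → Carrier) (p : List A) {x y : Carrier} →
    x ≈ y → evaluate φ p x ≈ evaluate φ p y
  evaluate-cong φ []      x≈y = refl
  evaluate-cong φ (a ∷ p) x≈y = +-congˡ (*-cong x≈y (evaluate-cong φ p x≈y))

module ExtensionProperties {F : Field} (E : Extension F) where
  open Extension E public
  private module F = Field F
  open Field top

  InBase : Pred Carrier 0ℓ
  InBase x = ∃[ a ] ι a ≈ x

  open RingMorphisms.IsRingHomomorphism isRingHomomorphism public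
    renaming (⟦⟧-cong to ι-cong; +-homo to ι-+; *-homo to ι-*; -‿homo to ι-neg; 0#-homo to ι-0; 1#-homo to ι-1)

  evaluate-ι : ∀ p a → ι (evaluate F (λ b → b) p a) ≈ evaluate top ι p (ι a)
  evaluate-ι []      a = ι-0
  evaluate-ι (b ∷ p) a = trans (ι-+ _ _) (+-congˡ (trans (ι-* _ _) (*-congˡ (evaluate-ι p a))))

  ι≈0⇒≈0 : ∀ {a} → ι a ≈ 0# → a F.≈ F.0#
  ι≈0⇒≈0 {a} ιa≈0 with a F.≟ F.0#
  ... | yes a≈0 = a≈0
  ... | no  a≉0 = ⊥-elim (0≉1 (begin
    0#            ≈⟨ zeroʳ (ι b) ⟨
    ι b * 0#      ≈⟨ *-congˡ ιa≈0 ⟨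
    ι b * ι a     ≈⟨ ι-* b a ⟨
    ι (b F.* a)   ≈⟨ ι-cong (proj₁ (proj₂ inv)) ⟩
    ι F.1#        ≈⟨ ι-1 ⟩
    1#            ∎))
    where
    open SetoidReasoning setoid
    inv = F.inverse a a≉0
    b   = proj₁ inv

-- No root is claimed to exist, only that extensions contribute no new ones. The eigenvalue
-- condition on a splitting field takes this form once the roots of `p` are known to be eigenvalues.
ContainsRoots : (K : Field) → List (Field.Carrier K) → Set₁
ContainsRoots K p = (L : Extension K) →
  let open ExtensionProperties L
      open Field top
  in ∀ x → evaluate top ι p x ≈ 0# → InBase x

record IsLinear (K : Field) (V : LeftModule (Field.ring K) 0ℓ 0ℓ)
                (τ : LeftModule.Carrierᴹ V → LeftModule.Carrierᴹ V) : Set where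
  open LeftModule V
  field
    τ-cong : ∀ {v w} → v ≈ᴹ w → τ v ≈ᴹ τ w
    τ-+    : ∀ v w → τ (v +ᴹ w) ≈ᴹ τ v +ᴹ τ w
    τ-*ₗ   : ∀ a v → τ (a *ₗ v) ≈ᴹ a *ₗ τ v

module PolynomialAction
  (K : Field) (V : LeftModule (Field.ring K) 0ℓ 0ℓ)
  {τ : LeftModule.Carrierᴹ V → LeftModule.Carrierᴹ V} (isLinear : IsLinear K V τ)
  where
  open LeftModule V
  open IsLinear isLinear
  private module K = Field K
  open SetoidReasoning ≈ᴹ-setoid
  open LeftModuleProperties V
  open CommutativeSemigroupProperties (CommutativeMonoid.commutativeSemigroup +ᴹ-commutativeMonoid)
    using (interchange; x∙yz≈y∙xz; x∙yz≈yx∙z)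

  private
    Poly = List K.Carrier

  -- `act p v` is p(τ) v: the space `V` becomes a module over K[X] with X acting as `τ`.
  act : Poly → Carrierᴹ → Carrierᴹ
  act []      v = 0ᴹ
  act (a ∷ p) v = a *ₗ v +ᴹ τ (act p v)

  -- A vector of length `n` stands for a monic polynomial of degree exactly `n`, with implicit
  -- leading coefficient 1; degrees are thus visible in types.
  monic : ∀ {n} → Vec K.Carrier n → Carrierᴹ → Carrierᴹ
  monic []      v = v
  monic (a ∷ f) v = a *ₗ v +ᴹ τ (monic f v)

  infixl 6 _⊕_
  infixl 7 _⊗_

  _⊕_ : Poly → Poly → Poly
  []      ⊕ q       = q
  (a ∷ p) ⊕ []      = a ∷ p
  (a ∷ p) ⊕ (b ∷ q) = (a K.+ b) ∷ (p ⊕ q)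

  scale : K.Carrier → Poly → Poly
  scale a = List.map (a K.*_)

  _⊗_ : Poly → Poly → Poly
  []      ⊗ q = []
  (a ∷ p) ⊗ q = scale a q ⊕ (K.0# ∷ p ⊗ q)

  τ-0 : τ 0ᴹ ≈ᴹ 0ᴹ
  τ-0 = begin
    τ 0ᴹ               ≈⟨ τ-cong (*ₗ-zeroˡ 0ᴹ) ⟨
    τ (K.0# *ₗ 0ᴹ)     ≈⟨ τ-*ₗ K.0# 0ᴹ ⟩
    K.0# *ₗ τ 0ᴹ       ≈⟨ *ₗ-zeroˡ _ ⟩
    0ᴹ                 ∎

  act-cong : ∀ p {v w} → v ≈ᴹ w → act p v ≈ᴹ act p w
  act-cong []      v≈w = ≈ᴹ-refl
  act-cong (a ∷ p) v≈w = +ᴹ-cong (*ₗ-congˡ v≈w) (τ-cong (act-cong p v≈w))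

  act-+ᴹ : ∀ p v w → act p (v +ᴹ w) ≈ᴹ act p v +ᴹ act p w
  act-+ᴹ []      v w = ≈ᴹ-sym (+ᴹ-identityˡ 0ᴹ)
  act-+ᴹ (a ∷ p) v w = ≈ᴹ-trans
    (+ᴹ-cong (*ₗ-distribˡ a v w) (≈ᴹ-trans (τ-cong (act-+ᴹ p v w)) (τ-+ _ _)))
    (interchange _ _ _ _)

  *ₗ-swap : ∀ a b v → a *ₗ b *ₗ v ≈ᴹ b *ₗ a *ₗ v
  *ₗ-swap a b v = begin
    a *ₗ b *ₗ v      ≈⟨ *ₗ-assoc a b v ⟨
    (a K.* b) *ₗ v   ≈⟨ *ₗ-congʳ (K.*-comm a b) ⟩
    (b K.* a) *ₗ v   ≈⟨ *ₗ-assoc b a v ⟩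
    b *ₗ a *ₗ v      ∎

  act-*ₗ : ∀ p a v → act p (a *ₗ v) ≈ᴹ a *ₗ act p v
  act-*ₗ []      a v = ≈ᴹ-sym (*ₗ-zeroʳ a)
  act-*ₗ (b ∷ p) a v = begin
    b *ₗ a *ₗ v +ᴹ τ (act p (a *ₗ v))
      ≈⟨ +ᴹ-cong (*ₗ-swap b a v) (≈ᴹ-trans (τ-cong (act-*ₗ p a v)) (τ-*ₗ a _)) ⟩
    a *ₗ b *ₗ v +ᴹ a *ₗ τ (act p v)    ≈⟨ *ₗ-distribˡ a _ _ ⟨
    a *ₗ (b *ₗ v +ᴹ τ (act p v))       ∎

  act-τ : ∀ p v → act p (τ v) ≈ᴹ τ (act p v)
  act-τ []      v = ≈ᴹ-sym τ-0
  act-τ (a ∷ p) v = ≈ᴹ-trans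
    (+ᴹ-cong (≈ᴹ-sym (τ-*ₗ a v)) (τ-cong (act-τ p v))) (≈ᴹ-sym (τ-+ _ _))

  act-0 : ∀ p → act p 0ᴹ ≈ᴹ 0ᴹ
  act-0 p = ≈ᴹ-trans (act-cong p (≈ᴹ-sym (*ₗ-zeroˡ 0ᴹ))) (≈ᴹ-trans (act-*ₗ p K.0# 0ᴹ) (*ₗ-zeroˡ _))

  act-⊕ : ∀ p q v → act (p ⊕ q) v ≈ᴹ act p v +ᴹ act q v
  act-⊕ []      q       v = ≈ᴹ-sym (+ᴹ-identityˡ _)
  act-⊕ (a ∷ p) []      v = ≈ᴹ-sym (+ᴹ-identityʳ _)
  act-⊕ (a ∷ p) (b ∷ q) v = ≈ᴹ-trans
    (+ᴹ-cong (*ₗ-distribʳ v a b) (≈ᴹ-trans (τ-cong (act-⊕ p q v)) (τ-+ _ _)))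
    (interchange _ _ _ _)

  act-scale : ∀ a p v → act (scale a p) v ≈ᴹ a *ₗ act p v
  act-scale a []      v = ≈ᴹ-sym (*ₗ-zeroʳ a)
  act-scale a (b ∷ p) v = ≈ᴹ-trans
    (+ᴹ-cong (*ₗ-assoc a b v) (≈ᴹ-trans (τ-cong (act-scale a p v)) (τ-*ₗ a _)))
    (≈ᴹ-sym (*ₗ-distribˡ a _ _))

  act-⊗ : ∀ p q v → act (p ⊗ q) v ≈ᴹ act p (act q v)
  act-⊗ []      q v = ≈ᴹ-refl
  act-⊗ (a ∷ p) q v = begin
    act (scale a q ⊕ (K.0# ∷ p ⊗ q)) v                ≈⟨ act-⊕ (scale a q) _ v ⟩
    act (scale a q) v +ᴹ (K.0# *ₗ v +ᴹ τ (act (p ⊗ q) v))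
      ≈⟨ +ᴹ-cong (act-scale a q v) (≈ᴹ-trans (+ᴹ-cong (*ₗ-zeroˡ v) (τ-cong (act-⊗ p q v))) (+ᴹ-identityˡ _)) ⟩
    a *ₗ act q v +ᴹ τ (act p (act q v))               ∎

  act-comm : ∀ p q v → act p (act q v) ≈ᴹ act q (act p v)
  act-comm []      q v = ≈ᴹ-sym (act-0 q)
  act-comm (a ∷ p) q v = begin
    a *ₗ act q v +ᴹ τ (act p (act q v))    ≈⟨ +ᴹ-cong (act-*ₗ q a v) (≈ᴹ-trans (act-τ q _) (τ-cong (act-comm q p v))) ⟨
    act q (a *ₗ v) +ᴹ act q (τ (act p v))  ≈⟨ act-+ᴹ q _ _ ⟨
    act q (a *ₗ v +ᴹ τ (act p v))          ∎

  private
    sub-scaled : ∀ {n} → K.Carrier → Vec K.Carrier n → Vec K.Carrier n → Vec K.Carrier n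
    sub-scaled c = Vec.zipWith (λ x b → x K.- c K.* b)

    coefficient : ∀ c x b → x K.≈ c K.* b K.+ (x K.- c K.* b)
    coefficient = solve 3 (λ c x b → x := c :* b :+ (x :- c :* b)) K.refl
      where open IntegerCoefficients K.commutativeRing

  -- One step of long division: subtracting `c` times the monic `f` removes the leading term `c` and
  -- leaves only `n` coefficients.
  act-∷ʳ : ∀ {n} c (xs f : Vec K.Carrier n) v →
    act (toList (xs ∷ʳ c)) v ≈ᴹ c *ₗ monic f v +ᴹ act (toList (sub-scaled c xs f)) v
  act-∷ʳ c []       []      v = +ᴹ-congˡ τ-0
  act-∷ʳ c (x ∷ xs) (b ∷ f) v = begin
    x *ₗ v +ᴹ τ (act (toList (xs ∷ʳ c)) v)
      ≈⟨ +ᴹ-cong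
          (≈ᴹ-trans (*ₗ-congʳ (coefficient c x b)) (≈ᴹ-trans (*ₗ-distribʳ v _ _) (+ᴹ-congʳ (*ₗ-assoc c b v))))
          (≈ᴹ-trans (τ-cong (act-∷ʳ c xs f v)) (≈ᴹ-trans (τ-+ _ _) (+ᴹ-congʳ (τ-*ₗ c _)))) ⟩
    (c *ₗ b *ₗ v +ᴹ (x K.- c K.* b) *ₗ v) +ᴹ (c *ₗ τ (monic f v) +ᴹ τ (act (toList (sub-scaled c xs f)) v))
      ≈⟨ interchange _ _ _ _ ⟩
    (c *ₗ b *ₗ v +ᴹ c *ₗ τ (monic f v)) +ᴹ ((x K.- c K.* b) *ₗ v +ᴹ τ (act (toList (sub-scaled c xs f)) v))
      ≈⟨ +ᴹ-congʳ (*ₗ-distribˡ c _ _) ⟨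
    c *ₗ (b *ₗ v +ᴹ τ (monic f v)) +ᴹ ((x K.- c K.* b) *ₗ v +ᴹ τ (act (toList (sub-scaled c xs f)) v))  ∎

  act-∷ʳ-0 : ∀ {n} {c} (xs : Vec K.Carrier n) v → c K.≈ K.0# →
    act (toList (xs ∷ʳ c)) v ≈ᴹ act (toList xs) v
  act-∷ʳ-0 []       v c≈0 = ≈ᴹ-trans (+ᴹ-cong (≈ᴹ-trans (*ₗ-congʳ c≈0) (*ₗ-zeroˡ v)) τ-0) (+ᴹ-identityˡ 0ᴹ)
  act-∷ʳ-0 (x ∷ xs) v c≈0 = +ᴹ-congˡ (τ-cong (act-∷ʳ-0 xs v c≈0))

  act-∷ʳ-monic : ∀ {n} {c d} (xs : Vec K.Carrier n) v → d K.* c K.≈ K.1# →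
    act (toList (xs ∷ʳ c)) v ≈ᴹ c *ₗ monic (Vec.map (d K.*_) xs) v
  act-∷ʳ-monic []       v dc≈1 = ≈ᴹ-trans (+ᴹ-congˡ τ-0) (+ᴹ-identityʳ _)
  act-∷ʳ-monic {c = c} {d} (x ∷ xs) v dc≈1 = begin
    x *ₗ v +ᴹ τ (act (toList (xs ∷ʳ c)) v)
      ≈⟨ +ᴹ-cong (*ₗ-congʳ x≈cdx) (≈ᴹ-trans (τ-cong (act-∷ʳ-monic xs v dc≈1)) (τ-*ₗ c _)) ⟩
    (c K.* (d K.* x)) *ₗ v +ᴹ c *ₗ τ (monic (Vec.map (d K.*_) xs) v)
      ≈⟨ +ᴹ-congʳ (*ₗ-assoc c _ v) ⟩
    c *ₗ (d K.* x) *ₗ v +ᴹ c *ₗ τ (monic (Vec.map (d K.*_) xs) v)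
      ≈⟨ *ₗ-distribˡ c _ _ ⟨
    c *ₗ ((d K.* x) *ₗ v +ᴹ τ (monic (Vec.map (d K.*_) xs) v)) ∎
    where
    x≈cdx : x K.≈ c K.* (d K.* x)
    x≈cdx = K.trans (K.sym (K.*-identityˡ x)) (K.trans (K.*-congʳ (K.trans (K.sym dc≈1) (K.*-comm d c))) (K.*-assoc c d x))

  monic-cong : ∀ {n} (f : Vec K.Carrier n) {v w} → v ≈ᴹ w → monic f v ≈ᴹ monic f w
  monic-cong []      v≈w = v≈w
  monic-cong (a ∷ f) v≈w = +ᴹ-cong (*ₗ-congˡ v≈w) (τ-cong (monic-cong f v≈w))

  fromMonic : ∀ {n} → Vec K.Carrier n → Poly
  fromMonic f = toList f ++ (K.1# ∷ [])

  act-fromMonic : ∀ {n} (f : Vec K.Carrier n) v → act (fromMonic f) v ≈ᴹ monic f v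
  act-fromMonic []      v = ≈ᴹ-trans (+ᴹ-cong (*ₗ-identityˡ v) τ-0) (+ᴹ-identityʳ v)
  act-fromMonic (a ∷ f) v = +ᴹ-congˡ (τ-cong (act-fromMonic f v))

  -- The remainder modulo `f`, by Horner's scheme: the remainder of the tail is multiplied by X, and
  -- the one coefficient that overflows is removed because `f` kills `v`.
  reduce : ∀ {n} (f : Vec K.Carrier n) v → monic f v ≈ᴹ 0ᴹ →
    ∀ p → ∃[ r ] act p v ≈ᴹ act (toList {n = n} r) v
  reduce {n} f v fv≈0 [] = Vec.replicate n K.0# , ≈ᴹ-sym (zeros n)
    where
    zeros : ∀ m → act (toList (Vec.replicate m K.0#)) v ≈ᴹ 0ᴹ
    zeros zero    = ≈ᴹ-refl
    zeros (suc m) = ≈ᴹ-trans (+ᴹ-cong (*ₗ-zeroˡ v) (≈ᴹ-trans (τ-cong (zeros m)) τ-0)) (+ᴹ-identityˡ 0ᴹ)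
  reduce f v fv≈0 (a ∷ p) with reduce f v fv≈0 p
  ... | r , pv≈rv with initLast (a ∷ r)
  ... | xs , c , a∷r≡xs∷ʳc = sub-scaled c xs f , (begin
    act (a ∷ p) v                        ≈⟨ +ᴹ-congˡ (τ-cong pv≈rv) ⟩
    act (toList (a ∷ r)) v               ≡⟨ ≡.cong (λ s → act (toList s) v) a∷r≡xs∷ʳc ⟩
    act (toList (xs ∷ʳ c)) v             ≈⟨ act-∷ʳ c xs f v ⟩
    c *ₗ monic f v +ᴹ act (toList (sub-scaled c xs f)) v
      ≈⟨ +ᴹ-congʳ (≈ᴹ-trans (*ₗ-congˡ fv≈0) (*ₗ-zeroʳ c)) ⟩
    0ᴹ +ᴹ act (toList (sub-scaled c xs f)) v  ≈⟨ +ᴹ-identityˡ _ ⟩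
    act (toList (sub-scaled c xs f)) v        ∎)

  -- Long division by a monic polynomial. Writing the degree of the dividend as `m + e` records that
  -- the quotient is again monic, of degree `m`.
  divide : ∀ m {e} (f : Vec K.Carrier (m ℕ.+ e)) (g : Vec K.Carrier e) →
    ∃₂ λ (q : Vec K.Carrier m) (r : Vec K.Carrier e) →
      ∀ v → monic f v ≈ᴹ monic q (monic g v) +ᴹ act (toList r) v
  divide zero f g = [] , sub-scaled K.1# f g , base f g
    where
    base : ∀ {e} (f g : Vec K.Carrier e) v → monic f v ≈ᴹ monic g v +ᴹ act (toList (sub-scaled K.1# f g)) v
    base []      []      v = ≈ᴹ-sym (+ᴹ-identityʳ v)
    base (a ∷ f) (b ∷ g) v = ≈ᴹ-trans
      (+ᴹ-cong (≈ᴹ-trans (*ₗ-congʳ (K.trans (coefficient K.1# a b) (K.+-congʳ (K.*-identityˡ b)))) (*ₗ-distribʳ v _ _))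
               (≈ᴹ-trans (τ-cong (base f g v)) (τ-+ _ _)))
      (interchange _ _ _ _)
  divide (suc m) (a ∷ f) g with divide m f g
  ... | q , r , f≈qg+r with initLast (a ∷ r)
  ... | xs , c , a∷r≡xs∷ʳc = c ∷ q , sub-scaled c xs g , λ v → begin
    a *ₗ v +ᴹ τ (monic f v)
      ≈⟨ +ᴹ-congˡ (≈ᴹ-trans (τ-cong (f≈qg+r v)) (τ-+ _ _)) ⟩
    a *ₗ v +ᴹ (τ (monic q (monic g v)) +ᴹ τ (act (toList r) v))
      ≈⟨ x∙yz≈y∙xz _ _ _ ⟩
    τ (monic q (monic g v)) +ᴹ act (toList (a ∷ r)) v
      ≡⟨ ≡.cong (λ s → τ (monic q (monic g v)) +ᴹ act (toList s) v) a∷r≡xs∷ʳc ⟩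
    τ (monic q (monic g v)) +ᴹ act (toList (xs ∷ʳ c)) v
      ≈⟨ +ᴹ-congˡ (act-∷ʳ c xs g v) ⟩
    τ (monic q (monic g v)) +ᴹ (c *ₗ monic g v +ᴹ act (toList (sub-scaled c xs g)) v)
      ≈⟨ x∙yz≈yx∙z _ _ _ ⟩
    (c *ₗ monic g v +ᴹ τ (monic q (monic g v))) +ᴹ act (toList (sub-scaled c xs g)) v  ∎

  neg : Poly → Poly
  neg = scale (K.- K.1#)

  act-neg : ∀ p v → act (neg p) v ≈ᴹ -ᴹ act p v
  act-neg p v = ≈ᴹ-trans (act-scale _ p v) (inverseʳ-uniqueᴹ _ _ (begin
    act p v +ᴹ (K.- K.1#) *ₗ act p v            ≈⟨ +ᴹ-congʳ (*ₗ-identityˡ _) ⟨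
    K.1# *ₗ act p v +ᴹ (K.- K.1#) *ₗ act p v    ≈⟨ *ₗ-distribʳ _ _ _ ⟨
    (K.1# K.- K.1#) *ₗ act p v                  ≈⟨ *ₗ-congʳ (K.-‿inverseʳ K.1#) ⟩
    K.0# *ₗ act p v                             ≈⟨ *ₗ-zeroˡ _ ⟩
    0ᴹ                                          ∎))

  act-1 : ∀ v → act (K.1# ∷ []) v ≈ᴹ v
  act-1 = act-fromMonic []

  act-const : ∀ a v → act (a ∷ []) v ≈ᴹ a *ₗ v
  act-const a v = ≈ᴹ-trans (+ᴹ-congˡ τ-0) (+ᴹ-identityʳ _)

  -- K[X] / Ann v
  cyclicRing : Carrierᴹ → CommutativeRing 0ℓ 0ℓ
  cyclicRing v = record
    { Carrier = Poly ; _≈_ = λ p q → act p v ≈ᴹ act q v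
    ; _+_ = _⊕_ ; _*_ = _⊗_ ; -_ = neg ; 0# = [] ; 1# = K.1# ∷ []
    ; isCommutativeRing = record
      { isRing = record
        { +-isAbelianGroup = record
          { isGroup = record
            { isMonoid = record
              { isSemigroup = record
                { isMagma = record
                  { isEquivalence = record { refl = ≈ᴹ-refl ; sym = ≈ᴹ-sym ; trans = ≈ᴹ-trans }
                  ; ∙-cong = λ {p} {p′} {q} {q′} p≈p′ q≈q′ →
                      ≈ᴹ-trans (act-⊕ p q v) (≈ᴹ-trans (+ᴹ-cong p≈p′ q≈q′) (≈ᴹ-sym (act-⊕ p′ q′ v))) }
                ; assoc = λ p q r → begin
                    act ((p ⊕ q) ⊕ r) v               ≈⟨ ≈ᴹ-trans (act-⊕ (p ⊕ q) r v) (+ᴹ-congʳ (act-⊕ p q v)) ⟩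
                    (act p v +ᴹ act q v) +ᴹ act r v   ≈⟨ +ᴹ-assoc _ _ _ ⟩
                    act p v +ᴹ (act q v +ᴹ act r v)   ≈⟨ ≈ᴹ-trans (act-⊕ p (q ⊕ r) v) (+ᴹ-congˡ (act-⊕ q r v)) ⟨
                    act (p ⊕ (q ⊕ r)) v               ∎ }
              ; identity = (λ p → ≈ᴹ-refl) , (λ p → ≈ᴹ-trans (act-⊕ p [] v) (+ᴹ-identityʳ _)) }
            ; inverse = (λ p → ≈ᴹ-trans (act-⊕ (neg p) p v) (≈ᴹ-trans (+ᴹ-congʳ (act-neg p v)) (-ᴹ‿inverseˡ _)))
                      , (λ p → ≈ᴹ-trans (act-⊕ p (neg p) v) (≈ᴹ-trans (+ᴹ-congˡ (act-neg p v)) (-ᴹ‿inverseʳ _)))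
            ; ⁻¹-cong = λ {p} {q} p≈q → ≈ᴹ-trans (act-neg p v) (≈ᴹ-trans (-ᴹ‿cong p≈q) (≈ᴹ-sym (act-neg q v))) }
          ; comm = +-comm′ }
        ; *-cong = λ {p} {p′} {q} {q′} p≈p′ q≈q′ → begin
            act (p ⊗ q) v       ≈⟨ act-⊗ p q v ⟩
            act p (act q v)     ≈⟨ act-cong p q≈q′ ⟩
            act p (act q′ v)    ≈⟨ act-comm p q′ v ⟩
            act q′ (act p v)    ≈⟨ act-cong q′ p≈p′ ⟩
            act q′ (act p′ v)   ≈⟨ act-comm q′ p′ v ⟩
            act p′ (act q′ v)   ≈⟨ act-⊗ p′ q′ v ⟨
            act (p′ ⊗ q′) v     ∎
        ; *-assoc = λ p q r → begin
            act ((p ⊗ q) ⊗ r) v       ≈⟨ act-⊗ (p ⊗ q) r v ⟩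
            act (p ⊗ q) (act r v)     ≈⟨ act-⊗ p q (act r v) ⟩
            act p (act q (act r v))   ≈⟨ act-cong p (act-⊗ q r v) ⟨
            act p (act (q ⊗ r) v)     ≈⟨ act-⊗ p (q ⊗ r) v ⟨
            act (p ⊗ (q ⊗ r)) v       ∎
        ; *-identity = (λ p → ≈ᴹ-trans (act-⊗ (K.1# ∷ []) p v) (act-1 _)) , (λ p → ≈ᴹ-trans (act-⊗ p (K.1# ∷ []) v) (act-cong p (act-1 v)))
        ; distrib = (λ p q r → begin
              act (p ⊗ (q ⊕ r)) v                    ≈⟨ ≈ᴹ-trans (act-⊗ p (q ⊕ r) v) (act-cong p (act-⊕ q r v)) ⟩
              act p (act q v +ᴹ act r v)             ≈⟨ act-+ᴹ p _ _ ⟩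
              act p (act q v) +ᴹ act p (act r v)     ≈⟨ +ᴹ-cong (act-⊗ p q v) (act-⊗ p r v) ⟨
              act (p ⊗ q) v +ᴹ act (p ⊗ r) v         ≈⟨ act-⊕ (p ⊗ q) (p ⊗ r) v ⟨
              act (p ⊗ q ⊕ p ⊗ r) v                  ∎)
          , (λ r p q → begin
              act ((p ⊕ q) ⊗ r) v                    ≈⟨ act-⊗ (p ⊕ q) r v ⟩
              act (p ⊕ q) (act r v)                  ≈⟨ act-⊕ p q (act r v) ⟩
              act p (act r v) +ᴹ act q (act r v)     ≈⟨ +ᴹ-cong (act-⊗ p r v) (act-⊗ q r v) ⟨
              act (p ⊗ r) v +ᴹ act (q ⊗ r) v         ≈⟨ act-⊕ (p ⊗ r) (q ⊗ r) v ⟨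
              act (p ⊗ r ⊕ q ⊗ r) v                  ∎) }
      ; *-comm = λ p q → ≈ᴹ-trans (act-⊗ p q v) (≈ᴹ-trans (act-comm p q v) (≈ᴹ-sym (act-⊗ q p v))) } }
    where
    +-comm′ : ∀ p q → act (p ⊕ q) v ≈ᴹ act (q ⊕ p) v
    +-comm′ p q = ≈ᴹ-trans (act-⊕ p q v) (≈ᴹ-trans (+ᴹ-comm _ _) (≈ᴹ-sym (act-⊕ q p v)))

  -- A constructive substitute for adjoining a root of p: descending to
  -- cyclic submodules of smaller degree must end in a field K[X] / Ann v.
  module Root
    (_≟ᴹ_ : Decidable _≈ᴹ_)
    (p : Poly) (p-kills : ∀ v → act p v ≈ᴹ 0ᴹ)
    (rootsIn : ContainsRoots K p)
    (noRoot : ∀ a → ¬ (evaluate K (λ b → b) p a K.≈ K.0#))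
    where

    private
      NoneOfDegree : ℕ → Set
      NoneOfDegree n = ∀ v → ¬ (v ≈ᴹ 0ᴹ) → (f : Vec K.Carrier n) → monic f v ≈ᴹ 0ᴹ → ⊥

      module _ {n} (smaller : ∀ {m} → m ℕ.< n → NoneOfDegree m)
               v (v≉0 : ¬ (v ≈ᴹ 0ᴹ)) (f : Vec K.Carrier n) (fv≈0 : monic f v ≈ᴹ 0ᴹ) where

        -- The Euclidean algorithm. Let g′ be `g` made monic and f = q g′ + r. If r v ≠ 0, the
        -- recursion inverts r, and with it g′, because r v = - q g′ v. If r v = 0, then q kills g′
        -- v ≠ 0, which the minimality of `n` forbids unless g′ = 1. The variable copy `n′` of the
        -- fixed `n` allows matching on `eq`.
        invert : ∀ {n′} → n′ ≡ n → (f : Vec K.Carrier n′) → monic f v ≈ᴹ 0ᴹ →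
          ∀ {m} k → n′ ≡ k ℕ.+ m → (g : Vec K.Carrier m) →
          ¬ (act (toList g) v ≈ᴹ 0ᴹ) → ∃[ q ] act q (act (toList g) v) ≈ᴹ v
        invert n′≡n f fv≈0 {zero} k eq [] gv≉0 = ⊥-elim (gv≉0 ≈ᴹ-refl)
        invert n′≡n f fv≈0 {suc e} k eq g gv≉0 with initLast g
        invert n′≡n f fv≈0 {suc e} k ≡.refl .(xs ∷ʳ c) gv≉0 | xs , c , ≡.refl with c K.≟ K.0#
        ... | yes c≈0 =
          let q , qxs = invert n′≡n f fv≈0 (suc k) (ℕₚ.+-suc k e) xs (λ xsv≈0 → gv≉0 (≈ᴹ-trans (act-∷ʳ-0 xs v c≈0) xsv≈0))
          in q , ≈ᴹ-trans (act-cong q (act-∷ʳ-0 xs v c≈0)) qxs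
        ... | no c≉0 = result
          where
          d   = proj₁ (K.inverse c c≉0)
          dc  = proj₁ (proj₂ (K.inverse c c≉0))
          g′  = Vec.map (d K.*_) xs
          f′  : Vec K.Carrier (suc k ℕ.+ e)
          f′  = ≡.subst (Vec K.Carrier) (ℕₚ.+-suc k e) f
          monic-subst : ∀ {m m′} (m≡m′ : m ≡ m′) (h : Vec K.Carrier m) →
            monic (≡.subst (Vec K.Carrier) m≡m′ h) v ≈ᴹ monic h v
          monic-subst ≡.refl h = ≈ᴹ-refl
          f′v≈0 = ≈ᴹ-trans (monic-subst (ℕₚ.+-suc k e) f) fv≈0
          division = divide (suc k) f′ g′
          q = proj₁ division
          r = proj₁ (proj₂ division)
          qg′v+rv≈0 = ≈ᴹ-trans (≈ᴹ-sym (proj₂ (proj₂ division) v)) f′v≈0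
          gv≈cg′v = act-∷ʳ-monic xs v dc
          g′v≉0 : ¬ (monic g′ v ≈ᴹ 0ᴹ)
          g′v≉0 g′v≈0 = gv≉0 (≈ᴹ-trans gv≈cg′v (≈ᴹ-trans (*ₗ-congˡ g′v≈0) (*ₗ-zeroʳ c)))
          dgv≈g′v : d *ₗ act (toList (xs ∷ʳ c)) v ≈ᴹ monic g′ v
          dgv≈g′v = begin
            d *ₗ act (toList (xs ∷ʳ c)) v   ≈⟨ *ₗ-congˡ gv≈cg′v ⟩
            d *ₗ c *ₗ monic g′ v            ≈⟨ *ₗ-assoc d c _ ⟨
            (d K.* c) *ₗ monic g′ v         ≈⟨ *ₗ-congʳ dc ⟩
            K.1# *ₗ monic g′ v              ≈⟨ *ₗ-identityˡ _ ⟩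
            monic g′ v                      ∎

          constant : ∀ {e} (xs : Vec K.Carrier e) → e ≡ 0 → monic (Vec.map (d K.*_) xs) v ≈ᴹ v
          constant [] eq = ≈ᴹ-refl

          rv≈0-case : act (toList r) v ≈ᴹ 0ᴹ → e ≡ 0
          rv≈0-case rv≈0 with e ℕₚ.≟ 0
          ... | yes e≡0 = e≡0
          ... | no  e≢0 = ⊥-elim (smaller
            (≡.subst (suc k ℕ.<_) (≡.trans (≡.sym (ℕₚ.+-suc k e)) n′≡n) (ℕ.s≤s (ℕₚ.m<m+n k (ℕₚ.n≢0⇒n>0 e≢0))))
            (monic g′ v) g′v≉0 q qg′v≈0)
            where
            qg′v≈0 : monic q (monic g′ v) ≈ᴹ 0ᴹ
            qg′v≈0 = ≈ᴹ-trans (≈ᴹ-sym (+ᴹ-identityʳ _)) (≈ᴹ-trans (+ᴹ-congˡ (≈ᴹ-sym rv≈0)) qg′v+rv≈0)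

          result : ∃[ q ] act q (act (toList (xs ∷ʳ c)) v) ≈ᴹ v
          result with act (toList r) v ≟ᴹ 0ᴹ
          ... | yes rv≈0 = (d ∷ []) , ≈ᴹ-trans (act-const d _) (≈ᴹ-trans dgv≈g′v (constant xs (rv≈0-case rv≈0)))
          ... | no rv≉0 with invert n′≡n f fv≈0 (suc k) (ℕₚ.+-suc k e) r rv≉0
          ... | s , srv≈v = (s ⊗ neg (fromMonic q)) ⊗ (d ∷ []) , (begin
            act ((s ⊗ neg (fromMonic q)) ⊗ (d ∷ [])) gv   ≈⟨ act-⊗ (s ⊗ neg (fromMonic q)) (d ∷ []) _ ⟩
            act (s ⊗ neg (fromMonic q)) (act (d ∷ []) gv) ≈⟨ act-cong (s ⊗ neg (fromMonic q)) (≈ᴹ-trans (act-const d _) dgv≈g′v) ⟩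
            act (s ⊗ neg (fromMonic q)) (monic g′ v)      ≈⟨ act-⊗ s _ _ ⟩
            act s (act (neg (fromMonic q)) (monic g′ v))
              ≈⟨ act-cong s (≈ᴹ-trans (act-neg (fromMonic q) _) (-ᴹ‿cong (act-fromMonic q _))) ⟩
            act s (-ᴹ monic q (monic g′ v))               ≈⟨ act-cong s (≈ᴹ-sym (inverseʳ-uniqueᴹ _ _ qg′v+rv≈0)) ⟩
            act s (act (toList r) v)                      ≈⟨ srv≈v ⟩
            v                                             ∎)
            where gv = act (toList (xs ∷ʳ c)) v

        field′ : Field
        field′ = record
          { commutativeRing = cyclicRing v
          ; _≟_ = λ p q → act p v ≟ᴹ act q v
          ; 0≉1 = λ 0≈v → v≉0 (≈ᴹ-sym (≈ᴹ-trans 0≈v (act-1 v)))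
          ; inverse = λ g gv≉0 →
              let r , gv≈rv = reduce f v fv≈0 g
                  q , qrv≈v = invert ≡.refl f fv≈0 0 ≡.refl r (λ rv≈0 → gv≉0 (≈ᴹ-trans gv≈rv rv≈0))
                  qg≈1 = ≈ᴹ-trans (act-⊗ q g v) (≈ᴹ-trans (act-cong q gv≈rv) (≈ᴹ-trans qrv≈v (≈ᴹ-sym (act-1 v))))
              in q , qg≈1 , ≈ᴹ-trans (act-⊗ g q v) (≈ᴹ-trans (act-comm g q v) (≈ᴹ-trans (≈ᴹ-sym (act-⊗ q g v)) qg≈1))
          }

        extension : Extension K
        extension = record
          { top = field′
          ; ι = λ a → a ∷ []
          ; isRingHomomorphism = record
            { isSemiringHomomorphism = record
              { isNearSemiringHomomorphism = record
                { +-isMonoidHomomorphism = record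
                  { isMagmaHomomorphism = record
                    { isRelHomomorphism = record { cong = λ a≈b → +ᴹ-congʳ (*ₗ-congʳ a≈b) }
                    ; homo = λ a b → ≈ᴹ-refl }
                  ; ε-homo = ≈ᴹ-trans (act-const K.0# v) (*ₗ-zeroˡ v) }
                ; *-homo = λ a b → +ᴹ-cong (*ₗ-congʳ (K.sym (K.+-identityʳ _))) ≈ᴹ-refl }
              ; 1#-homo = ≈ᴹ-refl }
            ; -‿homo = λ a → +ᴹ-congʳ (*ₗ-congʳ (K.sym (RingProperties.-1*x≈-x K.ring a))) } }

        X : Poly
        X = K.0# ∷ K.1# ∷ []

        act-X : ∀ w → act X w ≈ᴹ τ w
        act-X w = ≈ᴹ-trans (+ᴹ-cong (*ₗ-zeroˡ w) (τ-cong (act-1 w))) (+ᴹ-identityˡ _)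

        evaluate-X : ∀ p → act (evaluate field′ (λ a → a ∷ []) p X) v ≈ᴹ act p v
        evaluate-X []      = ≈ᴹ-refl
        evaluate-X (a ∷ p) = begin
          act ((a ∷ []) ⊕ X ⊗ e) v           ≈⟨ act-⊕ (a ∷ []) (X ⊗ e) v ⟩
          act (a ∷ []) v +ᴹ act (X ⊗ e) v    ≈⟨ +ᴹ-cong (act-const a v) (≈ᴹ-trans (act-⊗ X e v) (act-X _)) ⟩
          a *ₗ v +ᴹ τ (act e v)              ≈⟨ +ᴹ-congˡ (τ-cong (evaluate-X p)) ⟩
          a *ₗ v +ᴹ τ (act p v)              ∎
          where e = evaluate field′ (λ a → a ∷ []) p X

        -- In the field K[X] / Ann v the class of X is a root of `p`, because `p` kills `v`. By
        -- `rootsIn` it comes from an element of `K`, which is then a root as well.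
        contradiction : ⊥
        contradiction =
          let pX≈0 = ≈ᴹ-trans (evaluate-X p) (p-kills v)
              a , ιa≈X = rootsIn extension X pX≈0
          in noRoot a (ι≈0⇒≈0 (≈ᴹ-trans (evaluate-ι p a) (≈ᴹ-trans (evaluate-cong field′ _ p ιa≈X) pX≈0)))
          where open ExtensionProperties extension

    noMonicAnnihilator : ∀ {n} → NoneOfDegree n
    noMonicAnnihilator {n} = <-rec NoneOfDegree (λ n smaller → contradiction smaller) n

-- Graphs and walks

module FieldProperties (F : Field) where
  open Field F
  open IntegerCoefficients commutativeRing
  open SetoidReasoning setoid

  x-y≈0⇒x≈y : ∀ {x y} → x - y ≈ 0# → x ≈ y
  x-y≈0⇒x≈y {x} {y} x-y≈0 = begin
    x            ≈⟨ solve 2 (λ x y → x := (x :- y) :+ y) refl x y ⟩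
    (x - y) + y  ≈⟨ +-congʳ x-y≈0 ⟩
    0# + y       ≈⟨ +-identityˡ y ⟩
    y            ∎

  x*y≈0⇒x≈0∨y≈0 : ∀ {x y} → x * y ≈ 0# → x ≈ 0# ⊎ y ≈ 0#
  x*y≈0⇒x≈0∨y≈0 {x} {y} xy≈0 with x ≟ 0#
  ... | yes x≈0 = inj₁ x≈0
  ... | no  x≉0 = inj₂ (begin
    y              ≈⟨ *-identityˡ y ⟨
    1# * y         ≈⟨ *-congʳ (proj₁ (proj₂ (inverse x x≉0))) ⟨
    x⁻¹ * x * y    ≈⟨ *-assoc x⁻¹ x y ⟩
    x⁻¹ * (x * y)  ≈⟨ *-congˡ xy≈0 ⟩
    x⁻¹ * 0#       ≈⟨ zeroʳ x⁻¹ ⟩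
    0#             ∎)
    where x⁻¹ = proj₁ (inverse x x≉0)

module _ {F : Field} (E : Extension F) where
  open ExtensionProperties E
  private
    module F = Field F
    module FZ = IntegerCoefficients F.commutativeRing
    module FM = Multiples F.semiring
  open Field top
  private
    module EZ = IntegerCoefficients commutativeRing
    module EM = Multiples semiring

  private
    ι-× : ∀ n → ι (n FM.× F.1#) ≈ n EM.× 1#
    ι-× zero    = ι-0
    ι-× (suc n) = trans (ι-cong (FM.1+× n F.1#)) (trans (ι-+ _ _) (trans (+-cong ι-1 (ι-× n)) (sym (EM.1+× n 1#))))

  ι-fromℤ : ∀ i → ι (FZ.fromℤ i) ≈ EZ.fromℤ i
  ι-fromℤ (+ n)    = ι-× n
  ι-fromℤ -[1+ n ] = trans (ι-neg _) (-‿cong (ι-× (suc n)))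

  integerRoot : ∀ i {x} → x - EZ.fromℤ i ≈ 0# → InBase x
  integerRoot i x-i≈0 = FZ.fromℤ i , trans (ι-fromℤ i) (sym (FieldProperties.x-y≈0⇒x≈y top x-i≈0))

-- R[X] / (X² - s X - t)
module Quadratic {a ℓ} (R : CommutativeRing a ℓ) (s t : CommutativeRing.Carrier R) where
  open CommutativeRing R
  open IntegerCoefficients R

  private
    mul : Carrier × Carrier → Carrier × Carrier → Carrier × Carrier
    mul (a , b) (c , d) = a * c + t * (b * d) , a * d + b * c + s * (b * d)

  quadraticRing : CommutativeRing a ℓ
  quadraticRing = record
    { Carrier = Carrier × Carrier
    ; _≈_ = λ { (a , b) (c , d) → (a ≈ c) × (b ≈ d) }
    ; _+_ = λ { (a , b) (c , d) → a + c , b + d }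
    ; _*_ = mul
    ; -_ = λ { (a , b) → - a , - b }
    ; 0# = 0# , 0#
    ; 1# = 1# , 0#
    ; isCommutativeRing = record
      { isRing = record
        { +-isAbelianGroup = record
          { isGroup = record
            { isMonoid = record
              { isSemigroup = record
                { isMagma = record
                  { isEquivalence = record
                    { refl = refl , refl
                    ; sym = λ { (p , q) → sym p , sym q }
                    ; trans = λ { (p , q) (p′ , q′) → trans p p′ , trans q q′ } }
                  ; ∙-cong = λ { (p , q) (p′ , q′) → +-cong p p′ , +-cong q q′ } }
                ; assoc = λ _ _ _ → +-assoc _ _ _ , +-assoc _ _ _ }
              ; identity = (λ _ → +-identityˡ _ , +-identityˡ _) , (λ _ → +-identityʳ _ , +-identityʳ _) }
            ; inverse = (λ _ → -‿inverseˡ _ , -‿inverseˡ _) , (λ _ → -‿inverseʳ _ , -‿inverseʳ _)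
            ; ⁻¹-cong = λ { (p , q) → -‿cong p , -‿cong q } }
          ; comm = λ _ _ → +-comm _ _ , +-comm _ _ }
        ; *-cong = λ { (p , q) (p′ , q′) →
            +-cong (*-cong p p′) (*-congˡ (*-cong q q′))
          , +-cong (+-cong (*-cong p q′) (*-cong q p′)) (*-congˡ (*-cong q q′)) }
        ; *-assoc = λ { (a , b) (c , d) (e , f) →
            solve 8 (λ s t a b c d e f →
                (a :* c :+ t :* (b :* d)) :* e :+ t :* ((a :* d :+ b :* c :+ s :* (b :* d)) :* f)
              := a :* (c :* e :+ t :* (d :* f)) :+ t :* (b :* (c :* f :+ d :* e :+ s :* (d :* f)))) refl s t a b c d e f
          , solve 8 (λ s t a b c d e f →
                (a :* c :+ t :* (b :* d)) :* f :+ (a :* d :+ b :* c :+ s :* (b :* d)) :* e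
                  :+ s :* ((a :* d :+ b :* c :+ s :* (b :* d)) :* f)
              := a :* (c :* f :+ d :* e :+ s :* (d :* f)) :+ b :* (c :* e :+ t :* (d :* f))
                  :+ s :* (b :* (c :* f :+ d :* e :+ s :* (d :* f)))) refl s t a b c d e f }
        ; *-identity =
            (λ { (a , b) → solve 3 (λ a b t → con (+ 1) :* a :+ t :* (con (+ 0) :* b) := a) refl a b t
                         , solve 3 (λ a b s → con (+ 1) :* b :+ con (+ 0) :* a :+ s :* (con (+ 0) :* b) := b) refl a b s })
          , (λ { (a , b) → solve 3 (λ a b t → a :* con (+ 1) :+ t :* (b :* con (+ 0)) := a) refl a b t
                         , solve 3 (λ a b s → a :* con (+ 0) :+ b :* con (+ 1) :+ s :* (b :* con (+ 0)) := b) refl a b s })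
        ; distrib =
            (λ { (a , b) (c , d) (e , f) →
              solve 7 (λ t a b c d e f → a :* (c :+ e) :+ t :* (b :* (d :+ f))
                := (a :* c :+ t :* (b :* d)) :+ (a :* e :+ t :* (b :* f))) refl t a b c d e f
            , solve 7 (λ s a b c d e f → a :* (d :+ f) :+ b :* (c :+ e) :+ s :* (b :* (d :+ f))
                := (a :* d :+ b :* c :+ s :* (b :* d)) :+ (a :* f :+ b :* e :+ s :* (b :* f))) refl s a b c d e f })
          , (λ { (a , b) (c , d) (e , f) →
              solve 7 (λ t a b c d e f → (c :+ e) :* a :+ t :* ((d :+ f) :* b)
                := (c :* a :+ t :* (d :* b)) :+ (e :* a :+ t :* (f :* b))) refl t a b c d e f
            , solve 7 (λ s a b c d e f → (c :+ e) :* b :+ (d :+ f) :* a :+ s :* ((d :+ f) :* b)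
                := (c :* b :+ d :* a :+ s :* (d :* b)) :+ (e :* b :+ f :* a :+ s :* (f :* b))) refl s a b c d e f }) }
      ; *-comm = λ { (a , b) (c , d) →
            solve 5 (λ t a b c d → a :* c :+ t :* (b :* d) := c :* a :+ t :* (d :* b)) refl t a b c d
          , solve 5 (λ s a b c d → a :* d :+ b :* c :+ s :* (b :* d) := c :* b :+ d :* a :+ s :* (d :* b)) refl s a b c d } } }

  private module Q = CommutativeRing quadraticRing

  embed : Carrier → Q.Carrier
  embed a = a , 0#

  generator : Q.Carrier
  generator = 0# , 1#

  embed-+ : ∀ a b → embed (a + b) Q.≈ embed a Q.+ embed b
  embed-+ a b = refl , sym (+-identityʳ 0#)

  embed-* : ∀ a b → embed (a * b) Q.≈ embed a Q.* embed b
  embed-* a b =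
      solve 3 (λ t a b → a :* b := a :* b :+ t :* (con (+ 0) :* con (+ 0))) refl t a b
    , solve 3 (λ s a b → con (+ 0) := a :* con (+ 0) :+ con (+ 0) :* b :+ s :* (con (+ 0) :* con (+ 0))) refl s a b

  -- The trailing `Q.0#` makes the right side literally a `combination` over the basis 1, X.
  decompose : ∀ a b → (a , b) Q.≈ embed a Q.* Q.1# Q.+ (embed b Q.* generator Q.+ Q.0#)
  decompose a b =
      solve 3 (λ t a b → a := (a :* con (+ 1) :+ t :* (con (+ 0) :* con (+ 0))) :+ ((b :* con (+ 0) :+ t :* (con (+ 0) :* con (+ 1))) :+ con (+ 0))) refl t a b
    , solve 3 (λ s a b → b := (a :* con (+ 0) :+ con (+ 0) :* con (+ 1) :+ s :* (con (+ 0) :* con (+ 0)))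
        :+ ((b :* con (+ 1) :+ con (+ 0) :* con (+ 0) :+ s :* (con (+ 0) :* con (+ 1))) :+ con (+ 0))) refl s a b

  -- The conjugation X ↦ s - X sends a + b X to (a + s b) - b X; the product is the norm.
  conjugate : ∀ a b → (a , b) Q.* (a + s * b , - b) Q.≈ embed (a * a + s * (a * b) - t * (b * b))
  conjugate a b =
      solve 4 (λ s t a b → a :* (a :+ s :* b) :+ t :* (b :* (:- b)) := a :* a :+ s :* (a :* b) :- t :* (b :* b)) refl s t a b
    , solve 3 (λ s a b → a :* (:- b) :+ b :* (a :+ s :* b) :+ s :* (b :* (:- b)) := con (+ 0)) refl s a b

module Powers {a ℓ} (R : CommutativeRing a ℓ) where
  open CommutativeRing R
  open RawMonoidDefinitions *-rawMonoid public using () renaming (_×_ to _^[_])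

-- x = ζ + ζ⁻¹ for an N-th root of unity ζ
record IsRootOfUnityTrace {a ℓ} (R : CommutativeRing a ℓ) (N : ℕ) (x : CommutativeRing.Carrier R) : Set ℓ where
  open CommutativeRing R
  open Quadratic R x (- 1#)
  open Powers quadraticRing
  private module Q = CommutativeRing quadraticRing
  field
    ζᴺ≈1 : N ^[ generator ] Q.≈ Q.1#

module SumProperties (F : Field) where
  open Field F
  open SemiringSum semiring hiding (sum)
  open IntegerCoefficients commutativeRing
  open SetoidReasoning setoid

  δ : ∀ {n} → Fin n → Fin n → Carrier
  δ i j = if does (i Finₚ.≟ j) then 1# else 0#

  sum-zero : ∀ {n} (f : Fin n → Carrier) → (∀ i → f i ≈ 0#) → sum f ≈ 0#
  sum-zero {n} f f≈0 = trans (sum-cong-≋ {n} f≈0) (sum-replicate-zero n)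

  sum-δ : ∀ {n} (i : Fin n) (f : Fin n → Carrier) → sum (λ j → δ i j * f j) ≈ f i
  sum-δ {suc n} zero f = trans (+-cong (*-identityˡ _) (sum-zero {n} (λ j → 0# * f (suc j)) (λ j → zeroˡ _))) (+-identityʳ _)
  sum-δ {suc n} (suc i) f = trans (+-cong (zeroˡ _) (sum-δ i (f ∘ suc))) (+-identityˡ _)

  sumTo : ℕ → (ℕ → Carrier) → Carrier
  sumTo zero    f = 0#
  sumTo (suc n) f = f 0 + sumTo n (f ∘ suc)

  sumTo-cong : ∀ n {f g : ℕ → Carrier} → (∀ k → f k ≈ g k) → sumTo n f ≈ sumTo n g
  sumTo-cong zero    f≈g = refl
  sumTo-cong (suc n) f≈g = +-cong (f≈g 0) (sumTo-cong n (f≈g ∘ suc))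

  sumTo-zero : ∀ n {f : ℕ → Carrier} → (∀ k → k ℕ.< n → f k ≈ 0#) → sumTo n f ≈ 0#
  sumTo-zero zero    f≈0 = refl
  sumTo-zero (suc n) f≈0 = trans (+-cong (f≈0 0 ℕ.z<s) (sumTo-zero n (λ k k<n → f≈0 (suc k) (ℕ.s<s k<n)))) (+-identityˡ 0#)

  sumTo-last : ∀ n (f : ℕ → Carrier) → sumTo (suc n) f ≈ sumTo n f + f n
  sumTo-last zero    f = +-comm _ _
  sumTo-last (suc n) f = trans (+-congˡ (sumTo-last n (f ∘ suc))) (sym (+-assoc _ _ _))

  sumTo-rotate : ∀ n (f : ℕ → Carrier) → f n ≈ f 0 → sumTo n (f ∘ suc) ≈ sumTo n f
  sumTo-rotate n f fn≈f0 = begin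
    sumTo n (f ∘ suc)                       ≈⟨ solve 2 (λ a s → s := (a :+ s) :- a) refl (f 0) _ ⟩
    sumTo (suc n) f - f 0                   ≈⟨ +-cong (sumTo-last n f) (-‿cong (sym fn≈f0)) ⟩
    (sumTo n f + f n) - f n                 ≈⟨ solve 2 (λ a s → (s :+ a) :- a := s) refl (f n) _ ⟩
    sumTo n f                               ∎

  sumTo-+ : ∀ n (f g : ℕ → Carrier) → sumTo n (λ k → f k + g k) ≈ sumTo n f + sumTo n g
  sumTo-+ zero    f g = sym (+-identityˡ 0#)
  sumTo-+ (suc n) f g = trans (+-congˡ (sumTo-+ n (f ∘ suc) (g ∘ suc)))
    (solve 4 (λ a b c d → (a :+ b) :+ (c :+ d) := (a :+ c) :+ (b :+ d)) refl _ _ _ _)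

  sumTo-* : ∀ n a (f : ℕ → Carrier) → sumTo n (λ k → a * f k) ≈ a * sumTo n f
  sumTo-* zero    a f = sym (zeroʳ a)
  sumTo-* (suc n) a f = trans (+-congˡ (sumTo-* n a (f ∘ suc))) (sym (distribˡ a _ _))

  sum-sumTo : ∀ {m} n (a : Fin m → Carrier) (f : ℕ → Fin m → Carrier) →
    sum (λ j → a j * sumTo n (λ k → f k j)) ≈ sumTo n (λ k → sum (λ j → a j * f k j))
  sum-sumTo {m} zero a f = sum-zero {m} _ (λ j → zeroʳ _)
  sum-sumTo {m} (suc n) a f = begin
    sum (λ j → a j * (f 0 j + sumTo n (λ k → f (suc k) j)))
      ≈⟨ sum-cong-≋ {m} (λ j → distribˡ (a j) _ _) ⟩
    sum (λ j → a j * f 0 j + a j * sumTo n (λ k → f (suc k) j))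
      ≈⟨ ∑-distrib-+ (λ j → a j * f 0 j) _ ⟩
    sum (λ j → a j * f 0 j) + sum (λ j → a j * sumTo n (λ k → f (suc k) j))
      ≈⟨ +-congˡ (sum-sumTo n a (f ∘ suc)) ⟩
    sum (λ j → a j * f 0 j) + sumTo n (λ k → sum (λ j → a j * f (suc k) j)) ∎

module _ {n} (Γ : Graph n) where
  open Graph Γ using (_∼_; _∼?_) renaming (sym to ∼-sym)

  record HasNeighbours (i a b : Fin n) : Set where
    field
      a≢b        : a ≢ b
      neighbours : ∀ j → i ∼ j ⇔ (j ≡ a ⊎ j ≡ b)

  -- The walk never turns back, and its two adjacent vertices are all the neighbours of a vertex, so
  -- it runs around a whole cycle. It is infinite; closing up is expressed by periodicity.
  IsWalk : (ℕ → Fin n) → Set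
  IsWalk x = ∀ k → HasNeighbours (x (suc k)) (x k) (x (suc (suc k)))

  module WalkProperties (F : Field) where
    open Field F
    open SumProperties F
    open SemiringSum semiring hiding (sum)
    open SetoidReasoning setoid
    open IntegerCoefficients commutativeRing
    private A = adjacencyMatrix Γ F

    A-sym : ∀ i j → A i j ≈ A j i
    A-sym i j with i ∼? j | j ∼? i
    ... | yes p | yes q = refl
    ... | yes p | no ¬q = ⊥-elim (¬q (∼-sym p))
    ... | no ¬p | yes q = ⊥-elim (¬p (∼-sym q))
    ... | no ¬p | no ¬q = refl

    module _ {i a b} (nbrs : HasNeighbours i a b) where
      open HasNeighbours nbrs

      A-neighbours : ∀ j → A i j ≈ δ a j + δ b j
      A-neighbours j with i ∼? j | a Finₚ.≟ j | b Finₚ.≟ j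
      ... | yes p | yes q | yes r = ⊥-elim (a≢b (≡.trans q (≡.sym r)))
      ... | yes p | yes q | no ¬r = sym (+-identityʳ 1#)
      ... | yes p | no ¬q | yes r = sym (+-identityˡ 1#)
      ... | yes p | no ¬q | no ¬r = ⊥-elim ([ ¬q ∘ ≡.sym , ¬r ∘ ≡.sym ] (Equivalence.to (neighbours j) p))
      ... | no ¬p | yes q | _     = ⊥-elim (¬p (Equivalence.from (neighbours j) (inj₁ (≡.sym q))))
      ... | no ¬p | no ¬q | yes r = ⊥-elim (¬p (Equivalence.from (neighbours j) (inj₂ (≡.sym r))))
      ... | no ¬p | no ¬q | no ¬r = sym (+-identityʳ 0#)

      sum-neighbours : ∀ (f : Fin n → Carrier) → sum (λ j → A i j * f j) ≈ f a + f b
      sum-neighbours f = begin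
        sum (λ j → A i j * f j)                          ≈⟨ sum-cong-≋ {n} (λ j → trans (*-congʳ (A-neighbours j)) (distribʳ _ _ _)) ⟩
        sum (λ j → δ a j * f j + δ b j * f j)            ≈⟨ ∑-distrib-+ (λ j → δ a j * f j) _ ⟩
        sum (λ j → δ a j * f j) + sum (λ j → δ b j * f j) ≈⟨ +-cong (sum-δ a f) (sum-δ b f) ⟩
        f a + f b                                        ∎

    walk-recurrence : ∀ {x μ v} → IsWalk x → (∀ i → sum (λ j → A i j * v j) ≈ μ * v i) →
      ∀ k → v (x k) + v (x (2 ℕ.+ k)) ≈ μ * v (x (suc k))
    walk-recurrence {x} {μ} {v} walk eigen k = trans (sym (sum-neighbours (walk k) v)) (eigen (x (suc k)))

    module _ {x : ℕ → Fin n} (walk : IsWalk x) (N : ℕ) {μ : Carrier} {c : ℕ → Carrier}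
             (recurrence : ∀ k → c k + c (2 ℕ.+ k) ≈ μ * c (suc k))
             (x-period₀ : x N ≡ x 0) (x-period₁ : x (suc N) ≡ x 1)
             (c-period₀ : c N ≈ c 0) (c-period₁ : c (suc N) ≈ c 1)
             where

      -- The sequence `c` wrapped around the cycle. A vertex visited several times collects the sum
      -- of its values, which keeps the eigenvector equation a mere shift of sums over a period.
      walkVector : Fin n → Carrier
      walkVector i = sumTo N (λ k → c k * δ (x k) i)

      -- By symmetry of the matrix, each term is a value of `c` times the two indicators of the
      -- neighbours on the walk. Shifting both sums over a period collects c k + c (k + 2) at
      -- `x (k + 1)`.
      walkVector-eigen : ∀ i → sum (λ j → A i j * walkVector j) ≈ μ * walkVector i
      walkVector-eigen i = begin
        sum (λ j → A i j * walkVector j)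
          ≈⟨ sum-sumTo N (A i) (λ k j → c k * δ (x k) j) ⟩
        sumTo N (λ k → sum (λ j → A i j * (c k * δ (x k) j)))
          ≈⟨ sumTo-cong N (λ k → trans
               (sum-cong-≋ {n} (λ j → solve 3 (λ a c d → a :* (c :* d) := d :* (c :* a)) refl (A i j) (c k) (δ (x k) j)))
               (trans (sum-δ (x k) (λ j → c k * A i j)) (*-congˡ (A-sym i (x k))))) ⟩
        sumTo N (λ k → c k * A (x k) i)
          ≈⟨ sumTo-rotate N (λ k → c k * A (x k) i) (*-cong c-period₀ (reflexive (≡.cong (λ y → A y i) x-period₀))) ⟨
        sumTo N (λ k → c (suc k) * A (x (suc k)) i)
          ≈⟨ sumTo-cong N (λ k → trans (*-congˡ (A-neighbours (walk k) i)) (distribˡ _ _ _)) ⟩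
        sumTo N (λ k → c (suc k) * δ (x k) i + c (suc k) * δ (x (2 ℕ.+ k)) i)
          ≈⟨ sumTo-+ N (λ k → c (suc k) * δ (x k) i) _ ⟩
        sumTo N (λ k → c (suc k) * δ (x k) i) + sumTo N (λ k → c (suc k) * δ (x (2 ℕ.+ k)) i)
          ≈⟨ +-cong
               (sym (sumTo-rotate N (λ k → c (suc k) * δ (x k) i) (*-cong c-period₁ (reflexive (≡.cong (λ y → δ y i) x-period₀)))))
               (sumTo-rotate N (λ k → c k * δ (x (suc k)) i) (*-cong c-period₀ (reflexive (≡.cong (λ y → δ y i) x-period₁)))) ⟩
        sumTo N (λ k → c (2 ℕ.+ k) * δ (x (suc k)) i) + sumTo N (λ k → c k * δ (x (suc k)) i)
          ≈⟨ sumTo-+ N (λ k → c (2 ℕ.+ k) * δ (x (suc k)) i) _ ⟨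
        sumTo N (λ k → c (2 ℕ.+ k) * δ (x (suc k)) i + c k * δ (x (suc k)) i)
          ≈⟨ sumTo-cong N (λ k → trans
               (solve 3 (λ a b d → b :* d :+ a :* d := (a :+ b) :* d) refl (c k) (c (2 ℕ.+ k)) (δ (x (suc k)) i))
               (trans (*-congʳ (recurrence k)) (*-assoc _ _ _))) ⟩
        sumTo N (λ k → μ * (c (suc k) * δ (x (suc k)) i))
          ≈⟨ sumTo-* N μ _ ⟩
        μ * sumTo N (λ k → c (suc k) * δ (x (suc k)) i)
          ≈⟨ *-congˡ (sumTo-rotate N (λ k → c k * δ (x k) i) (*-cong c-period₀ (reflexive (≡.cong (λ y → δ y i) x-period₀)))) ⟩
        μ * walkVector i ∎

      walkVector-start : (∀ k → suc k ℕ.< N → x (suc k) ≢ x 0) → 0 ℕ.< N → walkVector (x 0) ≈ c 0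
      walkVector-start x-injective₀ (ℕ.s≤s {n = N′} _) = begin
        c 0 * δ (x 0) (x 0) + sumTo N′ (λ k → c (suc k) * δ (x (suc k)) (x 0))
          ≈⟨ +-cong (*-congˡ δ-diagonal) (sumTo-zero N′ (λ k k<N′ → trans (*-congˡ (δ-offDiagonal (x-injective₀ k (ℕ.s<s k<N′)))) (zeroʳ _))) ⟩
        c 0 * 1# + 0#   ≈⟨ solve 1 (λ c → c :* con (+ 1) :+ con (+ 0) := c) refl (c 0) ⟩
        c 0             ∎
        where
        δ-diagonal : δ (x 0) (x 0) ≈ 1#
        δ-diagonal with x 0 Finₚ.≟ x 0
        ... | yes _ = refl
        ... | no  q = ⊥-elim (q ≡.refl)
        δ-offDiagonal : ∀ {i j : Fin n} → i ≢ j → δ i j ≈ 0#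
        δ-offDiagonal {i} {j} i≢j with i Finₚ.≟ j
        ... | yes q = ⊥-elim (i≢j q)
        ... | no  _ = refl

    module _ (μ : Carrier) where
      open Quadratic commutativeRing μ (- 1#)
      open Powers quadraticRing
      private module Q = CommutativeRing quadraticRing

      -- The constant coefficients of the powers of ζ in F[ζ] / (ζ² - μ ζ + 1) satisfy the
      -- recurrence, begin with 1, and have period `N` because ζᴺ = 1. This works whether or not ζ
      -- lies in `F`.
      rootOfUnity⇒eigenvalue : ∀ {N} {x} → IsWalk x → 0 ℕ.< N → x N ≡ x 0 → x (suc N) ≡ x 1 →
        (∀ k → suc k ℕ.< N → x (suc k) ≢ x 0) → IsRootOfUnityTrace commutativeRing N μ → IsEigenvalue Γ F μ
      rootOfUnity⇒eigenvalue {N} walk 0<N xN≡x0 xN+1≡x1 injective₀ trace =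
        walkVector walk N {μ} {c} recurrence xN≡x0 xN+1≡x1 c-period₀ c-period₁ ,
        (λ v≈0 → 0≉1 (sym (trans (sym (walkVector-start walk N {μ} {c} recurrence xN≡x0 xN+1≡x1 c-period₀ c-period₁ injective₀ 0<N)) (v≈0 _)))) ,
        walkVector-eigen walk N recurrence xN≡x0 xN+1≡x1 c-period₀ c-period₁
        where
        open IsRootOfUnityTrace trace
        c : ℕ → Carrier
        c k = proj₁ (k ^[ generator ])
        c-period₀ : c N ≈ c 0
        c-period₀ = proj₁ ζᴺ≈1
        c-period₁ : c (suc N) ≈ c 1
        c-period₁ = proj₁ (Q.*-congˡ {generator} ζᴺ≈1)
        recurrence : ∀ k → c k + c (2 ℕ.+ k) ≈ μ * c (suc k)
        recurrence k with k ^[ generator ]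
        ... | a , b = solve 3 (λ μ a b →
            a :+ (con (+ 0) :* (con (+ 0) :* a :+ (:- con (+ 1)) :* (con (+ 1) :* b))
               :+ (:- con (+ 1)) :* (con (+ 1) :* (con (+ 0) :* b :+ con (+ 1) :* a :+ μ :* (con (+ 1) :* b))))
            := μ :* (con (+ 0) :* a :+ (:- con (+ 1)) :* (con (+ 1) :* b))) refl μ a b

-- Integers in ℚ and norms

module Rational where
  open IntegerCoefficients ℚₚ.+-*-commutativeRing public
  private
    module M = Multiples (CommutativeRing.semiring ℚₚ.+-*-commutativeRing)

    toℚᵘ-× : ∀ n → toℚᵘ (n M.× 1ℚ) ℚᵘ.≃ mkℚᵘ (+ n) 0
    toℚᵘ-× zero    = *≡* ≡.refl
    toℚᵘ-× (suc n) = begin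
      toℚᵘ (suc n M.× 1ℚ)           ≈⟨ ℚₚ.toℚᵘ-cong (M.1+× n 1ℚ) ⟩
      toℚᵘ (1ℚ ℚ.+ n M.× 1ℚ)        ≈⟨ ℚₚ.toℚᵘ-homo-+ 1ℚ (n M.× 1ℚ) ⟩
      mkℚᵘ (+ 1) 0 ℚᵘ.+ toℚᵘ (n M.× 1ℚ) ≈⟨ ℚᵘₚ.+-congʳ (mkℚᵘ (+ 1) 0) (toℚᵘ-× n) ⟩
      mkℚᵘ (+ 1) 0 ℚᵘ.+ mkℚᵘ (+ n) 0    ≈⟨ *≡* (≡.cong (λ j → (+ 1 ℤ.+ j) ℤ.* + 1) (ℤₚ.*-identityʳ (+ n))) ⟩
      mkℚᵘ (+ suc n) 0              ∎
      where open SetoidReasoning ℚᵘₚ.≃-setoid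

    toℚᵘ-fromℤ : ∀ i → toℚᵘ (fromℤ i) ℚᵘ.≃ mkℚᵘ i 0
    toℚᵘ-fromℤ (+ n)    = toℚᵘ-× n
    toℚᵘ-fromℤ -[1+ n ] = ℚᵘₚ.≃-trans (ℚₚ.toℚᵘ-homo‿- (suc n M.× 1ℚ)) (ℚᵘₚ.-‿cong (toℚᵘ-× (suc n)))

  fromℤ-injective : ∀ {i j} → fromℤ i ≡ fromℤ j → i ≡ j
  fromℤ-injective {i} {j} eq with
    ℚᵘₚ.≃-trans (ℚᵘₚ.≃-sym (toℚᵘ-fromℤ i)) (ℚᵘₚ.≃-trans (ℚₚ.toℚᵘ-cong eq) (toℚᵘ-fromℤ j))
  ... | *≡* i1≡j1 = ≡.trans (≡.sym (ℤₚ.*-identityʳ i)) (≡.trans i1≡j1 (ℤₚ.*-identityʳ j))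

  q*↧q≡↥q : ∀ q → q ℚ.* fromℤ (ℚ.↧ q) ≡ fromℤ (ℚ.↥ q)
  q*↧q≡↥q q@(mkℚ a d-1 _) = ℚₚ.toℚᵘ-injective (begin
    toℚᵘ (q ℚ.* fromℤ (+ suc d-1))            ≈⟨ ℚₚ.toℚᵘ-homo-* q (fromℤ (+ suc d-1)) ⟩
    mkℚᵘ a d-1 ℚᵘ.* toℚᵘ (fromℤ (+ suc d-1))  ≈⟨ ℚᵘₚ.*-congˡ {mkℚᵘ a d-1} (toℚᵘ-fromℤ (+ suc d-1)) ⟩
    mkℚᵘ a d-1 ℚᵘ.* mkℚᵘ (+ suc d-1) 0
      ≈⟨ *≡* (≡.trans (ℤₚ.*-identityʳ _) (≡.cong (λ k → a ℤ.* + suc k) (≡.sym (ℕₚ.*-identityʳ d-1)))) ⟩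
    mkℚᵘ a 0                                  ≈⟨ toℚᵘ-fromℤ a ⟨
    toℚᵘ (fromℤ a)                            ∎)
    where open SetoidReasoning ℚᵘₚ.≃-setoid

  IsInteger : ℚ → Set
  IsInteger q = ∃[ i ] q ≡ fromℤ i

  integer-+ : ∀ {p q} → IsInteger p → IsInteger q → IsInteger (p ℚ.+ q)
  integer-+ (i , ≡.refl) (j , ≡.refl) = i ℤ.+ j , ≡.sym (fromℤ-+ i j)

  integer-* : ∀ {p q} → IsInteger p → IsInteger q → IsInteger (p ℚ.* q)
  integer-* (i , ≡.refl) (j , ≡.refl) = i ℤ.* j , ≡.sym (fromℤ-* i j)

  integer-neg : ∀ {p} → IsInteger p → IsInteger (ℚ.- p)
  integer-neg (i , ≡.refl) = ℤ.- i , ≡.sym (fromℤ-neg i)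

  commonDenominator : ∀ {n} (q : Fin n → ℚ) →
    ∃[ D ] D ≢ 0 × (∀ i → IsInteger (fromℤ (+ D) ℚ.* q i))
  commonDenominator {zero}  q = 1 , (λ ()) , λ ()
  commonDenominator {suc n} q =
    let D , D≢0 , Dq = commonDenominator (q ∘ suc)
        d = ℚ.↧ₙ (q zero)
    in d ℕ.* D , (λ dD≡0 → [ (λ ()) , D≢0 ] (ℕₚ.m*n≡0⇒m≡0∨n≡0 d dD≡0)) ,
       λ { zero → ≡.subst IsInteger (≡.sym (≡.trans (≡.cong (ℚ._* q zero) (splitting d D)) (rearrange₀ (fromℤ (+ d)) _ (q zero))))
             (integer-* (+ D , ≡.refl) (ℚ.↥ (q zero) , q*↧q≡↥q (q zero)))
         ; (suc i) → ≡.subst IsInteger (≡.sym (≡.trans (≡.cong (ℚ._* q (suc i)) (splitting d D)) (ℚₚ.*-assoc (fromℤ (+ d)) _ _)))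
             (integer-* (+ d , ≡.refl) (Dq i)) }
    where
    splitting : ∀ d D → fromℤ (+ (d ℕ.* D)) ≡ fromℤ (+ d) ℚ.* fromℤ (+ D)
    splitting d D = ≡.trans (≡.cong fromℤ (ℤₚ.pos-* d D)) (fromℤ-* (+ d) (+ D))
    rearrange₀ : ∀ d D q → d ℚ.* D ℚ.* q ≡ D ℚ.* (q ℚ.* d)
    rearrange₀ = solve 3 (λ d D q → d :* D :* q := D :* (q :* d)) ≡.refl

  open Powers ℚₚ.+-*-commutativeRing public

  private
    coprime-* : ∀ {k m n} → Coprime k m → Coprime k n → Coprime k (m ℕ.* n)
    coprime-* k⊥m k⊥n (d∣k , d∣mn) =
      k⊥n (d∣k , coprime-divisor (λ (e∣d , e∣m) → k⊥m (∣-trans e∣d d∣k , e∣m)) d∣mn)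

    coprime-^ : ∀ {k m} n → Coprime k m → Coprime k (m ℕ.^ n)
    coprime-^ zero    k⊥m = Coprimality.sym (Coprimality.1-coprimeTo _)
    coprime-^ (suc n) k⊥m = coprime-* k⊥m (coprime-^ n k⊥m)

    n<2+m^n : ∀ m n → n ℕ.< (2 ℕ.+ m) ℕ.^ n
    n<2+m^n m n = ℕₚ.<-≤-trans (n<2^n n) (ℕₚ.^-monoˡ-≤ n (ℕ.s≤s (ℕ.s≤s ℕ.z≤n)))
      where
      n<2^n : ∀ n → n ℕ.< 2 ℕ.^ n
      n<2^n zero    = ℕ.z<s
      n<2^n (suc n) = ℕₚ.≤-<-trans (n<2^n n) (≡.subst (2 ℕ.^ n ℕ.<_) (≡.cong (2 ℕ.^ n ℕ.+_) (≡.sym (ℕₚ.+-identityʳ _)))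
                        (ℕₚ.m<m+n (2 ℕ.^ n) (ℕₚ.≤-<-trans ℕ.z≤n (n<2^n n))))


  ^-* : ∀ n q r → n ^[ q ℚ.* r ] ≡ n ^[ q ] ℚ.* n ^[ r ]
  ^-* zero    q r = ≡.refl
  ^-* (suc n) q r = ≡.trans (≡.cong (q ℚ.* r ℚ.*_) (^-* n q r))
    (solve 4 (λ q r s t → (q :* r) :* (s :* t) := (q :* s) :* (r :* t)) ≡.refl q r _ _)

  fromℤ-^ : ∀ n i → n ^[ fromℤ i ] ≡ fromℤ (i ℤ.^ n)
  fromℤ-^ zero    i = ≡.refl
  fromℤ-^ (suc n) i = ≡.trans (≡.cong (fromℤ i ℚ.*_) (fromℤ-^ n i)) (≡.sym (fromℤ-* i (i ℤ.^ n)))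

  abs-^ : ∀ i n → ∣ i ℤ.^ n ∣ ≡ ∣ i ∣ ℕ.^ n
  abs-^ i zero    = ≡.refl
  abs-^ i (suc n) = ≡.trans (ℤₚ.abs-* i (i ℤ.^ n)) (≡.cong (∣ i ∣ ℕ.*_) (abs-^ i n))

  -- Let q = a / d in lowest terms. From D qⁿ ∈ ℤ follows dⁿ | D. For d ≥ 2 the choice n = D is
  -- absurd, since D < dᴰ.
  boundedDenominators⇒integer : ∀ D → D ≢ 0 → ∀ q →
    (∀ n → IsInteger (fromℤ (+ D) ℚ.* n ^[ q ])) → IsInteger q
  boundedDenominators⇒integer D D≢0 q@(mkℚ a zero c) bounded =
    a , ≡.trans (≡.sym (ℚₚ.*-identityʳ q)) (q*↧q≡↥q q)
  boundedDenominators⇒integer D D≢0 q@(mkℚ a (suc e) c) bounded =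
    ⊥-elim (ℕₚ.<⇒≱ (n<2+m^n e D) (∣⇒≤ {{ℕ.≢-nonZero D≢0}} d^D∣D))
    where
    d = suc (suc e)
    i = proj₁ (bounded D)
    Da^D≡id^D : + D ℤ.* a ℤ.^ D ≡ i ℤ.* (+ d) ℤ.^ D
    Da^D≡id^D = fromℤ-injective (begin
      fromℤ (+ D ℤ.* a ℤ.^ D)                         ≡⟨ fromℤ-* (+ D) _ ⟩
      fromℤ (+ D) ℚ.* fromℤ (a ℤ.^ D)                 ≡⟨ ≡.cong (fromℤ (+ D) ℚ.*_) (fromℤ-^ D a) ⟨
      fromℤ (+ D) ℚ.* D ^[ fromℤ a ]                  ≡⟨ ≡.cong (λ r → fromℤ (+ D) ℚ.* D ^[ r ]) (q*↧q≡↥q q) ⟨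
      fromℤ (+ D) ℚ.* D ^[ q ℚ.* fromℤ (+ d) ]        ≡⟨ ≡.cong (fromℤ (+ D) ℚ.*_) (^-* D q _) ⟩
      fromℤ (+ D) ℚ.* (D ^[ q ] ℚ.* D ^[ fromℤ (+ d) ])  ≡⟨ ℚₚ.*-assoc (fromℤ (+ D)) _ _ ⟨
      fromℤ (+ D) ℚ.* D ^[ q ] ℚ.* D ^[ fromℤ (+ d) ]    ≡⟨ ≡.cong₂ ℚ._*_ (proj₂ (bounded D)) (fromℤ-^ D (+ d)) ⟩
      fromℤ i ℚ.* fromℤ ((+ d) ℤ.^ D)                 ≡⟨ fromℤ-* i _ ⟨
      fromℤ (i ℤ.* (+ d) ℤ.^ D)                       ∎)
      where open ≡-Reasoning
    d^D∣D : d ℕ.^ D ∣ D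
    d^D∣D = coprime-divisor
      (Coprimality.sym (coprime-^ D (Coprimality.sym (coprime-^ D (Coprimality.sym (Coprimality.recompute c))))))
      (divides ∣ i ∣ (≡.trans (ℕₚ.*-comm _ D) (begin
        D ℕ.* ∣ a ∣ ℕ.^ D              ≡⟨ ≡.cong (D ℕ.*_) (abs-^ a D) ⟨
        D ℕ.* ∣ a ℤ.^ D ∣              ≡⟨ ℤₚ.abs-* (+ D) _ ⟨
        ∣ + D ℤ.* a ℤ.^ D ∣            ≡⟨ ≡.cong ∣_∣ Da^D≡id^D ⟩
        ∣ i ℤ.* (+ d) ℤ.^ D ∣          ≡⟨ ℤₚ.abs-* i _ ⟩
        ∣ i ∣ ℕ.* ∣ (+ d) ℤ.^ D ∣      ≡⟨ ≡.cong (∣ i ∣ ℕ.*_) (abs-^ (+ d) D) ⟩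
        ∣ i ∣ ℕ.* d ℕ.^ D              ∎)))
      where open ≡-Reasoning

prime∣^⇒∣ : ∀ {p n} → Prime p → ∀ k → p ∣ n ℕ.^ k → p ∣ n
prime∣^⇒∣ {n = n} p-prime zero    p∣1 = ∣-trans p∣1 (Div.1∣ n)
prime∣^⇒∣ {n = n} p-prime (suc k) p∣  = [ (λ p∣n → p∣n) , prime∣^⇒∣ p-prime k ] (euclidsLemma n _ p-prime p∣)

-- From p | nʲ follows p | n; then p³ divides n³ and hence p², so p divides 1.
n^j≡p²r⇒p²≢n³s : ∀ {n p r s} → Prime p → ∀ j → n ℕ.^ j ≡ p ℕ.* p ℕ.* r → p ℕ.* p ≢ n ℕ.* (n ℕ.* n) ℕ.* s
n^j≡p²r⇒p²≢n³s {n} {p} {r} {s} p-prime j nʲ≡p²r p²≡n³s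
  with divides m n≡mp ← prime∣^⇒∣ p-prime j (∣-trans (m∣m*n p) (≡.subst (p ℕ.* p ∣_) (≡.sym nʲ≡p²r) (m∣m*n r)))
  = ℕ.nonTrivial⇒≢1 {{prime⇒nonTrivial p-prime}} (Div.∣1⇒≡1 (divides (m ℕ.* (m ℕ.* m) ℕ.* s)
      (ℕₚ.*-cancelˡ-≡ 1 _ (p ℕ.* p) {{ℕₚ.m*n≢0 p p {{prime⇒nonZero p-prime}} {{prime⇒nonZero p-prime}}}} (begin
        p ℕ.* p ℕ.* 1                                      ≡⟨ ℕₚ.*-identityʳ _ ⟩
        p ℕ.* p                                            ≡⟨ p²≡n³s ⟩
        n ℕ.* (n ℕ.* n) ℕ.* s                              ≡⟨ ≡.cong (λ n → n ℕ.* (n ℕ.* n) ℕ.* s) n≡mp ⟩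
        m ℕ.* p ℕ.* (m ℕ.* p ℕ.* (m ℕ.* p)) ℕ.* s
          ≡⟨ solve 3 (λ m p s → m :* p :* (m :* p :* (m :* p)) :* s := p :* p :* (m :* (m :* m) :* s :* p)) ≡.refl m p s ⟩
        p ℕ.* p ℕ.* (m ℕ.* (m ℕ.* m) ℕ.* s ℕ.* p)          ∎))))
  where
  open ≡-Reasoning
  open +-*-Solver

module _ (F : Field) where
  open Field F

  -- The subring ℤ[μ], generated inductively so that integrality can be proved by recursion on how
  -- an element is built.
  data Adjoin (μ : Carrier) : Carrier → Set where
    adjoined : Adjoin μ μ
    one       : Adjoin μ 1#
    plus      : ∀ {x y} → Adjoin μ x → Adjoin μ y → Adjoin μ (x + y)
    times     : ∀ {x y} → Adjoin μ x → Adjoin μ y → Adjoin μ (x * y)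
    minus     : ∀ {x} → Adjoin μ x → Adjoin μ (- x)
    equal     : ∀ {x y} → x ≈ y → Adjoin μ x → Adjoin μ y

module AdjoinProperties (F : Field) {μ : Field.Carrier F} where
  open Field F
  open IntegerCoefficients commutativeRing
  open Multiples semiring renaming (_×_ to _·_)
  open Powers commutativeRing

  Adjoin-ℤ : ∀ i → Adjoin F μ (fromℤ i)
  Adjoin-ℤ (+ n) = multiple n
    where
    multiple : ∀ n → Adjoin F μ (n · 1#)
    multiple zero    = equal (-‿inverseʳ 1#) (plus one (minus one))
    multiple (suc n) = equal (sym (1+× n 1#)) (plus one (multiple n))
  Adjoin-ℤ -[1+ n ] = minus (Adjoin-ℤ (+ suc n))

  Adjoin-^ : ∀ n {x} → Adjoin F μ x → Adjoin F μ (n ^[ x ])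
  Adjoin-^ zero    x∈ = one
  Adjoin-^ (suc n) x∈ = times x∈ (Adjoin-^ n x∈)

module Determinant {a ℓ} (R : CommutativeRing a ℓ) where
  open CommutativeRing R
  open IntegerCoefficients R

  determinant-* : ∀ a b c d e f g h →
    (e * a + f * c) * (g * b + h * d) + - ((e * b + f * d) * (g * a + h * c))
      ≈ (a * d + - (b * c)) * (e * h + - (f * g))
  determinant-* = solve 8 (λ a b c d e f g h →
    (e :* a :+ f :* c) :* (g :* b :+ h :* d) :+ (:- ((e :* b :+ f :* d) :* (g :* a :+ h :* c)))
      := (a :* d :+ (:- (b :* c))) :* (e :* h :+ (:- (f :* g)))) refl

  -- The four matrix entries come with four different denominators; each of the two products is
  -- given the factors that only the other one supplies.
  determinant-scale : ∀ A B C D a b c d →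
    (C * D) * ((A * a) * (B * b)) + - ((A * B) * ((C * c) * (D * d))) ≈ (A * B) * (C * D) * (a * b + - (c * d))
  determinant-scale = solve 8 (λ A B C D a b c d →
    (C :* D) :* ((A :* a) :* (B :* b)) :+ (:- ((A :* B) :* ((C :* c) :* (D :* d))))
      := (A :* B) :* (C :* D) :* (a :* b :+ (:- (c :* d)))) refl

module Norm (K : Extension ℚ-field) {b : Fin 2 → Field.Carrier (Extension.top K)} (isBasis : IsBasis K b) where
  open ExtensionProperties K
  open Field top hiding (zero)
  open IsBasis isBasis
  open Determinant ℚₚ.+-*-commutativeRing
  open Rational using (IsInteger; integer-+; integer-*; integer-neg; commonDenominator; boundedDenominators⇒integer)
  private
    module KZ = IntegerCoefficients commutativeRing
    module KR = RingProperties ring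
    module QR = RingProperties (CommutativeRing.ring ℚₚ.+-*-commutativeRing)
    module ^ℚ = Powers ℚₚ.+-*-commutativeRing
    open Powers commutativeRing

    b₀ b₁ : Carrier
    b₀ = b zero
    b₁ = b (suc zero)

  comb : ℚ → ℚ → Carrier
  comb p q = ι p * b₀ + ι q * b₁

  private
    pair : ℚ → ℚ → Fin 2 → ℚ
    pair p q zero    = p
    pair p q (suc _) = q

    combination≈comb : ∀ a → combination K a b ≈ comb (a zero) (a (suc zero))
    combination≈comb a = +-congˡ (+-identityʳ _)

    comb-zero : ∀ {p q} → comb p q ≈ 0# → p ≡ 0ℚ × q ≡ 0ℚ
    comb-zero {p} {q} pq≈0 =
      let zeros = independent (pair p q) (trans (combination≈comb (pair p q)) pq≈0)
      in zeros zero , zeros (suc zero)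

    comb-+ : ∀ p q r s → comb p q + comb r s ≈ comb (p ℚ.+ r) (q ℚ.+ s)
    comb-+ p q r s = trans
      (KZ.solve 6 (λ p q r s b c → (p KZ.:* b KZ.:+ q KZ.:* c) KZ.:+ (r KZ.:* b KZ.:+ s KZ.:* c)
        KZ.:= (p KZ.:+ r) KZ.:* b KZ.:+ (q KZ.:+ s) KZ.:* c) refl (ι p) (ι q) (ι r) (ι s) b₀ b₁)
      (+-cong (*-congʳ (sym (ι-+ p r))) (*-congʳ (sym (ι-+ q s))))

    comb-* : ∀ a p q → ι a * comb p q ≈ comb (a ℚ.* p) (a ℚ.* q)
    comb-* a p q = trans
      (KZ.solve 5 (λ a p q b c → a KZ.:* (p KZ.:* b KZ.:+ q KZ.:* c)
        KZ.:= (a KZ.:* p) KZ.:* b KZ.:+ (a KZ.:* q) KZ.:* c) refl (ι a) (ι p) (ι q) b₀ b₁)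
      (+-cong (*-congʳ (sym (ι-* a p))) (*-congʳ (sym (ι-* a q))))

    comb-neg : ∀ p q → - comb p q ≈ comb (ℚ.- p) (ℚ.- q)
    comb-neg p q = trans
      (KZ.solve 4 (λ p q b c → KZ.:- (p KZ.:* b KZ.:+ q KZ.:* c)
        KZ.:= (KZ.:- p) KZ.:* b KZ.:+ (KZ.:- q) KZ.:* c) refl (ι p) (ι q) b₀ b₁)
      (+-cong (*-congʳ (sym (ι-neg p))) (*-congʳ (sym (ι-neg q))))

    comb-injective : ∀ {p q r s} → comb p q ≈ comb r s → p ≡ r × q ≡ s
    comb-injective {p} {q} {r} {s} eq =
      let p-r≡0 , q-s≡0 = comb-zero {p ℚ.+ ℚ.- r} {q ℚ.+ ℚ.- s} (trans (sym (comb-+ p q _ _))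
            (trans (+-congˡ (sym (comb-neg r s))) (trans (+-congʳ eq) (-‿inverseʳ _))))
      in x-y≡0⇒x≡y p-r≡0 , x-y≡0⇒x≡y q-s≡0
      where
      x-y≡0⇒x≡y : ∀ {x y : ℚ} → x ℚ.+ ℚ.- y ≡ 0ℚ → x ≡ y
      x-y≡0⇒x≡y {x} {y} x-y≡0 = ≡.trans (Rational.solve 2 (λ x y → x Rational.:= (x Rational.:- y) Rational.:+ y) ≡.refl x y)
        (≡.trans (≡.cong (ℚ._+ y) x-y≡0) (ℚₚ.+-identityˡ y))

  coordinate₀ coordinate₁ : Carrier → ℚ
  coordinate₀ x = proj₁ (spanning x) zero
  coordinate₁ x = proj₁ (spanning x) (suc zero)

  x≈comb : ∀ x → x ≈ comb (coordinate₀ x) (coordinate₁ x)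
  x≈comb x = trans (proj₂ (spanning x)) (combination≈comb (proj₁ (spanning x)))

  private
    coordinates : ∀ {x p q} → x ≈ comb p q → coordinate₀ x ≡ p × coordinate₁ x ≡ q
    coordinates {x} x≈pq = comb-injective (trans (sym (x≈comb x)) x≈pq)

  -- The ℚ-linear functionals on `K`. Matrix entries of a multiplication map are of this kind, and
  -- denominators are bounded for one functional at a time.
  record IsAdditive (φ : Carrier → ℚ) : Set where
    field
      cong   : ∀ {x y} → x ≈ y → φ x ≡ φ y
      φ-+    : ∀ x y → φ (x + y) ≡ φ x ℚ.+ φ y
      φ-ι*   : ∀ a x → φ (ι a * x) ≡ a ℚ.* φ x

  private
    linear : (φ : Carrier → ℚ) (z : Carrier) → IsAdditive φ → IsAdditive (λ x → φ (x * z))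
    linear φ z φ-additive = record
      { cong = λ x≈y → cong (*-congʳ x≈y)
      ; φ-+  = λ x y → ≡.trans (cong (distribʳ z x y)) (φ-+ _ _)
      ; φ-ι* = λ a x → ≡.trans (cong (*-assoc (ι a) x z)) (φ-ι* a _) }
      where open IsAdditive φ-additive

    coordinate₀-additive : IsAdditive coordinate₀
    coordinate₀-additive = record
      { cong = λ {x} {y} x≈y → proj₁ (coordinates (trans x≈y (x≈comb y)))
      ; φ-+  = λ x y → proj₁ (coordinates (trans (+-cong (x≈comb x) (x≈comb y)) (comb-+ _ _ _ _)))
      ; φ-ι* = λ a x → proj₁ (coordinates (trans (*-congˡ (x≈comb x)) (comb-* a _ _))) }

    coordinate₁-additive : IsAdditive coordinate₁
    coordinate₁-additive = record
      { cong = λ {x} {y} x≈y → proj₂ (coordinates (trans x≈y (x≈comb y)))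
      ; φ-+  = λ x y → proj₂ (coordinates {p = coordinate₀ x ℚ.+ coordinate₀ y} (trans (+-cong (x≈comb x) (x≈comb y)) (comb-+ _ _ _ _)))
      ; φ-ι* = λ a x → proj₂ (coordinates {p = a ℚ.* coordinate₀ x} (trans (*-congˡ (x≈comb x)) (comb-* a _ _))) }

  -- The matrix of multiplication by `z` in the given basis, whose determinant is the norm.
  m₀₀ m₀₁ m₁₀ m₁₁ : Carrier → ℚ
  m₀₀ z = coordinate₀ (z * b₀)
  m₀₁ z = coordinate₁ (z * b₀)
  m₁₀ z = coordinate₀ (z * b₁)
  m₁₁ z = coordinate₁ (z * b₁)

  norm : Carrier → ℚ
  norm z = m₀₀ z ℚ.* m₁₁ z ℚ.+ ℚ.- (m₀₁ z ℚ.* m₁₀ z)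

  private
    module A₀ = IsAdditive coordinate₀-additive
    module A₁ = IsAdditive coordinate₁-additive

  norm-cong : ∀ {x y} → x ≈ y → norm x ≡ norm y
  norm-cong x≈y = ≡.cong₂ ℚ._+_
    (≡.cong₂ ℚ._*_ (A₀.cong (*-congʳ x≈y)) (A₁.cong (*-congʳ x≈y)))
    (≡.cong ℚ.-_ (≡.cong₂ ℚ._*_ (A₁.cong (*-congʳ x≈y)) (A₀.cong (*-congʳ x≈y))))

  norm-* : ∀ x y → norm (x * y) ≡ norm x ℚ.* norm y
  norm-* x y = ≡.trans
    (≡.cong₂ ℚ._+_
      (≡.cong₂ ℚ._*_ (coordinate-* coordinate₀-additive b₀) (coordinate-* coordinate₁-additive b₁))
      (≡.cong ℚ.-_ (≡.cong₂ ℚ._*_ (coordinate-* coordinate₁-additive b₀) (coordinate-* coordinate₀-additive b₁))))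
    (determinant-* (m₀₀ x) (m₀₁ x) (m₁₀ x) (m₁₁ x) (m₀₀ y) (m₀₁ y) (m₁₀ y) (m₁₁ y))
    where
    coordinate-* : ∀ {φ} → IsAdditive φ → ∀ b →
      φ (x * y * b) ≡ coordinate₀ (y * b) ℚ.* φ (x * b₀) ℚ.+ coordinate₁ (y * b) ℚ.* φ (x * b₁)
    coordinate-* {φ} φ-additive b = ≡.trans
      (cong (trans (*-assoc x y b) (trans (*-congˡ (x≈comb (y * b)))
        (KZ.solve 5 (λ x p q b c → x KZ.:* (p KZ.:* b KZ.:+ q KZ.:* c) KZ.:= p KZ.:* (x KZ.:* b) KZ.:+ q KZ.:* (x KZ.:* c)) refl x _ _ b₀ b₁))))
      (≡.trans (φ-+ _ _) (≡.cong₂ ℚ._+_ (φ-ι* _ _) (φ-ι* _ _)))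
      where open IsAdditive φ-additive

  norm-ι : ∀ a → norm (ι a) ≡ a ℚ.* a
  norm-ι a = ≡.trans
    (≡.cong₂ ℚ._+_ (≡.cong₂ ℚ._*_ (proj₁ row₀) (proj₂ row₁)) (≡.cong ℚ.-_ (≡.cong₂ ℚ._*_ (proj₂ row₀) (proj₁ row₁))))
    (Rational.solve 1 (λ a → a :* a :+ (:- (con (+ 0) :* con (+ 0))) := a :* a) ≡.refl a)
    where
    open Rational using (_:*_; _:+_; :-_; _:=_; con)
    row₀ = coordinates {ι a * b₀} {a} {0ℚ} (sym (trans (+-congˡ (trans (*-congʳ ι-0) (zeroˡ _))) (+-identityʳ _)))
    row₁ = coordinates {ι a * b₁} {0ℚ} {a} (sym (trans (+-congʳ (trans (*-congʳ ι-0) (zeroˡ _))) (+-identityˡ _)))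

  norm-^ : ∀ n x → norm (n ^[ x ]) ≡ n ^ℚ.^[ norm x ]
  norm-^ zero    x = ≡.trans (norm-cong (sym ι-1)) (norm-ι 1ℚ)
  norm-^ (suc n) x = ≡.trans (norm-* x _) (≡.cong (norm x ℚ.*_) (norm-^ n x))

  module _ {n} (Γ : Graph n) {μ : Carrier} (eigenvalue : IsEigenvalue Γ top μ) where
    open SemiringSum semiring hiding (sum)
    private
      v = proj₁ eigenvalue
      A = adjacencyMatrix Γ top

      vᵢ≢0 : ∃[ i ] ¬ (v i ≈ 0#)
      vᵢ≢0 = Finₚ.¬∀⟶∃¬ n _ (λ i → v i ≟ 0#) (proj₁ (proj₂ eigenvalue))

      i₀ : Fin n
      i₀ = proj₁ vᵢ≢0

      d : Carrier
      d = proj₁ (inverse (v i₀) (proj₂ vᵢ≢0))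

      -- The eigenvector scaled to have the entry 1 at `i₀`: the group spanned by its entries then
      -- contains 1 and, being stable under μ, all of ℤ[μ].
      w : Fin n → Carrier
      w i = d * v i

      w₀≈1 : w i₀ ≈ 1#
      w₀≈1 = proj₁ (proj₂ (inverse (v i₀) (proj₂ vᵢ≢0)))

      w-eigen : ∀ i → sum (λ j → A i j * w j) ≈ μ * w i
      w-eigen i = begin
        sum (λ j → A i j * (d * v j))    ≈⟨ sum-cong-≋ {n} (λ j → KZ.solve 3 (λ a d v → a KZ.:* (d KZ.:* v) KZ.:= d KZ.:* (a KZ.:* v)) refl (A i j) d (v j)) ⟩
        sum (λ j → d * (A i j * v j))    ≈⟨ *-distribˡ-sum {n} d _ ⟨
        d * sum (λ j → A i j * v j)      ≈⟨ *-congˡ (proj₂ (proj₂ eigenvalue) i) ⟩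
        d * (μ * v i)                    ≈⟨ KZ.solve 3 (λ d μ v → d KZ.:* (μ KZ.:* v) KZ.:= μ KZ.:* (d KZ.:* v)) refl d μ (v i) ⟩
        μ * w i                          ∎
        where open SetoidReasoning setoid

      module _ {φ : Carrier → ℚ} (φ-additive : IsAdditive φ) where
        open IsAdditive φ-additive

        private
          D   = proj₁ (commonDenominator (φ ∘ w))

          Φ : Carrier → ℚ
          Φ x = Rational.fromℤ (+ D) ℚ.* φ x

          Φ-additive : IsAdditive Φ
          Φ-additive = record
            { cong = λ x≈y → ≡.cong (Rational.fromℤ (+ D) ℚ.*_) (cong x≈y)
            ; φ-+  = λ x y → ≡.trans (≡.cong (Rational.fromℤ (+ D) ℚ.*_) (φ-+ x y)) (ℚₚ.*-distribˡ-+ (Rational.fromℤ (+ D)) _ _)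
            ; φ-ι* = λ a x → ≡.trans (≡.cong (Rational.fromℤ (+ D) ℚ.*_) (φ-ι* a x))
                (Rational.solve 3 (λ D a x → D Rational.:* (a Rational.:* x) Rational.:= a Rational.:* (D Rational.:* x)) ≡.refl (Rational.fromℤ (+ D)) a (φ x)) }

          module Φ = IsAdditive Φ-additive

          Φ-0 : Φ 0# ≡ 0ℚ
          Φ-0 = QR.x+x≈x⇒x≈0 (Φ 0#) (≡.trans (≡.sym (Φ.φ-+ 0# 0#)) (Φ.cong (+-identityˡ 0#)))

          Φ-neg : ∀ x → Φ (- x) ≡ ℚ.- Φ x
          Φ-neg x = QR.+-inverseʳ-unique (Φ x) (Φ (- x)) (≡.trans (≡.sym (Φ.φ-+ x (- x))) (≡.trans (Φ.cong (-‿inverseʳ x)) Φ-0))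

          -- The lattice is the group spanned by the entries `w i`, on which `Φ` is integral by the
          -- choice of `D`. The condition asks the same of `z` times the lattice.
          IntegralOnLattice : Carrier → Set
          IntegralOnLattice z = ∀ i → IsInteger (Φ (z * w i))

          Φ-sum : ∀ {m} (a : Fin m → Bool) (x : Fin m → Carrier) → (∀ j → IsInteger (Φ (x j))) →
            IsInteger (Φ (sum (λ j → (if a j then 1# else 0#) * x j)))
          Φ-sum {zero}  a x Φx∈ℤ = + 0 , Φ-0
          Φ-sum {suc m} a x Φx∈ℤ = ≡.subst IsInteger (≡.sym (Φ.φ-+ _ _))
            (integer-+ (head (a zero)) (Φ-sum (a ∘ suc) (x ∘ suc) (Φx∈ℤ ∘ suc)))
            where
            head : ∀ c → IsInteger (Φ ((if c then 1# else 0#) * x zero))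
            head true  = ≡.subst IsInteger (Φ.cong (sym (*-identityˡ _))) (Φx∈ℤ zero)
            head false = + 0 , ≡.trans (Φ.cong (zeroˡ _)) Φ-0

          -- The essential case is u = μ: since A w = μ w and A has entries 0 and 1, the element μ z
          -- w i is a sum of some of the z w j.
          lattice-closed : ∀ {u} → Adjoin top μ u → ∀ z → IntegralOnLattice z → IntegralOnLattice (u * z)
          lattice-closed adjoined z z∈ i = ≡.subst IsInteger (Φ.cong eq) (Φ-sum (λ j → does (Graph._∼?_ Γ i j)) (λ j → z * w j) z∈)
            where
            open SetoidReasoning setoid
            eq : sum (λ j → A i j * (z * w j)) ≈ μ * z * w i
            eq = begin
              sum (λ j → A i j * (z * w j))    ≈⟨ sum-cong-≋ {n} (λ j → KZ.solve 3 (λ a d v → a KZ.:* (d KZ.:* v) KZ.:= d KZ.:* (a KZ.:* v)) refl (A i j) z (w j)) ⟩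
              sum (λ j → z * (A i j * w j))    ≈⟨ *-distribˡ-sum {n} z _ ⟨
              z * sum (λ j → A i j * w j)      ≈⟨ *-congˡ (w-eigen i) ⟩
              z * (μ * w i)                    ≈⟨ KZ.solve 3 (λ d μ v → d KZ.:* (μ KZ.:* v) KZ.:= μ KZ.:* d KZ.:* v) refl z μ (w i) ⟩
              μ * z * w i                      ∎
          lattice-closed one z z∈ i = ≡.subst IsInteger (Φ.cong (*-congʳ (sym (*-identityˡ z)))) (z∈ i)
          lattice-closed (plus {x} {y} x∈ y∈) z z∈ i = ≡.subst IsInteger
            (≡.trans (≡.sym (Φ.φ-+ _ _)) (Φ.cong (KZ.solve 4 (λ x y z w → x KZ.:* z KZ.:* w KZ.:+ y KZ.:* z KZ.:* w KZ.:= (x KZ.:+ y) KZ.:* z KZ.:* w) refl x y z (w i))))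
            (integer-+ (lattice-closed x∈ z z∈ i) (lattice-closed y∈ z z∈ i))
          lattice-closed (times {x} {y} x∈ y∈) z z∈ i = ≡.subst IsInteger
            (Φ.cong (*-congʳ (sym (*-assoc x y z)))) (lattice-closed x∈ (y * z) (lattice-closed y∈ z z∈) i)
          lattice-closed (minus {x} x∈) z z∈ i = ≡.subst IsInteger
            (≡.trans (≡.sym (Φ-neg _)) (Φ.cong (KZ.solve 3 (λ x z w → KZ.:- (x KZ.:* z KZ.:* w) KZ.:= (KZ.:- x) KZ.:* z KZ.:* w) refl x z (w i))))
            (integer-neg (lattice-closed x∈ z z∈ i))
          lattice-closed (equal x≈y x∈) z z∈ i = ≡.subst IsInteger (Φ.cong (*-congʳ (*-congʳ x≈y))) (lattice-closed x∈ z z∈ i)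

        boundedDenominator : ∃[ D ] D ≢ 0 × (∀ {u} → Adjoin top μ u → IsInteger (Rational.fromℤ (+ D) ℚ.* φ u))
        boundedDenominator = D , proj₁ (proj₂ (commonDenominator (φ ∘ w))) , λ {u} u∈ →
          -- Closure is applied to z = 1 and read at the entry 1 of `w`, which leaves the value at
          -- `u` itself.
          ≡.subst IsInteger (Φ.cong (trans (*-cong (*-identityʳ u) w₀≈1) (*-identityʳ u)))
            (lattice-closed u∈ 1# (λ i → ≡.subst IsInteger (Φ.cong (sym (*-identityˡ _))) (proj₂ (proj₂ (commonDenominator (φ ∘ w))) i)) i₀)

    -- All powers of `z` stay in ℤ[μ], so the denominators of their four matrix entries are bounded
    -- independently of the power. Thus the powers of `norm z` have bounded denominators.
    norm-integer : ∀ {z} → Adjoin top μ z → IsInteger (norm z)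
    norm-integer {z} z∈ = boundedDenominators⇒integer (D₀₀ ℕ.* D₁₁ ℕ.* (D₀₁ ℕ.* D₁₀))
      (nonzero (nonzero D₀₀≢0 D₁₁≢0) (nonzero D₀₁≢0 D₁₀≢0)) (norm z)
      (λ k → ≡.subst (λ q → IsInteger (Rational.fromℤ (+ (D₀₀ ℕ.* D₁₁ ℕ.* (D₀₁ ℕ.* D₁₀))) ℚ.* q)) (norm-^ k z) (bounded (Adjoin-^ k z∈)))
      where
      open AdjoinProperties top
      open Rational using (fromℤ; fromℤ-*)
      bound : ∀ {φ} → IsAdditive φ → ∀ b → _
      bound φ-additive b = boundedDenominator (linear _ b φ-additive)
      bound₀₀ = bound coordinate₀-additive b₀
      bound₀₁ = bound coordinate₁-additive b₀
      bound₁₀ = bound coordinate₀-additive b₁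
      bound₁₁ = bound coordinate₁-additive b₁
      D₀₀ = proj₁ bound₀₀
      D₀₁ = proj₁ bound₀₁
      D₁₀ = proj₁ bound₁₀
      D₁₁ = proj₁ bound₁₁
      D₀₀≢0 = proj₁ (proj₂ bound₀₀)
      D₀₁≢0 = proj₁ (proj₂ bound₀₁)
      D₁₀≢0 = proj₁ (proj₂ bound₁₀)
      D₁₁≢0 = proj₁ (proj₂ bound₁₁)
      nonzero : ∀ {m n} → m ≢ 0 → n ≢ 0 → m ℕ.* n ≢ 0
      nonzero {m} m≢0 n≢0 mn≡0 = [ m≢0 , n≢0 ] (ℕₚ.m*n≡0⇒m≡0∨n≡0 m mn≡0)
      fromℤ-ℕ* : ∀ m n → fromℤ (+ (m ℕ.* n)) ≡ fromℤ (+ m) ℚ.* fromℤ (+ n)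
      fromℤ-ℕ* m n = ≡.trans (≡.cong fromℤ (ℤₚ.pos-* m n)) (fromℤ-* (+ m) (+ n))
      bounded : ∀ {u} → Adjoin top μ u → IsInteger (fromℤ (+ (D₀₀ ℕ.* D₁₁ ℕ.* (D₀₁ ℕ.* D₁₀))) ℚ.* norm u)
      bounded {u} u∈ = ≡.subst IsInteger
        (≡.trans
          (determinant-scale
            (fromℤ (+ D₀₀)) (fromℤ (+ D₁₁)) (fromℤ (+ D₀₁)) (fromℤ (+ D₁₀)) (m₀₀ u) (m₁₁ u) (m₀₁ u) (m₁₀ u))
          (≡.cong (ℚ._* norm u) (≡.sym (≡.trans (fromℤ-ℕ* (D₀₀ ℕ.* D₁₁) (D₀₁ ℕ.* D₁₀)) (≡.cong₂ ℚ._*_ (fromℤ-ℕ* D₀₀ D₁₁) (fromℤ-ℕ* D₀₁ D₁₀))))))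
        (integer-+
          (integer-* (integer-* (+ D₀₁ , ≡.refl) (+ D₁₀ , ≡.refl)) (integer-* (proj₂ (proj₂ bound₀₀) u∈) (proj₂ (proj₂ bound₁₁) u∈)))
          (integer-neg (integer-* (integer-* (+ D₀₀ , ≡.refl) (+ D₁₁ , ≡.refl)) (integer-* (proj₂ (proj₂ bound₀₁) u∈) (proj₂ (proj₂ bound₁₀) u∈)))))

    -- Taking norms, p divides N(y) and N(y)³ divides p².
    ramification-bound : ∀ {p} → Prime p → ∀ j {y r s} → Adjoin top μ y → Adjoin top μ r → Adjoin top μ s →
      j ^[ y ] ≈ KZ.fromℤ (+ p) * r → KZ.fromℤ (+ p) ≈ y * (y * y) * s → ⊥
    ramification-bound {p} p-prime j {y} {r} {s} y∈ r∈ s∈ yʲ≈pr p≈y³s =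
      argument (norm-integer y∈) (norm-integer r∈) (norm-integer s∈)
      where
      argument : IsInteger (norm y) → IsInteger (norm r) → IsInteger (norm s) → ⊥
      argument (N , N≡) (R , R≡) (S , S≡) =
        n^j≡p²r⇒p²≢n³s p-prime j nʲ≡p²r p²≡n³s
        where
        open ≡-Reasoning
        open Rational using (fromℤ; fromℤ-*; fromℤ-^; fromℤ-injective; abs-^)
        norm-p : norm (KZ.fromℤ (+ p)) ≡ fromℤ (+ p ℤ.* + p)
        norm-p = ≡.trans (norm-cong (sym (ι-fromℤ K (+ p)))) (≡.trans (norm-ι (fromℤ (+ p))) (≡.sym (fromℤ-* (+ p) (+ p))))
        nʲ≡p²r : ∣ N ∣ ℕ.^ j ≡ p ℕ.* p ℕ.* ∣ R ∣
        nʲ≡p²r = begin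
          ∣ N ∣ ℕ.^ j                     ≡⟨ abs-^ N j ⟨
          ∣ N ℤ.^ j ∣                     ≡⟨ ≡.cong ∣_∣ (fromℤ-injective {N ℤ.^ j} {+ p ℤ.* + p ℤ.* R} (begin
            fromℤ (N ℤ.^ j)                           ≡⟨ fromℤ-^ j N ⟨
            j ^ℚ.^[ fromℤ N ]                         ≡⟨ ≡.cong (j ^ℚ.^[_]) N≡ ⟨
            j ^ℚ.^[ norm y ]                          ≡⟨ norm-^ j y ⟨
            norm (j ^[ y ])                           ≡⟨ norm-cong yʲ≈pr ⟩
            norm (KZ.fromℤ (+ p) * r)                 ≡⟨ norm-* _ r ⟩
            norm (KZ.fromℤ (+ p)) ℚ.* norm r          ≡⟨ ≡.cong₂ ℚ._*_ norm-p R≡ ⟩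
            fromℤ (+ p ℤ.* + p) ℚ.* fromℤ R           ≡⟨ fromℤ-* (+ p ℤ.* + p) R ⟨
            fromℤ (+ p ℤ.* + p ℤ.* R)                 ∎)) ⟩
          ∣ + p ℤ.* + p ℤ.* R ∣           ≡⟨ ℤₚ.abs-* (+ p ℤ.* + p) R ⟩
          ∣ + p ℤ.* + p ∣ ℕ.* ∣ R ∣       ≡⟨ ≡.cong (ℕ._* ∣ R ∣) (ℤₚ.abs-* (+ p) (+ p)) ⟩
          p ℕ.* p ℕ.* ∣ R ∣               ∎
        p²≡n³s : p ℕ.* p ≡ ∣ N ∣ ℕ.* (∣ N ∣ ℕ.* ∣ N ∣) ℕ.* ∣ S ∣
        p²≡n³s = begin
          p ℕ.* p                               ≡⟨ ℤₚ.abs-* (+ p) (+ p) ⟨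
          ∣ + p ℤ.* + p ∣                       ≡⟨ ≡.cong ∣_∣ (fromℤ-injective {+ p ℤ.* + p} {N ℤ.* (N ℤ.* N) ℤ.* S} (begin
            fromℤ (+ p ℤ.* + p)                       ≡⟨ norm-p ⟨
            norm (KZ.fromℤ (+ p))                     ≡⟨ norm-cong p≈y³s ⟩
            norm (y * (y * y) * s)                    ≡⟨ norm-* _ s ⟩
            norm (y * (y * y)) ℚ.* norm s             ≡⟨ ≡.cong (ℚ._* norm s) (≡.trans (norm-* y _) (≡.cong (norm y ℚ.*_) (norm-* y y))) ⟩
            norm y ℚ.* (norm y ℚ.* norm y) ℚ.* norm s ≡⟨ ≡.cong₂ (λ n s → n ℚ.* (n ℚ.* n) ℚ.* s) N≡ S≡ ⟩
            fromℤ N ℚ.* (fromℤ N ℚ.* fromℤ N) ℚ.* fromℤ S ≡⟨ ≡.cong (λ x → fromℤ N ℚ.* x ℚ.* fromℤ S) (fromℤ-* N N) ⟨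
            fromℤ N ℚ.* fromℤ (N ℤ.* N) ℚ.* fromℤ S   ≡⟨ ≡.cong (ℚ._* fromℤ S) (fromℤ-* N (N ℤ.* N)) ⟨
            fromℤ (N ℤ.* (N ℤ.* N)) ℚ.* fromℤ S       ≡⟨ fromℤ-* (N ℤ.* (N ℤ.* N)) S ⟨
            fromℤ (N ℤ.* (N ℤ.* N) ℤ.* S)             ∎)) ⟩
          ∣ N ℤ.* (N ℤ.* N) ℤ.* S ∣             ≡⟨ ℤₚ.abs-* (N ℤ.* (N ℤ.* N)) S ⟩
          ∣ N ℤ.* (N ℤ.* N) ∣ ℕ.* ∣ S ∣         ≡⟨ ≡.cong (ℕ._* ∣ S ∣) (≡.trans (ℤₚ.abs-* N (N ℤ.* N)) (≡.cong (∣ N ∣ ℕ.*_) (ℤₚ.abs-* N N))) ⟩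
          ∣ N ∣ ℕ.* (∣ N ∣ ℕ.* ∣ N ∣) ℕ.* ∣ S ∣ ∎

-- Chebyshev polynomials

-- Σ d k i yⁱ and Σ u k i yⁱ are the polynomials D k and U k below; the entries
-- are binomial coefficients: d k i = C(k+i, 2i) and u k i = C(k+i, 2i+1).
module Coefficients where
  open IntegerCoefficients ℤₚ.+-*-commutativeRing
  open ≡-Reasoning

  d u : ℕ → ℕ → ℤ
  d zero    zero    = + 1
  d zero    (suc i) = + 0
  d (suc k) zero    = + 1
  d (suc k) (suc i) = d k (suc i) ℤ.+ u (suc k) i
  u zero    i = + 0
  u (suc k) i = u k i ℤ.+ d k i

  d-0 : ∀ k → d k 0 ≡ + 1
  d-0 zero    = ≡.refl
  d-0 (suc k) = ≡.refl

  d-above : ∀ {k i} → k ℕ.< i → d k i ≡ + 0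
  u-above : ∀ {k i} → k ℕ.≤ i → u k i ≡ + 0
  d-above {zero}  {suc i} _           = ≡.refl
  d-above {suc k} {suc i} (ℕ.s<s k<i) = ≡.cong₂ ℤ._+_ (d-above (ℕₚ.m<n⇒m<1+n k<i)) (u-above k<i)
  u-above {zero}  {i} _   = ≡.refl
  u-above {suc k} {i} k<i = ≡.cong₂ ℤ._+_ (u-above (ℕₚ.<⇒≤ k<i)) (d-above k<i)

  d-diagonal : ∀ k → d k k ≡ + 1
  d-diagonal zero    = ≡.refl
  d-diagonal (suc k) = ≡.cong₂ ℤ._+_ (d-above (ℕₚ.n<1+n k)) (≡.cong₂ ℤ._+_ (u-above (ℕₚ.≤-refl {k})) (d-diagonal k))

  u-0 : ∀ k → u k 0 ≡ + k
  u-0 zero    = ≡.refl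
  u-0 (suc k) = ≡.trans (≡.cong₂ ℤ._+_ (u-0 k) (d-0 k)) (ℤₚ.+-comm (+ k) (+ 1))

  -- The absorption identities of C(k+i, 2i+1) and C(k+i+1, 2i+2). They are proved together because
  -- Pascal's rule expresses each family through the other.
  u-absorption : ∀ k i → (+ i ℤ.+ + i ℤ.+ + 1) ℤ.* u k i ≡ (+ k ℤ.- + i) ℤ.* d k i
  d-absorption : ∀ k i → (+ i ℤ.+ + i ℤ.+ + 2) ℤ.* d k (suc i) ≡ (+ k ℤ.- + i) ℤ.* u (suc k) i

  u-absorption zero zero    = ≡.refl
  u-absorption zero (suc i) = ≡.trans (ℤₚ.*-zeroʳ (+ suc i ℤ.+ + suc i ℤ.+ + 1)) (≡.sym (ℤₚ.*-zeroʳ (+ 0 ℤ.- + suc i)))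
  u-absorption (suc k) zero = begin
    + 1 ℤ.* (u k 0 ℤ.+ d k 0)       ≡⟨ ≡.cong (+ 1 ℤ.*_) (≡.cong₂ ℤ._+_ (u-0 k) (d-0 k)) ⟩
    + 1 ℤ.* (+ k ℤ.+ + 1)           ≡⟨ solve 1 (λ k → con (+ 1) :* (k :+ con (+ 1)) := (con (+ 1) :+ k :- con (+ 0)) :* con (+ 1)) ≡.refl (+ k) ⟩
    (+ suc k ℤ.- + 0) ℤ.* + 1       ∎
  u-absorption (suc k) (suc i) = begin
    (+ suc i ℤ.+ + suc i ℤ.+ + 1) ℤ.* (u k (suc i) ℤ.+ d k (suc i))
      ≡⟨ ℤₚ.*-distribˡ-+ (+ suc i ℤ.+ + suc i ℤ.+ + 1) (u k (suc i)) (d k (suc i)) ⟩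
    (+ suc i ℤ.+ + suc i ℤ.+ + 1) ℤ.* u k (suc i) ℤ.+ (+ suc i ℤ.+ + suc i ℤ.+ + 1) ℤ.* d k (suc i)
      ≡⟨ ≡.cong (λ x → x ℤ.+ (+ suc i ℤ.+ + suc i ℤ.+ + 1) ℤ.* d k (suc i)) (u-absorption k (suc i)) ⟩
    (+ k ℤ.- + suc i) ℤ.* d k (suc i) ℤ.+ (+ suc i ℤ.+ + suc i ℤ.+ + 1) ℤ.* d k (suc i)
      ≡⟨ solve 3 (λ k i d → let i′ = con (+ 1) :+ i in
           (k :- i′) :* d :+ (i′ :+ i′ :+ con (+ 1)) :* d := (k :- i) :* d :+ (i :+ i :+ con (+ 2)) :* d) ≡.refl (+ k) (+ i) (d k (suc i)) ⟩
    (+ k ℤ.- + i) ℤ.* d k (suc i) ℤ.+ (+ i ℤ.+ + i ℤ.+ + 2) ℤ.* d k (suc i)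
      ≡⟨ ≡.cong (λ x → (+ k ℤ.- + i) ℤ.* d k (suc i) ℤ.+ x) (d-absorption k i) ⟩
    (+ k ℤ.- + i) ℤ.* d k (suc i) ℤ.+ (+ k ℤ.- + i) ℤ.* u (suc k) i
      ≡⟨ solve 4 (λ k i d u → (k :- i) :* d :+ (k :- i) :* u := (con (+ 1) :+ k :- (con (+ 1) :+ i)) :* (d :+ u)) ≡.refl (+ k) (+ i) (d k (suc i)) (u (suc k) i) ⟩
    (+ suc k ℤ.- + suc i) ℤ.* (d k (suc i) ℤ.+ u (suc k) i) ∎

  d-absorption zero zero    = ≡.refl
  d-absorption zero (suc i) = ≡.trans (ℤₚ.*-zeroʳ (+ suc i ℤ.+ + suc i ℤ.+ + 2)) (≡.sym (ℤₚ.*-zeroʳ (+ 0 ℤ.- + suc i)))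
  d-absorption (suc k) i = begin
    (+ i ℤ.+ + i ℤ.+ + 2) ℤ.* (d k (suc i) ℤ.+ u (suc k) i)
      ≡⟨ ℤₚ.*-distribˡ-+ (+ i ℤ.+ + i ℤ.+ + 2) (d k (suc i)) (u (suc k) i) ⟩
    (+ i ℤ.+ + i ℤ.+ + 2) ℤ.* d k (suc i) ℤ.+ (+ i ℤ.+ + i ℤ.+ + 2) ℤ.* u (suc k) i
      ≡⟨ ≡.cong (λ x → x ℤ.+ (+ i ℤ.+ + i ℤ.+ + 2) ℤ.* u (suc k) i) (d-absorption k i) ⟩
    (+ k ℤ.- + i) ℤ.* u (suc k) i ℤ.+ (+ i ℤ.+ + i ℤ.+ + 2) ℤ.* u (suc k) i
      ≡⟨ solve 3 (λ k i u → (k :- i) :* u :+ (i :+ i :+ con (+ 2)) :* u := (con (+ 1) :+ k :- i) :* u :+ (i :+ i :+ con (+ 1)) :* u) ≡.refl (+ k) (+ i) (u (suc k) i) ⟩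
    (+ suc k ℤ.- + i) ℤ.* u (suc k) i ℤ.+ (+ i ℤ.+ + i ℤ.+ + 1) ℤ.* u (suc k) i
      ≡⟨ ≡.cong (λ x → (+ suc k ℤ.- + i) ℤ.* u (suc k) i ℤ.+ x) (u-absorption (suc k) i) ⟩
    (+ suc k ℤ.- + i) ℤ.* u (suc k) i ℤ.+ (+ suc k ℤ.- + i) ℤ.* d (suc k) i
      ≡⟨ ℤₚ.*-distribˡ-+ (+ suc k ℤ.- + i) _ _ ⟨
    (+ suc k ℤ.- + i) ℤ.* (u (suc k) i ℤ.+ d (suc k) i) ∎

  -- The coefficients of `V k` below: C(k+i, 2i) multiplied by (2k + 1) / (2i + 1).
  e : ℕ → ℕ → ℤ
  e k i = d k i ℤ.+ (u k i ℤ.+ u k i)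

  e-closedForm : ∀ k i → (+ i ℤ.+ + i ℤ.+ + 1) ℤ.* e k i ≡ (+ 1 ℤ.+ (+ k ℤ.+ + k)) ℤ.* d k i
  e-closedForm k i = begin
    (+ i ℤ.+ + i ℤ.+ + 1) ℤ.* e k i
      ≡⟨ solve 3 (λ i d u → (i :+ i :+ con (+ 1)) :* (d :+ (u :+ u))
           := (i :+ i :+ con (+ 1)) :* d :+ con (+ 2) :* ((i :+ i :+ con (+ 1)) :* u)) ≡.refl (+ i) (d k i) (u k i) ⟩
    (+ i ℤ.+ + i ℤ.+ + 1) ℤ.* d k i ℤ.+ + 2 ℤ.* ((+ i ℤ.+ + i ℤ.+ + 1) ℤ.* u k i)
      ≡⟨ ≡.cong (λ x → (+ i ℤ.+ + i ℤ.+ + 1) ℤ.* d k i ℤ.+ + 2 ℤ.* x) (u-absorption k i) ⟩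
    (+ i ℤ.+ + i ℤ.+ + 1) ℤ.* d k i ℤ.+ + 2 ℤ.* ((+ k ℤ.- + i) ℤ.* d k i)
      ≡⟨ solve 3 (λ k i d → (i :+ i :+ con (+ 1)) :* d :+ con (+ 2) :* ((k :- i) :* d)
           := (con (+ 1) :+ (k :+ k)) :* d) ≡.refl (+ k) (+ i) (d k i) ⟩
    (+ 1 ℤ.+ (+ k ℤ.+ + k)) ℤ.* d k i ∎

  e-0 : ∀ k → e k 0 ≡ + (suc (k ℕ.+ k))
  e-0 k = ≡.cong₂ ℤ._+_ (d-0 k) (≡.cong₂ ℤ._+_ (u-0 k) (u-0 k))

  e-diagonal : ∀ k → e k k ≡ + 1
  e-diagonal k = ≡.cong₂ ℤ._+_ (d-diagonal k) (≡.cong₂ ℤ._+_ (u-above (ℕₚ.≤-refl {k})) (u-above (ℕₚ.≤-refl {k})))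

  -- The closed form shows that p = 2k + 1 divides (2i + 1) e, and 0 < 2i + 1 < p excludes the first
  -- factor.
  e-divisible : ∀ {k i} → Prime (suc (k ℕ.+ k)) → i ℕ.< k → ∃[ γ ] e k i ≡ + suc (k ℕ.+ k) ℤ.* γ
  e-divisible {k} {i} p-prime i<k
    with euclidsLemma (i ℕ.+ i ℕ.+ 1) ∣ e k i ∣ p-prime
           (divides ∣ d k i ∣ (≡.trans (≡.sym (ℤₚ.abs-* (+ (i ℕ.+ i ℕ.+ 1)) (e k i)))
             (≡.trans (≡.cong ∣_∣ (e-closedForm k i)) (≡.trans (ℤₚ.abs-* (+ suc (k ℕ.+ k)) (d k i)) (ℕₚ.*-comm _ ∣ d k i ∣)))))
  ... | inj₁ p∣2i+1 = ⊥-elim (ℕₚ.<⇒≱ (≡.subst (ℕ._< suc (k ℕ.+ k)) (ℕₚ.+-comm 1 (i ℕ.+ i)) (ℕ.s<s (ℕₚ.+-mono-< i<k i<k)))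
                        (∣⇒≤ {{ℕ.≢-nonZero (λ eq → ℕₚ.1+n≢0 (≡.trans (ℕₚ.+-comm 1 (i ℕ.+ i)) eq))}} p∣2i+1))
  ... | inj₂ p∣e with ∣ᵤ⇒∣ {+ suc (k ℕ.+ k)} {e k i} p∣e
  ... | dividesℤ γ eq = γ , ≡.trans eq (ℤₚ.*-comm γ _)

module Chebyshev (F : Field) (y : Field.Carrier F) where
  open Field F
  open IntegerCoefficients commutativeRing
  open SumProperties F
  open Powers commutativeRing
  open SetoidReasoning setoid

  -- With 2 + y = ζ + ζ⁻¹, the element `U k` is (ζᵏ - ζ⁻ᵏ) / (ζ - ζ⁻¹), `D k` is U (k + 1) - U k,
  -- and `V k` is U (k + 1) + U k = ζ⁻ᵏ + ... + ζᵏ. In the variable `y` the coefficients are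
  -- nonnegative, and those of `V` show the Eisenstein pattern.
  D U V : ℕ → Carrier
  D zero    = 1#
  D (suc k) = D k + y * U (suc k)
  U zero    = 0#
  U (suc k) = U k + D k
  V k = D k + (U k + U k)

  private
    μ : Carrier
    μ = fromℤ (+ 2) + y

  V-recurrence : ∀ k → V k + V (2 ℕ.+ k) ≈ μ * V (suc k)
  V-recurrence k = solve 3 (λ d u y →
    let u₁ = u :+ d
        d₁ = d :+ y :* u₁
        u₂ = u₁ :+ d₁
        d₂ = d₁ :+ y :* u₂
    in (d :+ (u :+ u)) :+ (d₂ :+ (u₂ :+ u₂)) := (con (+ 2) :+ y) :* (d₁ :+ (u₁ :+ u₁))) refl (D k) (U k) y

  -- The number 2k + 1, defined so that `sumTo (odd (suc k))` unfolds by two terms.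
  odd : ℕ → ℕ
  odd zero    = 1
  odd (suc k) = 2 ℕ.+ odd k

  odd≡ : ∀ k → odd k ≡ suc (k ℕ.+ k)
  odd≡ zero    = ≡.refl
  odd≡ (suc k) = ≡.cong (2 ℕ.+_) (≡.trans (odd≡ k) (≡.sym (ℕₚ.+-suc k k)))

  Recurrent : (ℕ → Carrier) → Set
  Recurrent f = ∀ k → f k + f (2 ℕ.+ k) ≈ μ * f (suc k)

  -- Formally, multiplication by ζ⁻ᵏ + ... + ζᵏ replaces the middle term of a recurrent sequence by
  -- the sum of the 2k + 1 terms around it.
  sum≈V : ∀ k {f} → Recurrent f → sumTo (odd k) f ≈ V k * f k
  sum≈V zero {f} rec = solve 1 (λ a → a :+ con (+ 0) := (con (+ 1) :+ (con (+ 0) :+ con (+ 0))) :* a) refl (f 0)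
  sum≈V (suc zero) {f} rec = begin
    f 0 + (f 1 + (f 2 + 0#))   ≈⟨ solve 3 (λ a b c → a :+ (b :+ (c :+ con (+ 0))) := (a :+ c) :+ b) refl (f 0) (f 1) (f 2) ⟩
    (f 0 + f 2) + f 1          ≈⟨ +-congʳ (rec 0) ⟩
    μ * f 1 + f 1              ≈⟨ solve 2 (λ y b → let u₁ = con (+ 0) :+ con (+ 1) in
                                    (con (+ 2) :+ y) :* b :+ b := ((con (+ 1) :+ y :* u₁) :+ (u₁ :+ u₁)) :* b) refl y (f 1) ⟩
    V 1 * f 1                  ∎
  -- Two windows of length 2k + 3, shifted by two against each other, cover the long window and
  -- overlap in `S₀`. Added term by term they give μ times the window between them.
  sum≈V (suc (suc k)) {f} rec = begin
    f 0 + (f 1 + S₂)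
      ≈⟨ solve 4 (λ a b s t → a :+ (b :+ s) := ((a :+ (b :+ t)) :+ s) :- t) refl (f 0) (f 1) S₂ S₀ ⟩
    (sumTo (odd (suc k)) f + S₂) - S₀
      ≈⟨ +-congʳ (sumTo-+ (odd (suc k)) f (λ i → f (2 ℕ.+ i))) ⟨
    sumTo (odd (suc k)) (λ i → f i + f (2 ℕ.+ i)) - S₀
      ≈⟨ +-congʳ (trans (sumTo-cong (odd (suc k)) rec) (sumTo-* (odd (suc k)) μ (f ∘ suc))) ⟩
    μ * sumTo (odd (suc k)) (f ∘ suc) - S₀
      ≈⟨ +-cong (*-congˡ (sum≈V (suc k) (rec ∘ suc))) (-‿cong (sum≈V k (λ i → rec (2 ℕ.+ i)))) ⟩
    μ * (V (suc k) * f (2 ℕ.+ k)) - V k * f (2 ℕ.+ k)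
      ≈⟨ solve 4 (λ μ v w f → μ :* (w :* f) :- v :* f := (μ :* w) :* f :- v :* f) refl μ (V k) (V (suc k)) (f (2 ℕ.+ k)) ⟩
    μ * V (suc k) * f (2 ℕ.+ k) - V k * f (2 ℕ.+ k)
      ≈⟨ +-congʳ (*-congʳ (V-recurrence k)) ⟨
    (V k + V (2 ℕ.+ k)) * f (2 ℕ.+ k) - V k * f (2 ℕ.+ k)
      ≈⟨ solve 3 (λ v w f → (v :+ w) :* f :- v :* f := w :* f) refl (V k) (V (2 ℕ.+ k)) (f (2 ℕ.+ k)) ⟩
    V (2 ℕ.+ k) * f (2 ℕ.+ k) ∎
    where
    S₂ = sumTo (odd (suc k)) (λ i → f (2 ℕ.+ i))
    S₀ = sumTo (odd k) (λ i → f (2 ℕ.+ i))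

  -- The sum over a period is invariant under the shift, so multiplication by
  -- μ doubles it.
  yV-kills-periodic : ∀ k {f} → Recurrent f → (∀ i → f (odd k ℕ.+ i) ≈ f i) → y * (V k * f 0) ≈ 0#
  yV-kills-periodic k {f} rec periodic = begin
    y * (V k * f 0)                 ≈⟨ *-congˡ (*-congˡ (periodic 0)) ⟨
    y * (V k * f (odd k ℕ.+ 0))     ≡⟨ ≡.cong (λ i → y * (V k * f i)) (≡.trans (ℕₚ.+-identityʳ (odd k)) (odd≡ k)) ⟩
    y * (V k * f (suc (k ℕ.+ k)))
      ≈⟨ solve 3 (λ y v b → y :* (v :* b) := v :* ((con (+ 2) :+ y) :* b) :- con (+ 2) :* (v :* b)) refl y (V k) _ ⟩
    V k * (μ * f (suc (k ℕ.+ k))) - fromℤ (+ 2) * (V k * f (suc (k ℕ.+ k)))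
      ≈⟨ +-congʳ (*-congˡ (rec (k ℕ.+ k))) ⟨
    V k * (f (k ℕ.+ k) + f (2 ℕ.+ (k ℕ.+ k))) - fromℤ (+ 2) * (V k * f (suc (k ℕ.+ k)))
      ≈⟨ +-congʳ (trans (distribˡ _ _ _) (+-cong (sym (constant k)) (constant (suc k)))) ⟩
    (V k * f (suc (k ℕ.+ k)) + V k * f (suc (k ℕ.+ k))) - fromℤ (+ 2) * (V k * f (suc (k ℕ.+ k)))
      ≈⟨ solve 1 (λ a → (a :+ a) :- con (+ 2) :* a := con (+ 0)) refl _ ⟩
    0# ∎
    where
    constant : ∀ m → V k * f (suc (m ℕ.+ k)) ≈ V k * f (m ℕ.+ k)
    constant m = begin
      V k * f (suc (m ℕ.+ k))                ≈⟨ sum≈V k {λ i → f (suc (m ℕ.+ i))} (λ i → shifted (suc m) i) ⟨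
      sumTo (odd k) (λ i → f (suc (m ℕ.+ i))) ≈⟨ sumTo-cong (odd k) (λ i → reflexive (≡.cong f (≡.sym (ℕₚ.+-suc m i)))) ⟩
      sumTo (odd k) (λ i → f (m ℕ.+ suc i))  ≈⟨ sumTo-rotate (odd k) (λ i → f (m ℕ.+ i))
        (trans (reflexive (≡.cong f (≡.trans (ℕₚ.+-comm m (odd k)) (≡.cong (odd k ℕ.+_) (≡.sym (ℕₚ.+-identityʳ m)))))) (periodic (m ℕ.+ 0))) ⟩
      sumTo (odd k) (λ i → f (m ℕ.+ i))      ≈⟨ sum≈V k (shifted m) ⟩
      V k * f (m ℕ.+ k)                      ∎
      where
      shifted : ∀ m → Recurrent (λ i → f (m ℕ.+ i))
      shifted m i = trans (+-congˡ (reflexive (≡.cong f (≡.trans (ℕₚ.+-suc m (suc i)) (≡.cong suc (ℕₚ.+-suc m i))))))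
        (trans (rec (m ℕ.+ i)) (*-congˡ (reflexive (≡.cong f (≡.sym (ℕₚ.+-suc m i))))))

  open Coefficients

  polynomial : ℕ → (ℕ → ℤ) → Carrier
  polynomial zero    c = 0#
  polynomial (suc n) c = fromℤ (c 0) + y * polynomial n (c ∘ suc)

  polynomial-+ : ∀ n c c′ → polynomial n (λ i → c i ℤ.+ c′ i) ≈ polynomial n c + polynomial n c′
  polynomial-+ zero    c c′ = sym (+-identityˡ 0#)
  polynomial-+ (suc n) c c′ = trans (+-cong (fromℤ-+ (c 0) (c′ 0)) (*-congˡ (polynomial-+ n (c ∘ suc) (c′ ∘ suc))))
    (solve 5 (λ a b y p q → (a :+ b) :+ y :* (p :+ q) := (a :+ y :* p) :+ (b :+ y :* q)) refl _ _ y _ _)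

  polynomial-last : ∀ n c → polynomial (suc n) c ≈ polynomial n c + n ^[ y ] * fromℤ (c n)
  polynomial-last zero    c = solve 2 (λ a y → a :+ y :* con (+ 0) := con (+ 0) :+ con (+ 1) :* a) refl (fromℤ (c 0)) y
  polynomial-last (suc n) c = trans (+-congˡ (*-congˡ (polynomial-last n (c ∘ suc))))
    (solve 5 (λ a y p q b → a :+ y :* (p :+ q :* b) := (a :+ y :* p) :+ (y :* q) :* b) refl (fromℤ (c 0)) y _ (n ^[ y ]) _)

  polynomial-last-0 : ∀ n c → c n ≡ + 0 → polynomial (suc n) c ≈ polynomial n c
  polynomial-last-0 n c cₙ≡0 = trans (polynomial-last n c)
    (trans (+-congˡ (trans (*-congˡ (reflexive (≡.cong fromℤ cₙ≡0))) (zeroʳ _))) (+-identityʳ _))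

  D-polynomial : ∀ k → D k ≈ polynomial (suc k) (d k)
  U-polynomial : ∀ k → U k ≈ polynomial k (u k)
  D-polynomial zero    = solve 1 (λ y → con (+ 1) := con (+ 1) :+ y :* con (+ 0)) refl y
  D-polynomial (suc k) = begin
    D k + y * U (suc k)
      ≈⟨ +-cong (D-polynomial k) (*-congˡ (U-polynomial (suc k))) ⟩
    (fromℤ (d k 0) + y * polynomial k (d k ∘ suc)) + y * polynomial (suc k) (u (suc k))
      ≈⟨ +-congʳ (+-cong (reflexive (≡.cong fromℤ (d-0 k))) (*-congˡ (sym (polynomial-last-0 k (d k ∘ suc) (d-above (ℕₚ.n<1+n k)))))) ⟩
    (1# + y * polynomial (suc k) (d k ∘ suc)) + y * polynomial (suc k) (u (suc k))
      ≈⟨ solve 3 (λ y p q → (con (+ 1) :+ y :* p) :+ y :* q := con (+ 1) :+ y :* (p :+ q)) refl y _ _ ⟩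
    1# + y * (polynomial (suc k) (d k ∘ suc) + polynomial (suc k) (u (suc k)))
      ≈⟨ +-congˡ (*-congˡ (polynomial-+ (suc k) (d k ∘ suc) (u (suc k)))) ⟨
    polynomial (2 ℕ.+ k) (d (suc k)) ∎
  U-polynomial zero    = refl
  U-polynomial (suc k) = begin
    U k + D k
      ≈⟨ +-cong (U-polynomial k) (D-polynomial k) ⟩
    polynomial k (u k) + polynomial (suc k) (d k)
      ≈⟨ +-congʳ (polynomial-last-0 k (u k) (u-above (ℕₚ.≤-refl {k}))) ⟨
    polynomial (suc k) (u k) + polynomial (suc k) (d k)
      ≈⟨ polynomial-+ (suc k) (u k) (d k) ⟨
    polynomial (suc k) (u (suc k)) ∎

  V-polynomial : ∀ k → V k ≈ polynomial (suc k) (e k)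
  V-polynomial k = begin
    D k + (U k + U k)
      ≈⟨ +-cong (D-polynomial k) (+-cong U≈ U≈) ⟩
    polynomial (suc k) (d k) + (polynomial (suc k) (u k) + polynomial (suc k) (u k))
      ≈⟨ +-congˡ (polynomial-+ (suc k) (u k) (u k)) ⟨
    polynomial (suc k) (d k) + polynomial (suc k) (λ i → u k i ℤ.+ u k i)
      ≈⟨ polynomial-+ (suc k) (d k) (λ i → u k i ℤ.+ u k i) ⟨
    polynomial (suc k) (e k) ∎
    where U≈ = trans (U-polynomial k) (sym (polynomial-last-0 k (u k) (u-above (ℕₚ.≤-refl {k}))))

  module _ {ν} (y∈ : Adjoin F ν y) where
    open AdjoinProperties F {ν}

    polynomial-divisible : ∀ n c p → (∀ i → i ℕ.< n → ∃[ γ ] c i ≡ p ℤ.* γ) →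
      ∃[ q ] Adjoin F ν q × polynomial n c ≈ fromℤ p * q
    polynomial-divisible zero    c p p∣c = 0# , Adjoin-ℤ (+ 0) , sym (zeroʳ _)
    polynomial-divisible (suc n) c p p∣c =
      let q , q∈ , eq = polynomial-divisible n (c ∘ suc) p (λ i i<n → p∣c (suc i) (ℕ.s<s i<n))
          γ , c₀≡pγ = p∣c 0 ℕ.z<s
      in fromℤ γ + y * q , plus (Adjoin-ℤ γ) (times y∈ q∈) ,
         trans (+-cong (trans (reflexive (≡.cong fromℤ c₀≡pγ)) (fromℤ-* p γ)) (*-congˡ eq))
           (solve 4 (λ p γ y q → p :* γ :+ y :* (p :* q) := p :* (γ :+ y :* q)) refl (fromℤ p) (fromℤ γ) y q)

    -- The constant term is p, the intermediate coefficients are multiples of p, and the leading one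
    -- is 1. The cofactor `q` is kept inside ℤ[ν] so that norms of expressions in it are integers.
    V-Eisenstein : ∀ k → Prime (suc (suc k ℕ.+ suc k)) →
      ∃[ q ] Adjoin F ν q × V (suc k) ≈ fromℤ (+ suc (suc k ℕ.+ suc k)) * (1# + y * q) + suc k ^[ y ]
    V-Eisenstein k p-prime =
      let q , q∈ , eq = polynomial-divisible k (e (suc k) ∘ suc) (+ suc (suc k ℕ.+ suc k)) (λ i i<k → e-divisible p-prime (ℕ.s<s i<k))
      in q , q∈ , (begin
        V (suc k)
          ≈⟨ V-polynomial (suc k) ⟩
        fromℤ (e (suc k) 0) + y * polynomial (suc k) (e (suc k) ∘ suc)
          ≈⟨ +-cong (reflexive (≡.cong fromℤ (e-0 (suc k)))) (*-congˡ (trans (polynomial-last k (e (suc k) ∘ suc))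
               (+-cong eq (*-congˡ (reflexive (≡.cong fromℤ (e-diagonal (suc k)))))))) ⟩
        p + y * (p * q + k ^[ y ] * 1#)
          ≈⟨ solve 4 (λ p y q t → p :+ y :* (p :* q :+ t :* con (+ 1)) := p :* (con (+ 1) :+ y :* q) :+ y :* t) refl p y q _ ⟩
        p * (1# + y * q) + suc k ^[ y ] ∎)
      where p = fromℤ (+ suc (suc k ℕ.+ suc k))

module _ {K : Extension ℚ-field} {b} (isBasis : IsBasis K {2} b) {n} (Γ : Graph n)
         {μ} (eigenvalue : IsEigenvalue Γ (Extension.top K) μ) where
  open Norm K isBasis
  open Field (Extension.top K)
  open IntegerCoefficients commutativeRing
  open SetoidReasoning setoid
  open AdjoinProperties (Extension.top K) {μ}
  open Powers commutativeRing
  private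
    y : Carrier
    y = μ - fromℤ (+ 2)
    y∈ : Adjoin (Extension.top K) μ y
    y∈ = plus adjoined (minus (Adjoin-ℤ (+ 2)))
  open Chebyshev (Extension.top K) (μ - fromℤ (+ 2)) using (V; V-Eisenstein)

  V≉0 : ∀ k → 3 ℕ.≤ k → Prime (suc (k ℕ.+ k)) → ¬ (V k ≈ 0#)
  V≉0 (suc (suc (suc k))) (ℕ.s≤s (ℕ.s≤s (ℕ.s≤s _))) p-prime V≈0 =
    ramification-bound Γ eigenvalue p-prime (3 ℕ.+ k) {y} {r} {s} y∈ r∈ s∈ yᵏ≈pr p≈y³s
    where
    Eisenstein = V-Eisenstein y∈ (2 ℕ.+ k) p-prime
    q  = proj₁ Eisenstein
    q∈ = proj₁ (proj₂ Eisenstein)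
    p t r s : Carrier
    p = fromℤ (+ suc ((3 ℕ.+ k) ℕ.+ (3 ℕ.+ k)))
    t = k ^[ y ]
    r = - (1# + y * q)
    -- From p (1 + y q) = - y³ t, multiplication by 1 - y q + (y q)² turns 1 + y q into 1 + y³ q³.
    -- Hence p is a multiple of y³, even if 1 + y q is not a unit.
    s = - (t * (1# - y * q + y * q * (y * q))) - p * (q * (q * q))
    h : p * (1# + y * q) + y * (y * (y * t)) ≈ 0#
    h = trans (sym (proj₂ (proj₂ Eisenstein))) V≈0
    yq∈ = times y∈ q∈
    r∈ : Adjoin (Extension.top K) μ r
    r∈ = minus (plus one yq∈)
    s∈ : Adjoin (Extension.top K) μ s
    s∈ = plus (minus (times (Adjoin-^ k y∈) (plus (plus one (minus yq∈)) (times yq∈ yq∈))))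
              (minus (times (Adjoin-ℤ (+ suc ((3 ℕ.+ k) ℕ.+ (3 ℕ.+ k)))) (times q∈ (times q∈ q∈))))
    yᵏ≈pr : y * (y * (y * t)) ≈ p * r
    yᵏ≈pr = begin
      y * (y * (y * t))
        ≈⟨ solve 4 (λ p y q t → y :* (y :* (y :* t)) := (p :* (con (+ 1) :+ y :* q) :+ y :* (y :* (y :* t))) :+ p :* (:- (con (+ 1) :+ y :* q))) refl p y q t ⟩
      (p * (1# + y * q) + y * (y * (y * t))) + p * r  ≈⟨ trans (+-congʳ h) (+-identityˡ _) ⟩
      p * r ∎
    p≈y³s : p ≈ y * (y * y) * s
    p≈y³s = begin
      p ≈⟨ solve 4 (λ p y q t → let one = con (+ 1) in
             p := (p :* (one :+ y :* q) :+ y :* (y :* (y :* t))) :* (one :- y :* q :+ y :* q :* (y :* q))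
               :+ y :* (y :* y) :* ((:- (t :* (one :- y :* q :+ y :* q :* (y :* q)))) :- p :* (q :* (q :* q)))) refl p y q t ⟩
      (p * (1# + y * q) + y * (y * (y * t))) * (1# - y * q + y * q * (y * q)) + y * (y * y) * s
        ≈⟨ trans (+-congʳ (trans (*-congʳ h) (zeroˡ _))) (+-identityˡ _) ⟩
      y * (y * y) * s ∎

-- Graphs that are not 2-integral

module _ {a ℓ} (R : CommutativeRing a ℓ) where
  open CommutativeRing R
  open IntegerCoefficients R
  open Powers R
  open SetoidReasoning setoid

  -- The hypotheses say that η + η⁻¹ = ψ is a root of X² + X - 1, as the traces of primitive fifth
  -- roots of unity are.
  golden⇒η⁵≈1 : ∀ {ψ η} → ψ * ψ + ψ ≈ 1# → η * η + 1# ≈ ψ * η → 5 ^[ η ] ≈ 1#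
  golden⇒η⁵≈1 {ψ} {η} ψ²+ψ≈1 η²+1≈ψη = begin
    5 ^[ η ]
      -- The cofactors come from dividing η⁵ - 1 by η² - ψ η + 1 and then the remainder by ψ² + ψ -
      -- 1.
      ≈⟨ solve 2 (λ ψ η → η :* (η :* (η :* (η :* (η :* unit)))) :=
           unit :+ ((η :* η :+ unit) :- ψ :* η) :* (η :* η :* η :+ ψ :* η :* η :+ (ψ :* ψ :- unit) :* η :+ (ψ :* ψ :* ψ :- ψ :- ψ))
               :+ ((ψ :* ψ :+ ψ) :- unit) :* ((ψ :* ψ :- ψ :- unit) :* η :- (ψ :- unit))) refl ψ η ⟩
    1# + ((η * η + 1#) - ψ * η) * _ + ((ψ * ψ + ψ) - 1#) * _
      ≈⟨ +-cong (+-congˡ (trans (*-congʳ (trans (+-congʳ η²+1≈ψη) (-‿inverseʳ _))) (zeroˡ _)))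
                (trans (*-congʳ (trans (+-congʳ ψ²+ψ≈1) (-‿inverseʳ _))) (zeroˡ _)) ⟩
    1# + 0# + 0#   ≈⟨ trans (+-identityʳ _) (+-identityʳ _) ⟩
    1#             ∎
    where
    unit : ∀ {n} → Polynomial n
    unit = con (+ 1)

module RootsOfUnity {a ℓ} (R : CommutativeRing a ℓ) (x : CommutativeRing.Carrier R) where
  open CommutativeRing R
  open IntegerCoefficients R
  open Quadratic R x (- 1#)
  private module Q = CommutativeRing quadraticRing
  open Powers quadraticRing
  open MonoidMultiples Q.*-monoid using (×-assocˡ; ×-congʳ)

  private
    Pair : Set
    Pair = Polynomial 1 × Polynomial 1

    -- The multiplication of the quadratic ring repeated on solver expressions, so that powers of ζ
    -- can be expanded inside solver goals.
    mulᵖ : Polynomial 1 → Pair → Pair → Pair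
    mulᵖ x (a , b) (c , d) = a :* c :+ (:- con (+ 1)) :* (b :* d) , a :* d :+ b :* c :+ x :* (b :* d)

    powᵖ : Polynomial 1 → ℕ → Pair → Pair
    powᵖ x zero    p = con (+ 1) , con (+ 0)
    powᵖ x (suc n) p = mulᵖ x p (powᵖ x n p)

    ζ ζ̄ : Q.Carrier
    ζ = generator
    ζ̄ = embed x Q.+ (Q.- ζ)

    ζᵖ : Pair
    ζᵖ = con (+ 0) , con (+ 1)

    ζ̄ᵖ : Polynomial 1 → Pair
    ζ̄ᵖ x = x :+ (:- con (+ 0)) , con (+ 0) :+ (:- con (+ 1))

  -- The polynomial that expresses ζ⁵ + ζ⁻⁵ through x = ζ + ζ⁻¹.
  w₅ : Carrier
  w₅ = x * (x * (x * (x * x))) - fromℤ (+ 5) * (x * (x * x)) + fromℤ (+ 5) * x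

  ζ⁵+ζ̄⁵≈w₅ : 5 ^[ ζ ] Q.+ 5 ^[ ζ̄ ] Q.≈ embed w₅
  ζ⁵+ζ̄⁵≈w₅ =
      solve 1 (λ x → proj₁ (powᵖ x 5 ζᵖ) :+ proj₁ (powᵖ x 5 (ζ̄ᵖ x)) :=
        x :* (x :* (x :* (x :* x))) :- con (+ 5) :* (x :* (x :* x)) :+ con (+ 5) :* x) refl x
    , solve 1 (λ x → proj₂ (powᵖ x 5 ζᵖ) :+ proj₂ (powᵖ x 5 (ζ̄ᵖ x)) := con (+ 0)) refl x

  ζ⁵ζ̄⁵≈1 : 5 ^[ ζ ] Q.* 5 ^[ ζ̄ ] Q.≈ Q.1#
  ζ⁵ζ̄⁵≈1 =
      solve 1 (λ x → proj₁ (mulᵖ x (powᵖ x 5 ζᵖ) (powᵖ x 5 (ζ̄ᵖ x))) := con (+ 1)) refl x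
    , solve 1 (λ x → proj₂ (mulᵖ x (powᵖ x 5 ζᵖ) (powᵖ x 5 (ζ̄ᵖ x))) := con (+ 0)) refl x

  private
    embed-golden : ∀ {ψ} → ψ * ψ + ψ ≈ 1# → embed ψ Q.* embed ψ Q.+ embed ψ Q.≈ Q.1#
    embed-golden {ψ} ψ²+ψ≈1 = Q.trans (Q.+-congʳ {embed ψ} (Q.sym (embed-* ψ ψ))) (Q.trans (Q.sym (embed-+ (ψ * ψ) ψ)) (ψ²+ψ≈1 , refl))

  golden⇒ζ⁵≈1 : x * x + x ≈ 1# → 5 ^[ ζ ] Q.≈ Q.1#
  golden⇒ζ⁵≈1 x²+x≈1 = golden⇒η⁵≈1 quadraticRing {embed x} {ζ} (embed-golden x²+x≈1)
    ( solve 1 (λ x → proj₁ (mulᵖ x ζᵖ ζᵖ) :+ con (+ 1) := proj₁ (mulᵖ x (x , con (+ 0)) ζᵖ)) refl x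
    , solve 1 (λ x → proj₂ (mulᵖ x ζᵖ ζᵖ) :+ con (+ 0) := proj₂ (mulᵖ x (x , con (+ 0)) ζᵖ)) refl x )

  trace : ∀ N → N ^[ ζ ] Q.≈ Q.1# → IsRootOfUnityTrace R N x
  trace N ζᴺ≈1 = record { ζᴺ≈1 = ζᴺ≈1 }

  golden⇒trace : ∀ m → x * x + x ≈ 1# → IsRootOfUnityTrace R (m ℕ.* 5) x
  golden⇒trace m x²+x≈1 = trace (m ℕ.* 5) (Q.trans (Q.sym (×-assocˡ ζ m 5)) (Q.trans (×-congʳ m (golden⇒ζ⁵≈1 x²+x≈1)) (1^n≈1 m)))
    where
    1^n≈1 : ∀ n → n ^[ Q.1# ] Q.≈ Q.1#
    1^n≈1 zero    = Q.refl
    1^n≈1 (suc n) = Q.trans (Q.*-identityˡ (n ^[ Q.1# ])) (1^n≈1 n)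

  -- Here η = ζ⁵ satisfies η + η⁻¹ = ψ, so η is a fifth root of unity.
  w₅≈golden⇒trace²⁵ : ∀ {ψ} → ψ * ψ + ψ ≈ 1# → w₅ ≈ ψ → IsRootOfUnityTrace R 25 x
  w₅≈golden⇒trace²⁵ {ψ} ψ²+ψ≈1 w₅≈ψ = trace 25 (Q.trans (Q.sym (×-assocˡ ζ 5 5))
    (golden⇒η⁵≈1 quadraticRing {embed ψ} {η} (embed-golden ψ²+ψ≈1) (begin
      η Q.* η Q.+ Q.1#          ≈⟨ Q.+-congˡ {η Q.* η} (Q.sym ζ⁵ζ̄⁵≈1) ⟩
      η Q.* η Q.+ η Q.* η̄       ≈⟨ Q.distribˡ η η η̄ ⟨
      η Q.* (η Q.+ η̄)           ≈⟨ Q.*-congˡ {η} (Q.trans ζ⁵+ζ̄⁵≈w₅ (w₅≈ψ , refl)) ⟩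
      η Q.* embed ψ             ≈⟨ Q.*-comm η (embed ψ) ⟩
      embed ψ Q.* η             ∎)))
    where
    open SetoidReasoning Q.setoid
    η η̄ : Q.Carrier
    η = 5 ^[ ζ ]
    η̄ = 5 ^[ ζ̄ ]

module GoldenRamification
  {K : Extension ℚ-field} {b} (isBasis : IsBasis K {2} b) {n} (Γ : Graph n)
  {μ} (eigenvalue : IsEigenvalue Γ (Extension.top K) μ) where
  open Norm K isBasis
  open Field (Extension.top K)
  open IntegerCoefficients commutativeRing
  open SetoidReasoning setoid
  open AdjoinProperties (Extension.top K) {μ}
  open Powers commutativeRing
  open RootsOfUnity commutativeRing μ using (w₅)

  private
    -- Z = y q² is w₅ - 2, so w₅ = ψ gives Z² + 5 Z + 5 = 0 and 5 = Z² W. As y divides Z, it divides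
    -- 5 and hence q, with q = y s′; then 5 = y² q⁴ W = y³ s. Moreover `g` is (Z - y⁵) / 5, and
    -- expanding y¹⁰ = (Z - 5 g)² modulo the equation for Z gives 5 r.
    five y q Z W s g r s′ : Carrier
    five = fromℤ (+ 5)
    y = μ - fromℤ (+ 2)
    q = y * y + five * y + five
    Z = y * (q * q)
    W = Z + fromℤ (+ 4)
    s′ = y + five + y * (q * (q * (q * q))) * W
    s = q * (q * q) * s′ * W
    g = y * (y + 1#) * (fromℤ (+ 2) * (y * y) + five * (y + 1#))
    r = five * (g * g) - (Z + 1#) - fromℤ (+ 2) * (Z * g)

    y∈ : Adjoin (Extension.top K) μ y
    y∈ = plus adjoined (minus (Adjoin-ℤ (+ 2)))
    five∈ = Adjoin-ℤ (+ 5)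
    q∈ : Adjoin (Extension.top K) μ q
    q∈ = plus (plus (times y∈ y∈) (times five∈ y∈)) five∈
    Z∈ : Adjoin (Extension.top K) μ Z
    Z∈ = times y∈ (times q∈ q∈)
    W∈ : Adjoin (Extension.top K) μ W
    W∈ = plus Z∈ (Adjoin-ℤ (+ 4))
    s∈ : Adjoin (Extension.top K) μ s
    s∈ = times (times (times q∈ (times q∈ q∈))
                 (plus (plus y∈ five∈) (times (times y∈ (times q∈ (times q∈ (times q∈ q∈)))) W∈))) W∈
    g∈ : Adjoin (Extension.top K) μ g
    g∈ = times (times y∈ (plus y∈ one)) (plus (times (Adjoin-ℤ (+ 2)) (times y∈ y∈)) (times five∈ (plus y∈ one)))
    r∈ : Adjoin (Extension.top K) μ r
    r∈ = plus (plus (times five∈ (times g∈ g∈)) (minus (plus Z∈ one))) (minus (times (Adjoin-ℤ (+ 2)) (times Z∈ g∈)))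

  w₅≉golden : ∀ {ψ} → ψ * ψ + ψ ≈ 1# → ¬ (w₅ ≈ ψ)
  w₅≉golden {ψ} ψ²+ψ≈1 w₅≈ψ = ramification-bound Γ eigenvalue prime[5] 10 {y} {r} {s} y∈ r∈ s∈ y¹⁰≈5r 5≈y³s
    where
    prime[5] : Prime 5
    prime[5] = from-yes (prime? 5)
    Z+2≈ψ : Z + fromℤ (+ 2) ≈ ψ
    Z+2≈ψ = trans (solve 1 (λ μ → let y = μ :- con (+ 2); q = y :* y :+ con (+ 5) :* y :+ con (+ 5) in
      y :* (q :* q) :+ con (+ 2) := μ :* (μ :* (μ :* (μ :* μ))) :- con (+ 5) :* (μ :* (μ :* μ)) :+ con (+ 5) :* μ) refl μ) w₅≈ψ
    h : Z * Z + five * Z + five ≈ 0#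
    h = begin
      Z * Z + five * Z + five
        ≈⟨ solve 1 (λ Z → Z :* Z :+ con (+ 5) :* Z :+ con (+ 5)
             := ((Z :+ con (+ 2)) :* (Z :+ con (+ 2)) :+ (Z :+ con (+ 2))) :- con (+ 1)) refl Z ⟩
      ((Z + fromℤ (+ 2)) * (Z + fromℤ (+ 2)) + (Z + fromℤ (+ 2))) - 1#
        ≈⟨ +-congʳ (trans (+-cong (*-cong Z+2≈ψ Z+2≈ψ) Z+2≈ψ) ψ²+ψ≈1) ⟩
      1# - 1#   ≈⟨ -‿inverseʳ 1# ⟩
      0#        ∎
    5≈Z²W : five ≈ Z * Z * W
    5≈Z²W = begin
      five ≈⟨ solve 1 (λ Z → con (+ 5) := Z :* Z :* (Z :+ con (+ 4)) :- (Z :* Z :+ con (+ 5) :* Z :+ con (+ 5)) :* (Z :- con (+ 1))) refl Z ⟩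
      Z * Z * W - (Z * Z + five * Z + five) * (Z - 1#)   ≈⟨ +-congˡ (-‿cong (trans (*-congʳ h) (zeroˡ _))) ⟩
      Z * Z * W - 0#                                     ≈⟨ solve 1 (λ a → a :- con (+ 0) := a) refl _ ⟩
      Z * Z * W                                          ∎
    q≈ys′ : q ≈ y * s′
    q≈ys′ = begin
      y * y + five * y + five             ≈⟨ +-congˡ 5≈Z²W ⟩
      y * y + five * y + Z * Z * W
        ≈⟨ solve 4 (λ y q W f → y :* y :+ f :* y :+ (y :* (q :* q)) :* (y :* (q :* q)) :* W
             := y :* (y :+ f :+ y :* (q :* (q :* (q :* q))) :* W)) refl y q W five ⟩
      y * s′                              ∎
    5≈y³s : five ≈ y * (y * y) * s
    5≈y³s = begin
      five                                            ≈⟨ 5≈Z²W ⟩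
      Z * Z * W                                       ≈⟨ solve 3 (λ y q W → (y :* (q :* q)) :* (y :* (q :* q)) :* W := q :* (y :* y :* (q :* (q :* q)) :* W)) refl y q W ⟩
      q * (y * y * (q * (q * q)) * W)                 ≈⟨ *-congʳ q≈ys′ ⟩
      y * s′ * (y * y * (q * (q * q)) * W)
        ≈⟨ solve 4 (λ y q W s → y :* s :* (y :* y :* (q :* (q :* q)) :* W) := y :* (y :* y) :* (q :* (q :* q) :* s :* W)) refl y q W s′ ⟩
      y * (y * y) * s                                 ∎
    y¹⁰≈5r : 10 ^[ y ] ≈ five * r
    y¹⁰≈5r = begin
      10 ^[ y ]
        ≈⟨ solve 1 (λ y → let five = con (+ 5); q = y :* y :+ five :* y :+ five; Z = y :* (q :* q)
                              g = y :* (y :+ con (+ 1)) :* (con (+ 2) :* (y :* y) :+ five :* (y :+ con (+ 1))) in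
             y :* (y :* (y :* (y :* (y :* (y :* (y :* (y :* (y :* (y :* con (+ 1))))))))))
               := (Z :* Z :+ five :* Z :+ five) :+ five :* (five :* (g :* g) :- (Z :+ con (+ 1)) :- con (+ 2) :* (Z :* g))) refl y ⟩
      (Z * Z + five * Z + five) + five * r   ≈⟨ trans (+-congʳ h) (+-identityˡ _) ⟩
      five * r                               ∎

module _ {n} (Γ : Graph n) where

  -- Otherwise the image of ℚ would be an intermediate field containing all
  -- eigenvalues, and K would be ℚ.
  irrationalEigenvalue : (K : Extension ℚ-field) → IsSplittingField Γ K → HasDegree K 2 →
    (∀ {μ} → IsEigenvalue Γ (Extension.top K) μ → ExtensionProperties.InBase K μ) → ⊥
  irrationalEigenvalue K split (b , isBasis) rational = 1≢0 (proj₁ (vanish 1ℚ 0ℚ (begin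
    ι 1ℚ * b₀ + ι 0ℚ * b₁    ≈⟨ +-cong (*-congˡ b₀≈0) (*-congʳ ι-0) ⟩
    ι 1ℚ * 0# + 0# * b₁      ≈⟨ solve 2 (λ a b → a :* con (+ 0) :+ con (+ 0) :* b := con (+ 0)) refl _ _ ⟩
    0#                       ∎)))
    where
    open ExtensionProperties K
    open Field top hiding (zero)
    open IntegerCoefficients commutativeRing
    open IsBasis isBasis
    open SetoidReasoning setoid
    intermediate : IsIntermediateField K InBase
    intermediate = record
      { respects = λ { x≈y (a , ιa≈x) → a , trans ιa≈x x≈y }
      ; base = λ a → a , refl
      ; +-closed = λ { (a , p) (b , q) → a ℚ.+ b , trans (ι-+ a b) (+-cong p q) }
      ; *-closed = λ { (a , p) (b , q) → a ℚ.* b , trans (ι-* a b) (*-cong p q) }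
      ; -‿closed = λ { (a , p) → ℚ.- a , trans (ι-neg a) (-‿cong p) }
      ; ⁻¹-closed = λ { {x} {y} (a , ιa≈x) xy≈1 →
          let a≢0 : a ≢ 0ℚ
              a≢0 = λ { ≡.refl → 0≉1 (trans (sym (trans (*-congʳ (trans (sym ιa≈x) ι-0)) (zeroˡ y))) xy≈1) }
              c , ca≡1 , _ = Field.inverse ℚ-field a a≢0
          in c , (begin
            ι c                  ≈⟨ *-identityʳ _ ⟨
            ι c * 1#             ≈⟨ *-congˡ (trans (*-congʳ ιa≈x) xy≈1) ⟨
            ι c * (ι a * y)      ≈⟨ *-assoc _ _ _ ⟨
            ι c * ι a * y        ≈⟨ *-congʳ (trans (sym (ι-* c a)) (trans (ι-cong ca≡1) ι-1)) ⟩
            1# * y               ≈⟨ *-identityˡ y ⟩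
            y                    ∎) }
      }
    everything : ∀ x → InBase x
    everything = IsSplittingField.smallest split InBase intermediate (λ μ → rational {μ})
    b₀ b₁ : Carrier
    b₀ = b zero
    b₁ = b (suc zero)
    vanish : ∀ p q → ι p * b₀ + ι q * b₁ ≈ 0# → p ≡ 0ℚ × q ≡ 0ℚ
    vanish p q eq =
      let zeros = independent (λ { zero → p ; (suc _) → q }) (trans (+-congˡ (+-identityʳ _)) eq)
      in zeros zero , zeros (suc zero)
    p q : ℚ
    p = proj₁ (everything b₀)
    q = proj₁ (everything b₁)
    -- If b₀ = ι p and b₁ = ι q are both rational, then q b₀ - p b₁ = 0 is a relation between the
    -- basis elements.
    p≡0 : ℚ.- p ≡ 0ℚ
    p≡0 = proj₂ (vanish q (ℚ.- p) (begin
      ι q * b₀ + ι (ℚ.- p) * b₁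
        ≈⟨ +-cong (*-congʳ (proj₂ (everything b₁))) (*-congʳ (trans (ι-neg p) (-‿cong (proj₂ (everything b₀))))) ⟩
      b₁ * b₀ + (- b₀) * b₁    ≈⟨ solve 2 (λ a b → b :* a :+ (:- a) :* b := con (+ 0)) refl b₀ b₁ ⟩
      0#                       ∎))
    b₀≈0 : b₀ ≈ 0#
    b₀≈0 = begin
      b₀                  ≈⟨ proj₂ (everything b₀) ⟨
      ι p                 ≈⟨ solve 1 (λ a → a := :- (:- a)) refl (ι p) ⟩
      - - ι p             ≈⟨ -‿cong (trans (sym (ι-neg p)) (trans (ι-cong p≡0) ι-0)) ⟩
      - 0#                ≈⟨ solve 0 (:- con (+ 0) := con (+ 0)) refl ⟩
      0#                  ∎
    1≢0 : 1ℚ ≢ 0ℚ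
    1≢0 ()

  -- Any multiple of the length of the cycle through `i` may serve as `N`; in particular 10 serves
  -- for cycles of length 5.
  WalksOfPeriod : ℕ → Set
  WalksOfPeriod N = ∀ i → ∃[ x ] IsWalk Γ x × x 0 ≡ i × (∀ k → x (N ℕ.+ k) ≡ x k)

  module _ (F : Field) {μ} (eigenvalue : IsEigenvalue Γ F μ) where
    open Field F
    open WalkProperties Γ F

    walkSequence : ∀ {N} → WalksOfPeriod N →
      ∃[ c ] ¬ (c 0 ≈ 0#) × (∀ k → c k + c (2 ℕ.+ k) ≈ μ * c (suc k)) × (∀ k → c (N ℕ.+ k) ≈ c k)
    walkSequence walks =
      let v , v≉0 , v-eigen = eigenvalue
          i , vᵢ≉0 = Finₚ.¬∀⟶∃¬ n _ (λ i → v i ≟ 0#) v≉0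
          x , walk , x₀≡i , periodic = walks i
      in v ∘ x , (λ vx₀≈0 → vᵢ≉0 (≡.subst (λ i → v i ≈ 0#) x₀≡i vx₀≈0)) , walk-recurrence walk v-eigen ,
         λ k → reflexive (≡.cong v (periodic k))

  -- Period 4 forces μ³ = 4 μ, so every eigenvalue is one of 0, 2 and -2.
  period4⇒¬2Integral : WalksOfPeriod 4 → ¬ Is2Integral Γ
  period4⇒¬2Integral walks (K , split , degree) = irrationalEigenvalue K split degree rational
    where
    open ExtensionProperties K
    open Field top hiding (zero)
    open IntegerCoefficients commutativeRing
    open FieldProperties top
    open SetoidReasoning setoid
    rational : ∀ {μ} → IsEigenvalue Γ top μ → InBase μ
    rational {μ} eigenvalue with c , c₀≉0 , rec , periodic ← walkSequence top eigenvalue walks =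
      [ integerRoot K (+ 0) , (λ eq → [ integerRoot K (+ 2) , integerRoot K -[1+ 1 ] ]′ (x*y≈0⇒x≈0∨y≈0 eq)) ]′
        (x*y≈0⇒x≈0∨y≈0 ([ (λ eq → eq) , (λ c₀≈0 → ⊥-elim (c₀≉0 c₀≈0)) ]′ (x*y≈0⇒x≈0∨y≈0 product≈0)))
      where
      μ³c₀≈4μc₀ : μ * (μ * (μ * c 0)) ≈ fromℤ (+ 4) * (μ * c 0)
      μ³c₀≈4μc₀ = begin
        μ * (μ * (μ * c 0))                ≈⟨ *-congˡ (*-congˡ μc₀) ⟩
        μ * (μ * (c 3 + c 1))              ≈⟨ *-congˡ (trans (distribˡ μ _ _) (+-cong (sym (trans (+-congˡ (sym (periodic 0))) (rec 2))) (sym (rec 0)))) ⟩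
        μ * ((c 2 + c 0) + (c 0 + c 2))    ≈⟨ solve 3 (λ μ a c → μ :* ((c :+ a) :+ (a :+ c)) := con (+ 2) :* (μ :* a) :+ con (+ 2) :* (μ :* c)) refl μ (c 0) (c 2) ⟩
        fromℤ (+ 2) * (μ * c 0) + fromℤ (+ 2) * (μ * c 2)
          ≈⟨ +-congˡ (*-congˡ (trans (sym (rec 1)) (trans (+-comm (c 1) (c 3)) (sym μc₀)))) ⟩
        fromℤ (+ 2) * (μ * c 0) + fromℤ (+ 2) * (μ * c 0)
          ≈⟨ solve 1 (λ a → con (+ 2) :* a :+ con (+ 2) :* a := con (+ 4) :* a) refl (μ * c 0) ⟩
        fromℤ (+ 4) * (μ * c 0)            ∎
        where
        μc₀ : μ * c 0 ≈ c 3 + c 1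
        μc₀ = trans (*-congˡ (sym (periodic 0))) (trans (sym (rec 3)) (+-congˡ (periodic 1)))
      product≈0 : ((μ - fromℤ (+ 0)) * ((μ - fromℤ (+ 2)) * (μ - fromℤ -[1+ 1 ]))) * c 0 ≈ 0#
      product≈0 = begin
        ((μ - fromℤ (+ 0)) * ((μ - fromℤ (+ 2)) * (μ - fromℤ -[1+ 1 ]))) * c 0
          ≈⟨ solve 2 (λ μ a → (μ :- con (+ 0)) :* ((μ :- con (+ 2)) :* (μ :- con -[1+ 1 ])) :* a
               := μ :* (μ :* (μ :* a)) :- con (+ 4) :* (μ :* a)) refl μ (c 0) ⟩
        μ * (μ * (μ * c 0)) - fromℤ (+ 4) * (μ * c 0)   ≈⟨ +-congʳ μ³c₀≈4μc₀ ⟩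
        fromℤ (+ 4) * (μ * c 0) - fromℤ (+ 4) * (μ * c 0) ≈⟨ -‿inverseʳ _ ⟩
        0# ∎

  -- Periodicity forces y V k = 0. Here y = 0 means μ = 2, V 1 = 0 means μ = -1, and for k ≥ 3
  -- ramification rules out V k = 0. For k = 2 the roots of `V 2` generate a field of degree 2.
  oddPrimePeriod⇒¬2Integral : ∀ k → 0 ℕ.< k → k ≢ 2 → Prime (suc (k ℕ.+ k)) →
    WalksOfPeriod (suc (k ℕ.+ k)) → ¬ Is2Integral Γ
  oddPrimePeriod⇒¬2Integral k 0<k k≢2 p-prime walks (K , split , (b , isBasis)) =
    irrationalEigenvalue K split (b , isBasis) rational
    where
    open ExtensionProperties K
    open Field top hiding (zero)
    open IntegerCoefficients commutativeRing
    open FieldProperties top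
    open SetoidReasoning setoid
    rational : ∀ {μ} → IsEigenvalue Γ top μ → InBase μ
    rational {μ} eigenvalue with c , c₀≉0 , rec , periodic ← walkSequence top eigenvalue walks =
      [ integerRoot K (+ 2) , (λ Vc₀≈0 → V≈0⇒rational k 0<k k≢2 p-prime ([ (λ V≈0 → V≈0) , (λ c₀≈0 → ⊥-elim (c₀≉0 c₀≈0)) ]′ (x*y≈0⇒x≈0∨y≈0 Vc₀≈0))) ]′
        (x*y≈0⇒x≈0∨y≈0 (yV-kills-periodic k
          (λ i → trans (rec i) (*-congʳ (solve 1 (λ μ → μ := con (+ 2) :+ (μ :- con (+ 2))) refl μ)))
          (λ i → trans (reflexive (≡.cong (λ p → c (p ℕ.+ i)) (odd≡ k))) (periodic i))))
      where
      open Chebyshev top (μ - fromℤ (+ 2))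
      V≈0⇒rational : ∀ k → 0 ℕ.< k → k ≢ 2 → Prime (suc (k ℕ.+ k)) → V k ≈ 0# → InBase μ
      V≈0⇒rational 1 _ _ _ V≈0 = integerRoot K -[1+ 0 ] (trans
        (solve 1 (λ μ → let y = μ :- con (+ 2); u₁ = con (+ 0) :+ con (+ 1) in
          μ :- con -[1+ 0 ] := (con (+ 1) :+ y :* u₁) :+ (u₁ :+ u₁)) refl μ) V≈0)
      V≈0⇒rational 2 _ 2≢2 _ _ = ⊥-elim (2≢2 ≡.refl)
      V≈0⇒rational (suc (suc (suc k))) _ _ p-prime V≈0 =
        ⊥-elim (V≉0 isBasis Γ eigenvalue (3 ℕ.+ k) (ℕ.s≤s (ℕ.s≤s (ℕ.s≤s ℕ.z≤n))) p-prime V≈0)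

  module Period25 {x : ℕ → Fin n} (walk : IsWalk Γ x) (periodic : ∀ k → x (25 ℕ.+ k) ≡ x k)
                  (injective₀ : ∀ k → suc k ℕ.< 25 → x (suc k) ≢ x 0)
                  (K : Extension ℚ-field) (split : IsSplittingField Γ K) {b} (isBasis : IsBasis K {2} b) where
    open Extension K using (top)
    private module K = Field top
    private module KZ = IntegerCoefficients K.commutativeRing

    private
      -- K² and K⁵ play the roles of K[X]/(X² + X - 1) and
      -- K[X]/(X⁵ - 5X³ + 5X - ψ), with τ as multiplication by X.
      K¹ = TensorUnit.leftModule {R = K.ring}
      K² = DirectProduct.leftModule K¹ K¹
      K⁵ = DirectProduct.leftModule K¹ (DirectProduct.leftModule K¹ (DirectProduct.leftModule K¹ K²))

      module ExtensionRoots (L : Extension top) where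
        open ExtensionProperties L public renaming (top to top′; ι to ι′)
        open Field top′ public
        open IntegerCoefficients commutativeRing public
        open SetoidReasoning setoid public
        open RootsOfUnity commutativeRing public

        eigenvalueIn : ∀ x → IsEigenvalue Γ top′ x → InBase x
        eigenvalueIn = IsSplittingField.containsEigenvalues split L

        trace²⁵⇒eigenvalue : ∀ x → IsRootOfUnityTrace commutativeRing 25 x → IsEigenvalue Γ top′ x
        trace²⁵⇒eigenvalue x = WalkProperties.rootOfUnity⇒eigenvalue Γ top′ x {25} walk ℕ.z<s (periodic 0) (periodic 1) injective₀

    goldenPolynomial : List K.Carrier
    goldenPolynomial = K.- K.1# ∷ K.1# ∷ K.1# ∷ []

    -- A root in an extension of `K` is the trace of a fifth, hence of a 25th root of unity. It is
    -- therefore an eigenvalue there and lies in `K`.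
    goldenRoot : ¬ (∀ ψ → ¬ (evaluate top (λ a → a) goldenPolynomial ψ K.≈ K.0#))
    goldenRoot noRoot = Root.noMonicAnnihilator (×-decidable K._≟_ K._≟_) goldenPolynomial kills rootsIn noRoot
      (K.1# , K.0#) (λ (1≈0 , _) → K.0≉1 (K.sym 1≈0)) (K.- K.1# ∷ K.1# ∷ [])
      (monic≈0₁ K.1# K.0# , monic≈0₂ K.1# K.0#)
      where
      τ : K.Carrier × K.Carrier → K.Carrier × K.Carrier
      τ (a , b) = b , a K.- b
      isLinear : IsLinear top K² τ
      isLinear = record
        { τ-cong = λ (p , q) → q , K.+-cong p (K.-‿cong q)
        ; τ-+    = λ (a , b) (c , d) → K.refl , KZ.solve 4 (λ a b c d → (a KZ.:+ c) KZ.:- (b KZ.:+ d) KZ.:= (a KZ.:- b) KZ.:+ (c KZ.:- d)) K.refl a b c d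
        ; τ-*ₗ   = λ s (a , b) → K.refl , KZ.solve 3 (λ s a b → s KZ.:* a KZ.:- s KZ.:* b KZ.:= s KZ.:* (a KZ.:- b)) K.refl s a b
        }
      open PolynomialAction top K² isLinear
      open KZ
      Pair : Set
      Pair = Polynomial 2 × Polynomial 2
      τᵖ : Pair → Pair
      τᵖ (a , b) = b , a :- b
      infixr 6 _▹_
      _▹_ : Polynomial 2 × Pair → Pair → Pair
      (s , (a , b)) ▹ (c , d) = s :* a :+ c , s :* b :+ d
      monicᵖ killsᵖ : Pair → Pair
      monicᵖ v = (:- con (+ 1) , v) ▹ τᵖ ((con (+ 1) , v) ▹ τᵖ v)
      killsᵖ v = (:- con (+ 1) , v) ▹ τᵖ ((con (+ 1) , v) ▹ τᵖ ((con (+ 1) , v) ▹ τᵖ (con (+ 0) , con (+ 0))))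
      monic≈0₁ : ∀ a b → _
      monic≈0₁ = solve 2 (λ a b → proj₁ (monicᵖ (a , b)) := con (+ 0)) K.refl
      monic≈0₂ : ∀ a b → _
      monic≈0₂ = solve 2 (λ a b → proj₂ (monicᵖ (a , b)) := con (+ 0)) K.refl
      kills : ∀ v → LeftModule._≈ᴹ_ K² (act goldenPolynomial v) (K.0# , K.0#)
      kills (a , b) =
          solve 2 (λ a b → proj₁ (killsᵖ (a , b)) := con (+ 0)) K.refl a b
        , solve 2 (λ a b → proj₂ (killsᵖ (a , b)) := con (+ 0)) K.refl a b
      rootsIn : ContainsRoots top goldenPolynomial
      rootsIn L x root = eigenvalueIn x (trace²⁵⇒eigenvalue x (golden⇒trace x 5 (begin
        x * x + x
          ≈⟨ solve′ 1 (λ x → x :*′ x :+′ x :=′ ((:-′ con′ (+ 1)) :+′ x :*′ (con′ (+ 1) :+′ x :*′ (con′ (+ 1) :+′ x :*′ con′ (+ 0)))) :+′ con′ (+ 1)) refl x ⟩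
        (- 1# + x * (1# + x * (1# + x * 0#))) + 1#
          ≈⟨ +-congʳ (+-cong (sym (trans (ι-neg K.1#) (-‿cong ι-1))) (*-congˡ (+-cong (sym ι-1) (*-congˡ (+-congʳ (sym ι-1)))))) ⟩
        evaluate top′ ι′ goldenPolynomial x + 1#  ≈⟨ trans (+-congʳ root) (+-identityˡ 1#) ⟩
        1# ∎)))
        where open ExtensionRoots L renaming (solve to solve′; con to con′; _:*_ to _:*′_; _:+_ to _:+′_; _:=_ to _:=′_; :-_ to :-′_)

    quinticPolynomial : K.Carrier → List K.Carrier
    quinticPolynomial ψ = K.- ψ ∷ KZ.fromℤ (+ 5) ∷ K.0# ∷ KZ.fromℤ -[1+ 4 ] ∷ K.0# ∷ K.1# ∷ []

    -- A root x satisfies w₅ x = ψ, so it is the trace of a 25th root of unity and an eigenvalue;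
    -- again no extension of `K` has roots outside `K`.
    quinticRoot : ∀ {ψ} → ψ K.* ψ K.+ ψ K.≈ K.1# → ¬ (∀ μ → ¬ (evaluate top (λ a → a) (quinticPolynomial ψ) μ K.≈ K.0#))
    quinticRoot {ψ} ψ²+ψ≈1 noRoot = Root.noMonicAnnihilator
      (×-decidable K._≟_ (×-decidable K._≟_ (×-decidable K._≟_ (×-decidable K._≟_ K._≟_)))) (quinticPolynomial ψ) kills rootsIn noRoot
      (K.1# , K.0# , K.0# , K.0# , K.0#) (λ (1≈0 , _) → K.0≉1 (K.sym 1≈0))
      (K.- ψ ∷ KZ.fromℤ (+ 5) ∷ K.0# ∷ KZ.fromℤ -[1+ 4 ] ∷ K.0# ∷ [])
      ( solve 1 (λ ψ → proj₁ (monicᵖ ψ (con (+ 1) , con (+ 0) , con (+ 0) , con (+ 0) , con (+ 0))) := con (+ 0)) K.refl ψ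
      , solve 1 (λ ψ → proj₁ (proj₂ (monicᵖ ψ (con (+ 1) , con (+ 0) , con (+ 0) , con (+ 0) , con (+ 0)))) := con (+ 0)) K.refl ψ
      , solve 1 (λ ψ → proj₁ (proj₂ (proj₂ (monicᵖ ψ (con (+ 1) , con (+ 0) , con (+ 0) , con (+ 0) , con (+ 0))))) := con (+ 0)) K.refl ψ
      , solve 1 (λ ψ → proj₁ (proj₂ (proj₂ (proj₂ (monicᵖ ψ (con (+ 1) , con (+ 0) , con (+ 0) , con (+ 0) , con (+ 0)))))) := con (+ 0)) K.refl ψ
      , solve 1 (λ ψ → proj₂ (proj₂ (proj₂ (proj₂ (monicᵖ ψ (con (+ 1) , con (+ 0) , con (+ 0) , con (+ 0) , con (+ 0)))))) := con (+ 0)) K.refl ψ )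
      where
      open KZ
      five : K.Carrier
      five = fromℤ (+ 5)
      τ : LeftModule.Carrierᴹ K⁵ → LeftModule.Carrierᴹ K⁵
      τ (a , b , c , d , e) = ψ K.* e , a K.- five K.* e , b , c K.+ five K.* e , d
      isLinear : IsLinear top K⁵ τ
      isLinear = record
        { τ-cong = λ (a , b , c , d , e) → K.*-congˡ e , K.+-cong a (K.-‿cong (K.*-congˡ e)) , b , K.+-cong c (K.*-congˡ e) , d
        ; τ-+    = λ (a , b , c , d , e) (a′ , b′ , c′ , d′ , e′) →
            K.distribˡ ψ e e′
          , solve 4 (λ a e a′ e′ → (a :+ a′) :- con (+ 5) :* (e :+ e′) := (a :- con (+ 5) :* e) :+ (a′ :- con (+ 5) :* e′)) K.refl a e a′ e′
          , K.refl
          , solve 4 (λ a e a′ e′ → (a :+ a′) :+ con (+ 5) :* (e :+ e′) := (a :+ con (+ 5) :* e) :+ (a′ :+ con (+ 5) :* e′)) K.refl c e c′ e′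
          , K.refl
        ; τ-*ₗ   = λ s (a , b , c , d , e) →
            solve 3 (λ ψ s e → ψ :* (s :* e) := s :* (ψ :* e)) K.refl ψ s e
          , solve 3 (λ s a e → s :* a :- con (+ 5) :* (s :* e) := s :* (a :- con (+ 5) :* e)) K.refl s a e
          , K.refl
          , solve 3 (λ s a e → s :* a :+ con (+ 5) :* (s :* e) := s :* (a :+ con (+ 5) :* e)) K.refl s c e
          , K.refl
        }
      open PolynomialAction top K⁵ isLinear
      module _ {n} (ψ : Polynomial n) where
        Tuple : Set
        Tuple = Polynomial n × Polynomial n × Polynomial n × Polynomial n × Polynomial n
        τᵖ : Tuple → Tuple
        τᵖ (a , b , c , d , e) = ψ :* e , a :- con (+ 5) :* e , b , c :+ con (+ 5) :* e , d
        infixr 6 _▹_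
        _▹_ : Polynomial n × Tuple → Tuple → Tuple
        (s , (a , b , c , d , e)) ▹ (a′ , b′ , c′ , d′ , e′) = s :* a :+ a′ , s :* b :+ b′ , s :* c :+ c′ , s :* d :+ d′ , s :* e :+ e′
        horner : Tuple → Tuple → Tuple
        horner v t = (:- ψ , v) ▹ τᵖ ((con (+ 5) , v) ▹ τᵖ ((con (+ 0) , v) ▹ τᵖ ((con -[1+ 4 ] , v) ▹ τᵖ ((con (+ 0) , v) ▹ τᵖ t))))
        monicᵖ killsᵖ : Tuple → Tuple
        monicᵖ v = horner v v
        killsᵖ v = horner v ((con (+ 1) , v) ▹ τᵖ (con (+ 0) , con (+ 0) , con (+ 0) , con (+ 0) , con (+ 0)))
      kills : ∀ v → LeftModule._≈ᴹ_ K⁵ (act (quinticPolynomial ψ) v) (LeftModule.0ᴹ K⁵)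
      kills (a , b , c , d , e) =
          solve 6 (λ ψ a b c d e → proj₁ (killsᵖ ψ (a , b , c , d , e)) := con (+ 0)) K.refl ψ a b c d e
        , solve 6 (λ ψ a b c d e → proj₁ (proj₂ (killsᵖ ψ (a , b , c , d , e))) := con (+ 0)) K.refl ψ a b c d e
        , solve 6 (λ ψ a b c d e → proj₁ (proj₂ (proj₂ (killsᵖ ψ (a , b , c , d , e)))) := con (+ 0)) K.refl ψ a b c d e
        , solve 6 (λ ψ a b c d e → proj₁ (proj₂ (proj₂ (proj₂ (killsᵖ ψ (a , b , c , d , e))))) := con (+ 0)) K.refl ψ a b c d e
        , solve 6 (λ ψ a b c d e → proj₂ (proj₂ (proj₂ (proj₂ (killsᵖ ψ (a , b , c , d , e))))) := con (+ 0)) K.refl ψ a b c d e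
      rootsIn : ContainsRoots top (quinticPolynomial ψ)
      rootsIn L x root = eigenvalueIn x (trace²⁵⇒eigenvalue x (w₅≈golden⇒trace²⁵ x {ι′ ψ}
        (trans (+-congʳ (sym (ι-* ψ ψ))) (trans (sym (ι-+ _ _)) (trans (ι-cong ψ²+ψ≈1) ι-1)))
        (begin
          w₅ x
            ≈⟨ solve′ 2 (λ x ψ → x :*′ (x :*′ (x :*′ (x :*′ x))) :-′ con′ (+ 5) :*′ (x :*′ (x :*′ x)) :+′ con′ (+ 5) :*′ x :=′
                 (neg′ ψ :+′ x :*′ (con′ (+ 5) :+′ x :*′ (con′ (+ 0) :+′ x :*′ (con′ -[1+ 4 ] :+′ x :*′ (con′ (+ 0) :+′ x :*′ (con′ (+ 1) :+′ x :*′ con′ (+ 0))))))) :+′ ψ) refl x (ι′ ψ) ⟩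
          (- ι′ ψ + x * (fromℤ′ (+ 5) + x * (0# + x * (fromℤ′ -[1+ 4 ] + x * (0# + x * (1# + x * 0#)))))) + ι′ ψ
            ≈⟨ +-congʳ (+-cong (sym (ι-neg ψ)) (*-congˡ (+-cong (sym (ι-fromℤ L (+ 5))) (*-congˡ (+-cong (sym ι-0)
                 (*-congˡ (+-cong (sym (ι-fromℤ L -[1+ 4 ])) (*-congˡ (+-cong (sym ι-0) (*-congˡ (+-congʳ (sym ι-1)))))))))))) ⟩
          evaluate top′ ι′ (quinticPolynomial ψ) x + ι′ ψ  ≈⟨ trans (+-congʳ root) (+-identityˡ _) ⟩
          ι′ ψ ∎)))
        where open ExtensionRoots L renaming (solve to solve′; con to con′; _:*_ to _:*′_; _:+_ to _:+′_; _:=_ to _:=′_; _:-_ to _:-′_; :-_ to neg′; fromℤ to fromℤ′)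

    -- As the goal is ⊥, the doubly negated roots may be used as if given. The second one is an
    -- eigenvalue in `K` itself, as the norm argument requires.
    contradiction : ⊥
    contradiction = goldenRoot λ ψ ψ-root →
      let ψ²+ψ≈1 = golden ψ ψ-root in
      quinticRoot ψ²+ψ≈1 λ μ μ-root →
        let w₅≈ψ = quintic ψ μ μ-root in
        GoldenRamification.w₅≉golden isBasis Γ
          (WalkProperties.rootOfUnity⇒eigenvalue Γ top μ {25} walk ℕ.z<s (periodic 0) (periodic 1) injective₀
            (RootsOfUnity.w₅≈golden⇒trace²⁵ K.commutativeRing μ ψ²+ψ≈1 w₅≈ψ))
          ψ²+ψ≈1 w₅≈ψ
      where
      open KZ
      golden : ∀ ψ → evaluate top (λ a → a) goldenPolynomial ψ K.≈ K.0# → ψ K.* ψ K.+ ψ K.≈ K.1#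
      golden ψ root = FieldProperties.x-y≈0⇒x≈y top (K.trans
        (solve 1 (λ x → x :* x :+ x :- con (+ 1) := (:- con (+ 1)) :+ x :* (con (+ 1) :+ x :* (con (+ 1) :+ x :* con (+ 0)))) K.refl ψ) root)
      quintic : ∀ ψ μ → evaluate top (λ a → a) (quinticPolynomial ψ) μ K.≈ K.0# → RootsOfUnity.w₅ K.commutativeRing μ K.≈ ψ
      quintic ψ μ root = FieldProperties.x-y≈0⇒x≈y top (K.trans
        (solve 2 (λ x ψ → x :* (x :* (x :* (x :* x))) :- con (+ 5) :* (x :* (x :* x)) :+ con (+ 5) :* x :- ψ :=
           :- ψ :+ x :* (con (+ 5) :+ x :* (con (+ 0) :+ x :* (con -[1+ 4 ] :+ x :* (con (+ 0) :+ x :* (con (+ 1) :+ x :* con (+ 0))))))) K.refl μ ψ) root)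

  period25⇒¬2Integral : ∀ {x} → IsWalk Γ x → (∀ k → x (25 ℕ.+ k) ≡ x k) →
    (∀ k → suc k ℕ.< 25 → x (suc k) ≢ x 0) → ¬ Is2Integral Γ
  period25⇒¬2Integral walk periodic injective₀ (K , split , (b , isBasis)) =
    Period25.contradiction walk periodic injective₀ K split isBasis

-- Element orders in groups of class 𝓑₂

∣⁅i⁆∪⁅j⁆∣≡2 : ∀ {n} {i j : Fin n} → i ≢ j → Subset.∣ ⁅ i ⁆ ∪ ⁅ j ⁆ ∣ ≡ 2
∣⁅i⁆∪⁅j⁆∣≡2 {i = zero}  {zero}  i≢j = ⊥-elim (i≢j ≡.refl)
∣⁅i⁆∪⁅j⁆∣≡2 {i = zero}  {suc j} i≢j = ≡.cong suc (≡.trans (≡.cong Subset.∣_∣ (Subsetₚ.∪-identityˡ ⁅ j ⁆)) (Subsetₚ.∣⁅x⁆∣≡1 j))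
∣⁅i⁆∪⁅j⁆∣≡2 {i = suc i} {zero}  i≢j = ≡.cong suc (≡.trans (≡.cong Subset.∣_∣ (Subsetₚ.∪-identityʳ ⁅ i ⁆)) (Subsetₚ.∣⁅x⁆∣≡1 i))
∣⁅i⁆∪⁅j⁆∣≡2 {i = suc i} {suc j} i≢j = ∣⁅i⁆∪⁅j⁆∣≡2 (i≢j ∘ ≡.cong suc)

double : ∀ n → ∃[ k ] (n ≡ k ℕ.+ k ⊎ n ≡ suc (k ℕ.+ k))
double zero = 0 , inj₁ ≡.refl
double (suc n) with double n
... | k , inj₁ n≡k+k   = k , inj₂ (≡.cong suc n≡k+k)
... | k , inj₂ n≡1+k+k = suc k , inj₁ (≡.cong suc (≡.trans n≡1+k+k (≡.sym (ℕₚ.+-suc k k))))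

module GroupTheory {c ℓ : Level} (G : FiniteGroup c ℓ) where
  open FiniteGroup G public hiding (enumeration; inverse) renaming (_∙_ to infixl 7 _∙_)
  open GroupProperties group public
  open SetoidReasoning setoid
  open MonoidMultiples monoid using () renaming (×-homo-+ to power-+; ×-congʳ to power-cong; ×-assocˡ to power-*) public
  open FiniteGroup G using (enumeration)

  index-injective : ∀ {x y} → index x ≡ index y → x ≈ y
  index-injective {x} {y} eq = begin
    x                   ≈⟨ Inverse.strictlyInverseʳ enumeration x ⟨
    element (index x)   ≡⟨ ≡.cong element eq ⟩
    element (index y)   ≈⟨ Inverse.strictlyInverseʳ enumeration y ⟩
    y                   ∎

  index-element : ∀ i → index (element i) ≡ i
  index-element = Inverse.strictlyInverseˡ enumeration

  element-index : ∀ x → element (index x) ≈ x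
  element-index = Inverse.strictlyInverseʳ enumeration

  infix 4 _≈?_
  _≈?_ : Decidable _≈_
  x ≈? y = map′ index-injective index-cong (index x Finₚ.≟ index y)

  power-ε : ∀ n → power n ε ≈ ε
  power-ε zero    = refl
  power-ε (suc n) = trans (identityˡ _) (power-ε n)

  power-1+ : ∀ n x → power n x ∙ x ≈ x ∙ power n x
  power-1+ zero    x = trans (identityˡ x) (sym (identityʳ x))
  power-1+ (suc n) x = trans (assoc x _ x) (∙-congˡ (power-1+ n x))

  power-comm : ∀ m n x → power m (power n x) ≈ power n (power m x)
  power-comm m n x = begin
    power m (power n x)    ≈⟨ power-* x m n ⟩
    power (m ℕ.* n) x      ≡⟨ ≡.cong (λ k → power k x) (ℕₚ.*-comm m n) ⟩
    power (n ℕ.* m) x      ≈⟨ power-* x n m ⟨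
    power n (power m x)    ∎

  power-∣ : ∀ {m n x} → power m x ≈ ε → m ∣ n → power n x ≈ ε
  power-∣ {m} {n} {x} xᵐ≈ε (divides k ≡.refl) = begin
    power (k ℕ.* m) x      ≈⟨ power-* x k m ⟨
    power k (power m x)    ≈⟨ power-cong k xᵐ≈ε ⟩
    power k ε              ≈⟨ power-ε k ⟩
    ε                      ∎

  power-gcd : ∀ {m n x} → power m x ≈ ε → power n x ≈ ε → power (gcd m n) x ≈ ε
  power-gcd {m} {n} {x} xᵐ≈ε xⁿ≈ε with GCD.Bézout.identity (gcd-GCD m n)
  ... | GCD.Bézout.+- k l eq = begin
    power (gcd m n) x                            ≈⟨ identityʳ _ ⟨
    power (gcd m n) x ∙ ε                        ≈⟨ ∙-congˡ (power-∣ {x = x} xⁿ≈ε (divides l ≡.refl)) ⟨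
    power (gcd m n) x ∙ power (l ℕ.* n) x        ≈⟨ power-+ x (gcd m n) (l ℕ.* n) ⟨
    power (gcd m n ℕ.+ l ℕ.* n) x                ≡⟨ ≡.cong (λ k → power k x) eq ⟩
    power (k ℕ.* m) x                            ≈⟨ power-∣ {x = x} xᵐ≈ε (divides k ≡.refl) ⟩
    ε                                            ∎
  ... | GCD.Bézout.-+ k l eq = begin
    power (gcd m n) x                            ≈⟨ identityʳ _ ⟨
    power (gcd m n) x ∙ ε                        ≈⟨ ∙-congˡ (power-∣ {x = x} xᵐ≈ε (divides k ≡.refl)) ⟨
    power (gcd m n) x ∙ power (k ℕ.* m) x        ≈⟨ power-+ x (gcd m n) (k ℕ.* m) ⟨
    power (gcd m n ℕ.+ k ℕ.* m) x                ≡⟨ ≡.cong (λ k → power k x) eq ⟩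
    power (l ℕ.* n) x                            ≈⟨ power-∣ {x = x} xⁿ≈ε (divides l ≡.refl) ⟩
    ε                                            ∎

  power-5∧2 : ∀ {x} → power 5 x ≈ ε → x ∙ x ≈ ε → x ≈ ε
  power-5∧2 {x} x⁵≈ε x²≈ε = trans (sym (identityʳ x)) (power-gcd {5} {2} x⁵≈ε (trans (∙-congˡ (identityʳ x)) x²≈ε))

  torsion : ∀ x → ∃[ n ] n ≢ 0 × power n x ≈ ε
  torsion x with Finₚ.pigeonhole (ℕₚ.n<1+n order) (λ k → index (power (Fin.toℕ k) x))
  ... | i , j , i<j , eq = Fin.toℕ j ℕ.∸ Fin.toℕ i , ℕₚ.m>n⇒m∸n≢0 i<j , identityʳ-unique (power (Fin.toℕ i) x) _ (begin
    power (Fin.toℕ i) x ∙ power (Fin.toℕ j ℕ.∸ Fin.toℕ i) x   ≈⟨ power-+ x (Fin.toℕ i) _ ⟨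
    power (Fin.toℕ i ℕ.+ (Fin.toℕ j ℕ.∸ Fin.toℕ i)) x         ≡⟨ ≡.cong (λ k → power k x) (ℕₚ.m+[n∸m]≡n (ℕₚ.<⇒≤ i<j)) ⟩
    power (Fin.toℕ j) x                                       ≈⟨ index-injective eq ⟨
    power (Fin.toℕ i) x                                       ∎)

  record IsPair (S : Subset order) (s t : Carrier) : Set (c Level.⊔ ℓ) where
    field
      s≉t     : ¬ (s ≈ t)
      members : ∀ g → (_∈_ G g S) ⇔ (g ≈ s ⊎ g ≈ t)

  pair : Carrier → Carrier → Subset order
  pair s t = ⁅ index s ⁆ ∪ ⁅ index t ⁆

  pair-isPair : ∀ {s t} → ¬ (s ≈ t) → IsPair (pair s t) s t
  pair-isPair {s} {t} s≉t = record
    { s≉t = s≉t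
    ; members = λ g → mk⇔
        (λ g∈ → [ (λ g∈s → inj₁ (index-injective (Subsetₚ.x∈⁅y⁆⇒x≡y (index s) g∈s)))
                , (λ g∈t → inj₂ (index-injective (Subsetₚ.x∈⁅y⁆⇒x≡y (index t) g∈t))) ]′
                (Subsetₚ.x∈p∪q⁻ ⁅ index s ⁆ ⁅ index t ⁆ g∈))
        [ (λ g≈s → Subsetₚ.x∈p∪q⁺ (inj₁ (Equivalence.from Subsetₚ.x∈⁅y⁆⇔x≡y (index-cong g≈s))))
        , (λ g≈t → Subsetₚ.x∈p∪q⁺ (inj₂ (Equivalence.from Subsetₚ.x∈⁅y⁆⇔x≡y (index-cong g≈t)))) ]′
    }

  -- The two shapes of an inverse-closed set of two elements. The first leads to walks along the
  -- powers of `s`, the second to walks multiplying by `s` and `t` in turn.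
  InverseClosed : Carrier → Carrier → Set ℓ
  InverseClosed s t = (t ≈ s ⁻¹) ⊎ (s ∙ s ≈ ε × t ∙ t ≈ ε)

  inverses : ∀ {s t} → InverseClosed s t → ∀ {g} → g ≈ s ⊎ g ≈ t → g ⁻¹ ≈ s ⊎ g ⁻¹ ≈ t
  inverses (inj₁ t≈s⁻¹) (inj₁ g≈s) = inj₂ (trans (⁻¹-cong g≈s) (sym t≈s⁻¹))
  inverses (inj₁ t≈s⁻¹) (inj₂ g≈t) = inj₁ (trans (⁻¹-cong (trans g≈t t≈s⁻¹)) (⁻¹-involutive _))
  inverses (inj₂ (s² , t²)) (inj₁ g≈s) = inj₁ (trans (⁻¹-cong g≈s) (sym (inverseˡ-unique _ _ s²)))
  inverses (inj₂ (s² , t²)) (inj₂ g≈t) = inj₂ (trans (⁻¹-cong g≈t) (sym (inverseˡ-unique _ _ t²)))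

  pair-isConnectionSet : ∀ {s t} → ¬ (s ≈ t) → ¬ (s ≈ ε) → ¬ (t ≈ ε) → InverseClosed s t → IsConnectionSet G (pair s t)
  pair-isConnectionSet {s} {t} s≉t s≉ε t≉ε closed = record
    { 1∉S = λ 1∈S → [ s≉ε ∘ sym , t≉ε ∘ sym ]′ (Equivalence.to (members ε) 1∈S)
    ; S≡S⁻¹ = λ g → mk⇔
        (λ g∈ → Equivalence.from (members (g ⁻¹)) (inverses closed (Equivalence.to (members g) g∈)))
        (λ g⁻¹∈ → Equivalence.from (members g) (back (inverses closed (Equivalence.to (members (g ⁻¹)) g⁻¹∈))))
    }
    where
    open IsPair (pair-isPair s≉t)
    back : ∀ {g} → g ⁻¹ ⁻¹ ≈ s ⊎ g ⁻¹ ⁻¹ ≈ t → g ≈ s ⊎ g ≈ t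
    back = [ (λ eq → inj₁ (trans (sym (⁻¹-involutive _)) eq)) , (λ eq → inj₂ (trans (sym (⁻¹-involutive _)) eq)) ]′

  module _ {S : Subset order} {s t : Carrier} (isPair : IsPair S s t) (conn : IsConnectionSet G S) where
    open IsPair isPair
    private Γ = Cay G S conn

    hasNeighbours : ∀ {x y z} → y ≈ s ∙ x → z ≈ t ∙ x → HasNeighbours Γ (index x) (index y) (index z)
    hasNeighbours {x} {y} {z} y≈sx z≈tx = record
      { a≢b = λ eq → s≉t (∙-cancelʳ x s t (trans (sym y≈sx) (trans (index-injective eq) z≈tx)))
      ; neighbours = λ j → mk⇔
          (λ j∼ → [ (λ eq → inj₁ (to eq y≈sx)) , (λ eq → inj₂ (to eq z≈tx)) ]′ (Equivalence.to (members _) j∼))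
          [ (λ eq → Equivalence.from (members _) (inj₁ (from eq y≈sx)))
          , (λ eq → Equivalence.from (members _) (inj₂ (from eq z≈tx))) ]′
      }
      where
      to : ∀ {j y g} → element j ∙ element (index x) ⁻¹ ≈ g → y ≈ g ∙ x → j ≡ index y
      to {j} {y} {g} eq y≈gx = ≡.trans (≡.sym (index-element j)) (index-cong (begin
        element j                                             ≈⟨ //-rightDividesˡ (element (index x)) (element j) ⟨
        element j ∙ element (index x) ⁻¹ ∙ element (index x)  ≈⟨ ∙-cong eq (element-index x) ⟩
        g ∙ x                                                 ≈⟨ y≈gx ⟨
        y                                                     ∎))
      from : ∀ {j y g} → j ≡ index y → y ≈ g ∙ x → element j ∙ element (index x) ⁻¹ ≈ g
      from {y = y} {g} ≡.refl y≈gx = begin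
        element (index y) ∙ element (index x) ⁻¹    ≈⟨ ∙-cong (trans (element-index y) y≈gx) (⁻¹-cong (element-index x)) ⟩
        g ∙ x ∙ x ⁻¹                                ≈⟨ //-rightDividesʳ x g ⟩
        g                                           ∎

  swap-neighbours : ∀ {n} {Γ : Graph n} {i a b} → HasNeighbours Γ i a b → HasNeighbours Γ i b a
  swap-neighbours nbrs = record
    { a≢b = λ b≡a → a≢b (≡.sym b≡a)
    ; neighbours = λ j → mk⇔ (swap ∘ Equivalence.to (neighbours j)) (Equivalence.from (neighbours j) ∘ swap) }
    where open HasNeighbours nbrs

  swap-isPair : ∀ {S s t} → IsPair S s t → IsPair S t s
  swap-isPair isPair = record
    { s≉t = λ t≈s → s≉t (sym t≈s)
    ; members = λ g → mk⇔ (swap ∘ Equivalence.to (members g)) (Equivalence.from (members g) ∘ swap) }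
    where open IsPair isPair

  -- Multiplication is on the left because adjacency of g and h means h g⁻¹ ∈ S.
  cyclicWalk : Carrier → Carrier → ℕ → Fin order
  cyclicWalk s h k = index (power k s ∙ h)

  cyclicWalk-isWalk : ∀ {S s t} → IsPair S s t → t ≈ s ⁻¹ → (conn : IsConnectionSet G S) → ∀ h → IsWalk (Cay G S conn) (cyclicWalk s h)
  cyclicWalk-isWalk {s = s} {t} isPair t≈s⁻¹ conn h k = swap-neighbours (hasNeighbours isPair conn
    (assoc s _ h)
    (begin
      power k s ∙ h                          ≈⟨ \\-leftDividesʳ s (power k s ∙ h) ⟨
      s ⁻¹ ∙ (s ∙ (power k s ∙ h))           ≈⟨ ∙-cong t≈s⁻¹ (assoc s _ h) ⟨
      t ∙ (power (suc k) s ∙ h)              ∎))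

  cyclicWalk-periodic : ∀ {N s} → power N s ≈ ε → ∀ h k → cyclicWalk s h (N ℕ.+ k) ≡ cyclicWalk s h k
  cyclicWalk-periodic {N} {s} sᴺ≈ε h k = index-cong (∙-congʳ (begin
    power (N ℕ.+ k) s            ≈⟨ power-+ s N k ⟩
    power N s ∙ power k s        ≈⟨ ∙-congʳ sᴺ≈ε ⟩
    ε ∙ power k s                ≈⟨ identityˡ _ ⟩
    power k s                    ∎))

  -- The two factors exchange roles at each step, so two steps multiply by `t ∙ s` and the walk
  -- closes after twice an exponent of `t ∙ s`.
  alternating : Carrier → Carrier → Carrier → ℕ → Carrier
  alternating s t h zero    = h
  alternating s t h (suc k) = alternating t s (s ∙ h) k

  alternating-cong : ∀ s t {h h′} k → h ≈ h′ → alternating s t h k ≈ alternating s t h′ k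
  alternating-cong s t zero    h≈h′ = h≈h′
  alternating-cong s t (suc k) h≈h′ = alternating-cong t s k (∙-congˡ h≈h′)

  alternatingWalk-isWalk : ∀ {S s t} → IsPair S s t → s ∙ s ≈ ε → t ∙ t ≈ ε → (conn : IsConnectionSet G S) →
    ∀ h → IsWalk (Cay G S conn) (λ k → index (alternating s t h k))
  alternatingWalk-isWalk {s = s} {t} isPair s² t² conn h zero = hasNeighbours isPair conn
    (begin
      h               ≈⟨ identityˡ h ⟨
      ε ∙ h           ≈⟨ ∙-congʳ s² ⟨
      s ∙ s ∙ h       ≈⟨ assoc s s h ⟩
      s ∙ (s ∙ h)     ∎)
    refl
  alternatingWalk-isWalk isPair s² t² conn h (suc k) = alternatingWalk-isWalk (swap-isPair isPair) t² s² conn _ k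

  alternating-+ : ∀ s t h m k → alternating s t h (m ℕ.* 2 ℕ.+ k) ≈ alternating s t (power m (t ∙ s) ∙ h) k
  alternating-+ s t h zero    k = alternating-cong s t k (sym (identityˡ h))
  alternating-+ s t h (suc m) k = trans (alternating-+ s t (t ∙ (s ∙ h)) m k) (alternating-cong s t k (begin
    power m (t ∙ s) ∙ (t ∙ (s ∙ h))    ≈⟨ ∙-congˡ (assoc t s h) ⟨
    power m (t ∙ s) ∙ (t ∙ s ∙ h)      ≈⟨ assoc _ _ h ⟨
    power m (t ∙ s) ∙ (t ∙ s) ∙ h      ≈⟨ ∙-congʳ (power-1+ m (t ∙ s)) ⟩
    power (suc m) (t ∙ s) ∙ h          ∎))

  alternating-periodic : ∀ {s t} m → power m (t ∙ s) ≈ ε → ∀ h k → index (alternating s t h (m ℕ.* 2 ℕ.+ k)) ≡ index (alternating s t h k)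
  alternating-periodic {s} {t} m tsᵐ≈ε h k = index-cong (trans (alternating-+ s t h m k)
    (alternating-cong s t k (trans (∙-congʳ tsᵐ≈ε) (identityˡ h))))

  module _ (G∈𝓑₂ : 𝓑 G 2) where

    private
      pairGraph : ∀ {s t} (s≉t : ¬ (s ≈ t)) (s≉ε : ¬ (s ≈ ε)) (t≉ε : ¬ (t ≈ ε)) (closed : InverseClosed s t) →
        Is2Integral (Cay G (pair s t) (pair-isConnectionSet s≉t s≉ε t≉ε closed))
      pairGraph {s} {t} s≉t s≉ε t≉ε closed = G∈𝓑₂ (pair s t) (pair-isConnectionSet s≉t s≉ε t≉ε closed) (ℕₚ.≤-reflexive (≡.sym size)) (ℕₚ.≤-reflexive size)
        where
        size : Subset.∣ pair s t ∣ ≡ 2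
        size = ∣⁅i⁆∪⁅j⁆∣≡2 (λ eq → s≉t (index-injective eq))

      module Cyclic (s : Carrier) (s²≉ε : ¬ (s ∙ s ≈ ε)) where
        s≉ε : ¬ (s ≈ ε)
        s≉ε s≈ε = s²≉ε (trans (∙-cong s≈ε s≈ε) (identityˡ ε))
        s⁻¹≉ε : ¬ (s ⁻¹ ≈ ε)
        s⁻¹≉ε s⁻¹≈ε = s≉ε (⁻¹-injective (trans s⁻¹≈ε (sym ε⁻¹≈ε)))
        s≉s⁻¹ : ¬ (s ≈ s ⁻¹)
        s≉s⁻¹ s≈s⁻¹ = s²≉ε (trans (∙-congˡ s≈s⁻¹) (inverseʳ s))
        conn = pair-isConnectionSet s≉s⁻¹ s≉ε s⁻¹≉ε (inj₁ refl)
        Γ : Graph order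
        Γ = Cay G (pair s (s ⁻¹)) conn
        2Integral : Is2Integral Γ
        2Integral = pairGraph s≉s⁻¹ s≉ε s⁻¹≉ε (inj₁ refl)
        walk : ∀ h → IsWalk Γ (cyclicWalk s h)
        walk = cyclicWalk-isWalk (pair-isPair s≉s⁻¹) refl conn
        walks : ∀ {N} → power N s ≈ ε → WalksOfPeriod Γ N
        walks {N} sᴺ≈ε i = cyclicWalk s (element i) , walk (element i) ,
          ≡.trans (index-cong (identityˡ _)) (index-element i) , cyclicWalk-periodic {N} sᴺ≈ε (element i)

    -- Otherwise {s, s⁻¹} is a connection set of size 2 whose walks have period 4.
    power4 : ∀ s → power 4 s ≈ ε → s ∙ s ≈ ε
    power4 s s⁴≈ε with s ∙ s ≈? ε
    ... | yes s²≈ε = s²≈ε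
    ... | no  s²≉ε = ⊥-elim (period4⇒¬2Integral Γ (walks {4} s⁴≈ε) 2Integral)
      where open Cyclic s s²≉ε

    -- If s⁵ ≠ 1, the order is exactly 25, since every positive exponent below 25 has a gcd with 25
    -- that divides 5. The powers of `s` then form a simple cycle.
    power25 : ∀ s → power 25 s ≈ ε → power 5 s ≈ ε
    power25 s s²⁵≈ε with power 5 s ≈? ε
    ... | yes s⁵≈ε = s⁵≈ε
    ... | no  s⁵≉ε = ⊥-elim (period25⇒¬2Integral Γ (walk ε) (cyclicWalk-periodic {25} s²⁵≈ε ε) injective₀ 2Integral)
      where
      divisors : ∀ (k : Fin 24) → gcd (suc (Fin.toℕ k)) 25 ∣ 5
      divisors = from-yes (Finₚ.all? {n = 24} (λ k → gcd (suc (Fin.toℕ k)) 25 Div.∣? 5))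
      sᵏ≉ε : ∀ k → suc k ℕ.< 25 → ¬ (power (suc k) s ≈ ε)
      sᵏ≉ε k (ℕ.s≤s k<24) sᵏ≈ε = s⁵≉ε (power-∣ (power-gcd {suc k} {25} sᵏ≈ε s²⁵≈ε)
        (≡.subst (λ k → gcd (suc k) 25 ∣ 5) (Finₚ.toℕ-fromℕ< k<24) (divisors (Fin.fromℕ< k<24))))
      s²≉ε : ¬ (s ∙ s ≈ ε)
      s²≉ε s²≈ε = sᵏ≉ε 1 (ℕ.s≤s (ℕ.s≤s (ℕ.s≤s ℕ.z≤n))) (trans (∙-congˡ (identityʳ s)) s²≈ε)
      open Cyclic s s²≉ε
      injective₀ : ∀ k → suc k ℕ.< 25 → cyclicWalk s ε (suc k) ≢ cyclicWalk s ε 0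
      injective₀ k k<24 eq = sᵏ≉ε k k<24 (∙-cancelʳ ε _ _ (index-injective eq))

    -- The set {s, s⁻¹} has two elements only for s² ≠ 1; when s² = 1, the odd exponent itself gives
    -- s = 1.
    powerOdd : ∀ k s → k ≢ 2 → Prime (suc (k ℕ.+ k)) → power (suc (k ℕ.+ k)) s ≈ ε → s ≈ ε
    powerOdd zero    s k≢2 p-prime sᵖ≈ε = trans (sym (identityʳ s)) sᵖ≈ε
    powerOdd k@(suc _) s k≢2 p-prime sᵖ≈ε with s ∙ s ≈? ε
    ... | no  s²≉ε = ⊥-elim (oddPrimePeriod⇒¬2Integral Γ k ℕ.z<s k≢2 p-prime (walks {suc (k ℕ.+ k)} sᵖ≈ε) 2Integral)
      where open Cyclic s s²≉ε
    ... | yes s²≈ε = begin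
      s                          ≈⟨ identityʳ s ⟨
      s ∙ ε                      ≈⟨ ∙-congˡ (power-∣ {2} {k ℕ.+ k} (trans (∙-congˡ (identityʳ s)) s²≈ε) (divides k (≡.trans (≡.cong (k ℕ.+_) (≡.sym (ℕₚ.+-identityʳ k))) (ℕₚ.*-comm 2 k)))) ⟨
      power (suc (k ℕ.+ k)) s    ≈⟨ sᵖ≈ε ⟩
      ε                          ∎

    power10-prime : ∀ {p} → Prime p → ∀ s → power 10 (power p s) ≈ ε → power 10 s ≈ ε
    power10-prime {p} p-prime s sᵖ≈ε with p ℕₚ.≟ 2 | p ℕₚ.≟ 5 | double p
    ... | yes ≡.refl | _ | _ = trans (sym (power-* s 2 5)) (trans (∙-congˡ (identityʳ _)) (power4 (power 5 s) (begin
      power 4 (power 5 s)       ≈⟨ power-* s 4 5 ⟩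
      power 20 s                ≈⟨ power-* s 10 2 ⟨
      power 10 (power 2 s)      ≈⟨ sᵖ≈ε ⟩
      ε                         ∎)))
    ... | no _ | yes ≡.refl | _ = trans (sym (power-* s 5 2)) (power25 (power 2 s) (begin
      power 25 (power 2 s)      ≈⟨ power-* s 25 2 ⟩
      power 50 s                ≈⟨ power-* s 10 5 ⟨
      power 10 (power 5 s)      ≈⟨ sᵖ≈ε ⟩
      ε                         ∎))
    ... | no p≢2 | no p≢5 | k , inj₁ p≡k+k = ⊥-elim (p≢2 (≡.sym
      ([ (λ ()) , (λ 2≡p → 2≡p) ]′ (prime⇒irreducible p-prime (divides k (≡.trans p≡k+k (≡.trans (≡.cong (k ℕ.+_) (≡.sym (ℕₚ.+-identityʳ k))) (ℕₚ.*-comm 2 k))))))))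
    ... | no p≢2 | no p≢5 | k , inj₂ ≡.refl =
      powerOdd k (power 10 s) (λ k≡2 → p≢5 (≡.cong (λ k → suc (k ℕ.+ k)) k≡2)) p-prime
        (trans (power-comm (suc (k ℕ.+ k)) 10 s) sᵖ≈ε)

    exponent10 : ∀ s → power 10 s ≈ ε
    exponent10 s with torsion s
    ... | n , n≢0 , sⁿ≈ε = byFactors (factors) factorsPrime s (trans (reflexive (≡.cong (λ k → power k s) (≡.sym isFactorisation))) sⁿ≈ε)
      where
      open PrimeFactorisation (factorise n {{ℕ.≢-nonZero n≢0}})
      byFactors : ∀ ps → All Prime ps → ∀ s → power (product ps) s ≈ ε → power 10 s ≈ ε
      byFactors []       []               s s¹≈ε = power-∣ {1} {10} s¹≈ε (divides 10 ≡.refl)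
      byFactors (p ∷ ps) (p-prime ∷ primes) s eq = power10-prime p-prime s (byFactors ps primes (power p s) (begin
        power (product ps) (power p s)    ≈⟨ power-comm (product ps) p s ⟩
        power p (power (product ps) s)    ≈⟨ power-* s p (product ps) ⟩
        power (p ℕ.* product ps) s        ≈⟨ eq ⟩
        ε                                 ∎))

    -- For distinct commuting involutions t s has square 1, so the alternating walks close after
    -- four steps.
    involutions-commute⇒≈ : ∀ {s t} → s ∙ s ≈ ε → t ∙ t ≈ ε → ¬ (s ≈ ε) → ¬ (t ≈ ε) → t ∙ s ≈ s ∙ t → s ≈ t
    involutions-commute⇒≈ {s} {t} s² t² s≉ε t≉ε ts≈st with s ≈? t
    ... | yes s≈t = s≈t
    ... | no  s≉t = ⊥-elim (period4⇒¬2Integral (Cay G (pair s t) conn) walks (pairGraph s≉t s≉ε t≉ε (inj₂ (s² , t²))))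
      where
      conn = pair-isConnectionSet s≉t s≉ε t≉ε (inj₂ (s² , t²))
      ts²≈ε : power 2 (t ∙ s) ≈ ε
      ts²≈ε = begin
        t ∙ s ∙ (t ∙ s ∙ ε)      ≈⟨ ∙-cong ts≈st (identityʳ _) ⟩
        s ∙ t ∙ (t ∙ s)          ≈⟨ assoc s t _ ⟩
        s ∙ (t ∙ (t ∙ s))        ≈⟨ ∙-congˡ (assoc t t s) ⟨
        s ∙ (t ∙ t ∙ s)          ≈⟨ ∙-congˡ (trans (∙-congʳ t²) (identityˡ s)) ⟩
        s ∙ s                    ≈⟨ s² ⟩
        ε                        ∎
      walks : WalksOfPeriod (Cay G (pair s t) conn) 4
      walks i = (λ k → index (alternating s t (element i) k)) ,
        alternatingWalk-isWalk (pair-isPair s≉t) s² t² conn (element i) , index-element i , alternating-periodic 2 ts²≈ε (element i)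

-- The transfer

module BoolSum where
  open SemiringSum (CommutativeRing.semiring Boolₚ.xor-∧-commutativeRing) public
    using (sum; sum-cong-≗; sum-permute; sum-replicate-zero) renaming (∑-distrib-+ to sum-xor)

  sum-indicator : ∀ {n} (j : Fin n) → sum (λ i → does (i Finₚ.≟ j)) ≡ true
  sum-indicator {suc n} zero    = ≡.cong (true xor_) (sum-replicate-zero n)
  sum-indicator {suc n} (suc j) = sum-indicator j

module Transfer {c ℓ : Level} (G : FiniteGroup c ℓ) where
  open GroupTheory G
  open BoolSum

  Respects : (Carrier → Bool) → Set _
  Respects f = ∀ {x y} → x ≈ y → f x ≡ f y

  -- The parity of the number of elements satisfying `f`, as a sum in the field of two elements.
  ∑ : (Carrier → Bool) → Bool
  ∑ f = sum (λ i → f (element i))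

  ∑-cong : ∀ {f g} → (∀ x → f x ≡ g x) → ∑ f ≡ ∑ g
  ∑-cong f≡g = sum-cong-≗ (λ i → f≡g (element i))

  ∑-xor : ∀ f g → ∑ (λ x → f x xor g x) ≡ ∑ f xor ∑ g
  ∑-xor f g = sum-xor (λ i → f (element i)) (λ i → g (element i))

  ∑-reindex : ∀ {f} → Respects f → (ρ ρ⁻¹ : Carrier → Carrier) →
    (∀ {x y} → x ≈ y → ρ x ≈ ρ y) → (∀ {x y} → x ≈ y → ρ⁻¹ x ≈ ρ⁻¹ y) →
    (∀ x → ρ (ρ⁻¹ x) ≈ x) → (∀ x → ρ⁻¹ (ρ x) ≈ x) → ∑ f ≡ ∑ (f ∘ ρ)
  ∑-reindex {f} f-resp ρ ρ⁻¹ ρ-cong ρ⁻¹-cong ρρ⁻¹ ρ⁻¹ρ = ≡.trans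
    (sum-permute (λ i → f (element i)) (permutation (onIndex ρ) (onIndex ρ⁻¹) (inverse ρ ρ⁻¹ ρ-cong ρρ⁻¹) (inverse ρ⁻¹ ρ ρ⁻¹-cong ρ⁻¹ρ)))
    (sum-cong-≗ (λ i → f-resp (element-index (ρ (element i)))))
    where
    onIndex : (Carrier → Carrier) → Fin order → Fin order
    onIndex ρ i = index (ρ (element i))
    inverse : ∀ ρ ρ⁻¹ → (∀ {x y} → x ≈ y → ρ x ≈ ρ y) → (∀ x → ρ (ρ⁻¹ x) ≈ x) → ∀ i → onIndex ρ (onIndex ρ⁻¹ i) ≡ i
    inverse ρ ρ⁻¹ ρ-cong ρρ⁻¹ i = ≡.trans (index-cong (trans (ρ-cong (element-index _)) (ρρ⁻¹ (element i)))) (index-element i)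

  -- The involution σ pairs off the support of `f`. Keeping the member of smaller index gives g with
  -- f = g + g ∘ σ, and both summands have the same sum.
  ∑-paired : ∀ {f} → Respects f → (σ : Carrier → Carrier) → (∀ {x y} → x ≈ y → σ x ≈ σ y) → (∀ x → σ (σ x) ≈ x) →
    (∀ x → f (σ x) ≡ f x) → (∀ x → f x ≡ true → ¬ (σ x ≈ x)) → ∑ f ≡ false
  ∑-paired {f} f-resp σ σ-cong σσ fσ≡f noFixedPoint = begin
    ∑ f                                    ≡⟨ ∑-cong half ⟩
    ∑ (λ x → g x xor g (σ x))              ≡⟨ ∑-xor g (g ∘ σ) ⟩
    ∑ g xor ∑ (g ∘ σ)                      ≡⟨ ≡.cong (∑ g xor_) (∑-reindex g-resp σ σ σ-cong σ-cong σσ σσ) ⟨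
    ∑ g xor ∑ g                            ≡⟨ Boolₚ.xor-same (∑ g) ⟩
    false                                  ∎
    where
    open ≡-Reasoning
    lt : Carrier → Bool
    lt x = does (index x Finₚ.<? index (σ x))
    g : Carrier → Bool
    g x = f x ∧ lt x
    g-resp : Respects g
    g-resp x≈y = ≡.cong₂ _∧_ (f-resp x≈y) (≡.cong₂ (λ i j → does (i Finₚ.<? j)) (index-cong x≈y) (index-cong (σ-cong x≈y)))
    distinct : ∀ {n} {i j : Fin n} → i ≢ j → does (i Finₚ.<? j) xor does (j Finₚ.<? i) ≡ true
    distinct {i = i} {j} i≢j with Finₚ.<-cmp i j
    ... | tri< i<j _ j≮i = ≡.cong₂ _xor_ (dec-true (i Finₚ.<? j) i<j) (dec-false (j Finₚ.<? i) j≮i)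
    ... | tri≈ _ i≡j _   = ⊥-elim (i≢j i≡j)
    ... | tri> i≮j _ j<i = ≡.cong₂ _xor_ (dec-false (i Finₚ.<? j) i≮j) (dec-true (j Finₚ.<? i) j<i)
    half : ∀ x → f x ≡ g x xor g (σ x)
    half x with f x in fx≡ | f (σ x) | fσ≡f x
    ... | false | .false | ≡.refl = ≡.refl
    ... | true  | .true  | ≡.refl = ≡.sym (≡.trans
      (≡.cong (λ i → lt x xor does (index (σ x) Finₚ.<? i)) (index-cong (σσ x)))
      (distinct (λ eq → noFixedPoint x fx≡ (sym (index-injective eq)))))

  power-commutes : ∀ {x y} n → y ∙ x ≈ x ∙ y → y ∙ power n x ≈ power n x ∙ y
  power-commutes {x} {y} zero    yx≈xy = trans (identityʳ y) (sym (identityˡ y))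
  power-commutes {x} {y} (suc n) yx≈xy = begin
    y ∙ (x ∙ power n x)    ≈⟨ assoc y x _ ⟨
    y ∙ x ∙ power n x      ≈⟨ ∙-congʳ yx≈xy ⟩
    x ∙ y ∙ power n x      ≈⟨ assoc x y _ ⟩
    x ∙ (y ∙ power n x)    ≈⟨ ∙-congˡ (power-commutes n yx≈xy) ⟩
    x ∙ (power n x ∙ y)    ≈⟨ assoc x _ y ⟨
    x ∙ power n x ∙ y      ∎
    where open SetoidReasoning setoid

  power-∙ : ∀ {x y} n → y ∙ x ≈ x ∙ y → power n (x ∙ y) ≈ power n x ∙ power n y
  power-∙ {x} {y} zero    yx≈xy = sym (identityˡ ε)
  power-∙ {x} {y} (suc n) yx≈xy = begin
    x ∙ y ∙ power n (x ∙ y)              ≈⟨ ∙-congˡ (power-∙ n yx≈xy) ⟩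
    x ∙ y ∙ (power n x ∙ power n y)      ≈⟨ assoc x y _ ⟩
    x ∙ (y ∙ (power n x ∙ power n y))    ≈⟨ ∙-congˡ (assoc y _ _) ⟨
    x ∙ (y ∙ power n x ∙ power n y)      ≈⟨ ∙-congˡ (∙-congʳ (power-commutes n yx≈xy)) ⟩
    x ∙ (power n x ∙ y ∙ power n y)      ≈⟨ ∙-congˡ (assoc _ y _) ⟩
    x ∙ (power n x ∙ (y ∙ power n y))    ≈⟨ assoc x _ _ ⟨
    x ∙ power n x ∙ (y ∙ power n y)      ∎
    where open SetoidReasoning setoid

  power-⁻¹ : ∀ n x → power n (x ⁻¹) ≈ power n x ⁻¹
  power-⁻¹ n x = inverseˡ-unique _ _ (begin
    power n (x ⁻¹) ∙ power n x    ≈⟨ power-∙ n (trans (inverseʳ x) (sym (inverseˡ x))) ⟨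
    power n (x ⁻¹ ∙ x)            ≈⟨ power-cong n (inverseˡ x) ⟩
    power n ε                     ≈⟨ power-ε n ⟩
    ε                             ∎)
    where open SetoidReasoning setoid

  power-5-involution : ∀ {x} → x ∙ x ≈ ε → power 5 x ≈ x
  power-5-involution {x} x²≈ε = begin
    x ∙ power 4 x    ≈⟨ ∙-congˡ (power-∣ {2} {4} (trans (∙-congˡ (identityʳ x)) x²≈ε) (divides 2 ≡.refl)) ⟩
    x ∙ ε            ≈⟨ identityʳ x ⟩
    x                ∎
    where open SetoidReasoning setoid

  module Structure
    (exponent10 : ∀ x → power 10 x ≈ ε)
    (involutions-commute⇒≈ : ∀ {s t} → s ∙ s ≈ ε → t ∙ t ≈ ε → ¬ (s ≈ ε) → ¬ (t ≈ ε) → t ∙ s ≈ s ∙ t → s ≈ t)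
    where

    fifthPower² : ∀ x → power 5 x ∙ power 5 x ≈ ε
    fifthPower² x = trans (sym (power-+ x 5 5)) (exponent10 x)

    -- As `s` inverts x = s t, it commutes with a = x⁵, whose square is 1. If a ≠ 1, then s = a, so
    -- `s` commutes with x and hence with `t`; thus s = t, and x⁵ = 1 after all.
    dihedral : ∀ {s t} → s ∙ s ≈ ε → t ∙ t ≈ ε → ¬ (s ≈ ε) → ¬ (t ≈ ε) → power 5 (s ∙ t) ≈ ε
    dihedral {s} {t} s² t² s≉ε t≉ε with power 5 (s ∙ t) ≈? ε
    ... | yes eq  = eq
    ... | no  a≉ε = ⊥-elim (a≉ε (begin
      power 5 (s ∙ t)    ≈⟨ power-cong 5 (∙-congˡ (sym s≈t)) ⟩
      power 5 (s ∙ s)    ≈⟨ power-cong 5 s² ⟩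
      power 5 ε          ≈⟨ power-ε 5 ⟩
      ε                  ∎))
      where
      open SetoidReasoning setoid
      a x : Carrier
      x = s ∙ t
      a = power 5 x
      a² = fifthPower² x
      sx≈t : s ∙ x ≈ t
      sx≈t = trans (sym (assoc s s t)) (trans (∙-congʳ s²) (identityˡ t))
      x⁻¹s≈t : x ⁻¹ ∙ s ≈ t
      x⁻¹s≈t = begin
        x ⁻¹ ∙ s              ≈⟨ ∙-congʳ (⁻¹-anti-homo-∙ s t) ⟩
        t ⁻¹ ∙ s ⁻¹ ∙ s       ≈⟨ assoc _ _ s ⟩
        t ⁻¹ ∙ (s ⁻¹ ∙ s)     ≈⟨ ∙-congˡ (inverseˡ s) ⟩
        t ⁻¹ ∙ ε              ≈⟨ identityʳ _ ⟩
        t ⁻¹                  ≈⟨ inverseˡ-unique t t t² ⟨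
        t                     ∎
      s-inverts : ∀ n → s ∙ power n x ≈ power n (x ⁻¹) ∙ s
      s-inverts zero    = trans (identityʳ s) (sym (identityˡ s))
      s-inverts (suc n) = begin
        s ∙ (x ∙ power n x)              ≈⟨ assoc s x _ ⟨
        s ∙ x ∙ power n x                ≈⟨ ∙-congʳ (trans sx≈t (sym x⁻¹s≈t)) ⟩
        x ⁻¹ ∙ s ∙ power n x             ≈⟨ assoc _ s _ ⟩
        x ⁻¹ ∙ (s ∙ power n x)           ≈⟨ ∙-congˡ (s-inverts n) ⟩
        x ⁻¹ ∙ (power n (x ⁻¹) ∙ s)      ≈⟨ assoc _ _ s ⟨
        x ⁻¹ ∙ power n (x ⁻¹) ∙ s        ∎
      sa≈as : s ∙ a ≈ a ∙ s
      sa≈as = trans (s-inverts 5) (∙-congʳ (trans (power-⁻¹ 5 x) (sym (inverseˡ-unique a a a²))))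
      s≈a : s ≈ a
      s≈a = involutions-commute⇒≈ s² a² s≉ε a≉ε (sym sa≈as)
      s≈t : s ≈ t
      s≈t = involutions-commute⇒≈ s² t² s≉ε t≉ε (begin
        t ∙ s                ≈⟨ ∙-congʳ sx≈t ⟨
        s ∙ x ∙ s            ≈⟨ ∙-congʳ (∙-congʳ s≈a) ⟩
        a ∙ x ∙ s            ≈⟨ ∙-congʳ (power-1+ 5 x) ⟩
        x ∙ a ∙ s            ≈⟨ assoc x a s ⟩
        x ∙ (a ∙ s)          ≈⟨ ∙-congˡ (trans (∙-congʳ (sym s≈a)) s²) ⟩
        x ∙ ε                ≈⟨ identityʳ x ⟩
        s ∙ t                ∎)

    module _ {t : Carrier} (t² : t ∙ t ≈ ε) (t≉ε : ¬ (t ≈ ε)) where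

      private
        Commutes : Carrier → Set ℓ
        Commutes x = t ∙ x ≈ x ∙ t

        commutes? : ∀ x → Dec (Commutes x)
        commutes? x = t ∙ x ≈? x ∙ t

        xtt≈x : ∀ x → x ∙ t ∙ t ≈ x
        xtt≈x x = trans (assoc x t t) (trans (∙-congˡ t²) (identityʳ x))

        ttx≈x : ∀ x → t ∙ (t ∙ x) ≈ x
        ttx≈x x = trans (sym (assoc t t x)) (trans (∙-congʳ t²) (identityˡ x))

        xt≉x : ∀ x → ¬ (x ∙ t ≈ x)
        xt≉x x xt≈x = t≉ε (identityʳ-unique x t xt≈x)

        commutes-xt : ∀ {x} → Commutes x → Commutes (x ∙ t)
        commutes-xt {x} tx≈xt = trans (sym (assoc t x t)) (∙-congʳ tx≈xt)

        commutes-xt⁻¹ : ∀ {x} → Commutes (x ∙ t) → Commutes x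
        commutes-xt⁻¹ {x} eq = ∙-cancelʳ t _ _ (trans (assoc t x t) eq)

        commutes-tx⁻¹ : ∀ {x} → Commutes (t ∙ x) → Commutes x
        commutes-tx⁻¹ {x} eq = ∙-cancelˡ t _ _ (trans eq (assoc t x t))

        -- A label of the set {x, t x}, namely its smallest index. If `x` does not commute with `t`,
        -- this set is disjoint from {x t, t x t}, and comparing labels decides between x and x t.
        L : Carrier → ℕ
        L x = Fin.toℕ (index x) ℕ.⊓ Fin.toℕ (index (t ∙ x))

        L-cong : ∀ {x y} → x ≈ y → L x ≡ L y
        L-cong x≈y = ≡.cong₂ (λ i j → Fin.toℕ i ℕ.⊓ Fin.toℕ j) (index-cong x≈y) (index-cong (∙-congˡ x≈y))

        L-tx : ∀ x → L (t ∙ x) ≡ L x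
        L-tx x = ≡.trans (≡.cong (λ i → Fin.toℕ (index (t ∙ x)) ℕ.⊓ Fin.toℕ i) (index-cong (ttx≈x x))) (ℕₚ.⊓-comm (Fin.toℕ (index (t ∙ x))) _)

        L-xt : ∀ {x} → ¬ Commutes x → L x ≢ L (x ∙ t)
        L-xt {x} tx≉xt Lx≡Lxt = [ (λ p → [ case₁ p , case₂ p ]′ selʳ) , (λ p → [ case₃ p , case₄ p ]′ selʳ) ]′ selˡ
          where
          i j k l : ℕ
          i = Fin.toℕ (index x)
          j = Fin.toℕ (index (t ∙ x))
          k = Fin.toℕ (index (x ∙ t))
          l = Fin.toℕ (index (t ∙ (x ∙ t)))
          selˡ = ℕₚ.⊓-sel i j
          selʳ = ℕₚ.⊓-sel k l
          conclude : ∀ {y z m n} → m ≡ Fin.toℕ (index y) → n ≡ Fin.toℕ (index z) → m ≡ n → y ≈ z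
          conclude ≡.refl ≡.refl eq = index-injective (Finₚ.toℕ-injective eq)
          case₁ : i ℕ.⊓ j ≡ i → k ℕ.⊓ l ≡ k → ⊥
          case₁ p q = xt≉x x (sym (conclude p q Lx≡Lxt))
          case₂ : i ℕ.⊓ j ≡ i → k ℕ.⊓ l ≡ l → ⊥
          case₂ p q = tx≉xt (trans (∙-congˡ (conclude p q Lx≡Lxt)) (ttx≈x (x ∙ t)))
          case₃ : i ℕ.⊓ j ≡ j → k ℕ.⊓ l ≡ k → ⊥
          case₃ p q = tx≉xt (conclude p q Lx≡Lxt)
          case₄ : i ℕ.⊓ j ≡ j → k ℕ.⊓ l ≡ l → ⊥
          case₄ p q = xt≉x x (sym (∙-cancelˡ t _ _ (conclude p q Lx≡Lxt)))

        -- r selects one element of each coset {x , x t}; on elements not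
        -- commuting with t the choice is invariant under left multiplication
        -- by t, which makes the value of the transfer at t easy to compute.
        r : Carrier → Bool
        r x = if does (commutes? x) then does (power 5 x ≈? ε) else does (L x ℕₚ.<? L (x ∙ t))

        r-resp : Respects r
        r-resp {x} {y} x≈y = if-cong
          (≡.cong₂ (λ i j → does (i Finₚ.≟ j)) (index-cong (∙-congˡ x≈y)) (index-cong (∙-congʳ x≈y)))
          (≡.cong (λ i → does (i Finₚ.≟ index ε)) (index-cong (power-cong 5 x≈y)))
          (≡.cong₂ (λ m n → does (m ℕₚ.<? n)) (L-cong x≈y) (L-cong (∙-congʳ x≈y)))
          where
          if-cong : ∀ {a a′ b b′ c c′ : Bool} → a ≡ a′ → b ≡ b′ → c ≡ c′ → (if a then b else c) ≡ (if a′ then b′ else c′)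
          if-cong ≡.refl ≡.refl ≡.refl = ≡.refl

        r-commuting : ∀ {x} → Commutes x → r x ≡ does (power 5 x ≈? ε)
        r-commuting {x} tx≈xt rewrite dec-true (commutes? x) tx≈xt = ≡.refl

        r-noncommuting : ∀ {x} → ¬ Commutes x → r x ≡ does (L x ℕₚ.<? L (x ∙ t))
        r-noncommuting {x} tx≉xt rewrite dec-false (commutes? x) tx≉xt = ≡.refl

        fifthPower-xt : ∀ {x} → Commutes x → power 5 (x ∙ t) ≈ power 5 x ∙ t
        fifthPower-xt {x} tx≈xt = trans (power-∙ 5 tx≈xt) (∙-congˡ (power-5-involution t²))

        -- If `x` commutes with `t`, then x⁵ is 1 or `t`, because commuting involutions coincide;
        -- multiplication of `x` by `t` exchanges the two cases. Otherwise the two labels swap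
        -- roles.
        r-xt : ∀ x → r (x ∙ t) ≡ not (r x)
        r-xt x with commutes? x
        ... | no tx≉xt = ≡.trans (r-noncommuting (λ comm → tx≉xt (commutes-xt⁻¹ comm)))
          (≡.trans (≡.cong (λ m → does (L (x ∙ t) ℕₚ.<? m)) (L-cong (xtt≈x x))) (≡.trans (flip (L (x ∙ t)) (L x) (λ eq → L-xt tx≉xt (≡.sym eq))) (≡.cong not (≡.sym (r-noncommuting tx≉xt)))))
          where
          flip : ∀ m n → m ≢ n → does (m ℕₚ.<? n) ≡ not (does (n ℕₚ.<? m))
          flip m n m≢n with ℕₚ.<-cmp m n
          ... | tri< m<n _ n≮m = ≡.trans (dec-true (m ℕₚ.<? n) m<n) (≡.cong not (≡.sym (dec-false (n ℕₚ.<? m) n≮m)))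
          ... | tri≈ _ m≡n _   = ⊥-elim (m≢n m≡n)
          ... | tri> m≮n _ n<m = ≡.trans (dec-false (m ℕₚ.<? n) m≮n) (≡.cong not (≡.sym (dec-true (n ℕₚ.<? m) n<m)))
        ... | yes tx≈xt = ≡.trans (r-commuting (commutes-xt tx≈xt)) (≡.trans (flip (power 5 x ≈? ε)) (≡.cong not (≡.sym (r-commuting tx≈xt))))
          where
          flip : (d : Dec (power 5 x ≈ ε)) → does (power 5 (x ∙ t) ≈? ε) ≡ not (does d)
          flip (yes x⁵≈ε) = dec-false (power 5 (x ∙ t) ≈? ε)
            (λ eq → t≉ε (trans (sym (trans (∙-congʳ x⁵≈ε) (identityˡ t))) (trans (sym (fifthPower-xt tx≈xt)) eq)))
          flip (no x⁵≉ε) = dec-true (power 5 (x ∙ t) ≈? ε)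
            (trans (fifthPower-xt tx≈xt) (trans (∙-congʳ (involutions-commute⇒≈ (fifthPower² x) t² x⁵≉ε t≉ε
              (power-commutes 5 tx≈xt))) t²))

      -- Let T be the set selected by `r`. For x in T, the element g x lies in T or in T t; counting
      -- the second case modulo 2 is the transfer of `g` into {1, t}.
      χ : Carrier → Bool
      χ g = ∑ (λ x → r x ∧ not (r (g ∙ x)))

      χ-cong : Respects χ
      χ-cong {g} {h} g≈h = ∑-cong (λ x → ≡.cong (λ b → r x ∧ not b) (r-resp (∙-congʳ {x} g≈h)))

      -- With a, b, c the values of `r` at x, h x and g h x, the summands add up except for the
      -- error (a + b)(b + c). All three values flip under x ↦ x t, which leaves the error
      -- unchanged, so its sum is even.
      χ-∙ : ∀ g h → χ (g ∙ h) ≡ χ g xor χ h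
      χ-∙ g h = begin
        ∑ (λ x → r x ∧ not (r (g ∙ h ∙ x)))
          ≡⟨ ∑-cong (λ x → ≡.trans (≡.cong (λ b → r x ∧ not b) (r-resp (assoc g h x))) (expand (r x) (r (h ∙ x)) (r (g ∙ (h ∙ x))))) ⟩
        ∑ (λ x → (E (h ∙ x) xor F x) xor (r x ∧ not (r (h ∙ x))))
          ≡⟨ ∑-xor (λ x → E (h ∙ x) xor F x) (λ x → r x ∧ not (r (h ∙ x))) ⟩
        ∑ (λ x → E (h ∙ x) xor F x) xor χ h
          ≡⟨ ≡.cong (_xor χ h) (∑-xor (λ x → E (h ∙ x)) F) ⟩
        (∑ (λ x → E (h ∙ x)) xor ∑ F) xor χ h
          ≡⟨ ≡.cong (_xor χ h) (≡.trans (≡.cong (∑ (λ x → E (h ∙ x)) xor_) ∑F≡0) (Boolₚ.xor-identityʳ (∑ (λ x → E (h ∙ x))))) ⟩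
        ∑ (λ x → E (h ∙ x)) xor χ h
          ≡⟨ ≡.cong (_xor χ h) (∑-reindex {E} (λ x≈y → ≡.cong₂ (λ a b → a ∧ not b) (r-resp x≈y) (r-resp (∙-congˡ x≈y)))
               (h ∙_) (h ⁻¹ ∙_) ∙-congˡ ∙-congˡ (\\-leftDividesˡ h) (\\-leftDividesʳ h)) ⟨
        χ g xor χ h ∎
        where
        open ≡-Reasoning
        expand : ∀ a b c → a ∧ not c ≡ ((b ∧ not c) xor ((a xor b) ∧ (b xor c))) xor (a ∧ not b)
        expand false false false = ≡.refl
        expand false false true  = ≡.refl
        expand false true  false = ≡.refl
        expand false true  true  = ≡.refl
        expand true  false false = ≡.refl
        expand true  false true  = ≡.refl
        expand true  true  false = ≡.refl
        expand true  true  true  = ≡.refl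
        E F : Carrier → Bool
        E y = r y ∧ not (r (g ∙ y))
        F x = (r x xor r (h ∙ x)) ∧ (r (h ∙ x) xor r (g ∙ (h ∙ x)))
        r-gxt : ∀ g x → r (g ∙ (x ∙ t)) ≡ not (r (g ∙ x))
        r-gxt g x = ≡.trans (r-resp (sym (assoc g x t))) (r-xt (g ∙ x))
        ∑F≡0 : ∑ F ≡ false
        ∑F≡0 = ∑-paired
          (λ x≈y → ≡.cong₂ _∧_ (≡.cong₂ _xor_ (r-resp x≈y) (r-resp (∙-congˡ x≈y)))
                               (≡.cong₂ _xor_ (r-resp (∙-congˡ x≈y)) (r-resp (∙-congˡ (∙-congˡ x≈y)))))
          (_∙ t) ∙-congʳ xtt≈x
          (λ x → ≡.cong₂ _∧_
            (≡.trans (≡.cong₂ _xor_ (r-xt x) (r-gxt h x)) (Boolₚ.xor-annihilates-not (r x) _))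
            (≡.trans (≡.cong₂ _xor_ (r-gxt h x) (≡.trans (r-resp (∙-congˡ (sym (assoc h x t)))) (r-gxt g (h ∙ x)))) (Boolₚ.xor-annihilates-not (r (h ∙ x)) _)))
          (λ x _ → xt≉x x)

      -- Elements not commuting with `t` contribute nothing, because r (t x) = r x. The others
      -- contribute exactly when x⁵ = 1, and inversion pairs off all of these but ε.
      χ-t : χ t ≡ true
      χ-t = begin
        ∑ (λ x → r x ∧ not (r (t ∙ x)))             ≡⟨ ∑-cong summand ⟩
        ∑ (λ x → does (x ≈? ε) xor Q x)             ≡⟨ ∑-xor (λ x → does (x ≈? ε)) Q ⟩
        ∑ (λ x → does (x ≈? ε)) xor ∑ Q             ≡⟨ ≡.cong₂ _xor_ ∑δ≡1 ∑Q≡0 ⟩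
        true                                        ∎
        where
        open ≡-Reasoning
        ∑δ≡1 : ∑ (λ x → does (x ≈? ε)) ≡ true
        ∑δ≡1 = ≡.trans (sum-cong-≗ (λ i → ≡.cong (λ j → does (j Finₚ.≟ index ε)) (index-element i))) (sum-indicator (index ε))
        Q : Carrier → Bool
        Q x = does (commutes? x) ∧ (does (power 5 x ≈? ε) ∧ not (does (x ≈? ε)))
        summand : ∀ x → r x ∧ not (r (t ∙ x)) ≡ does (x ≈? ε) xor Q x
        summand x with commutes? x
        ... | no tx≉xt = begin
          r x ∧ not (r (t ∙ x))
            ≡⟨ ≡.cong₂ (λ a b → a ∧ not b) (r-noncommuting tx≉xt) (r-noncommuting (λ comm → tx≉xt (commutes-tx⁻¹ comm))) ⟩
          does (L x ℕₚ.<? L (x ∙ t)) ∧ not (does (L (t ∙ x) ℕₚ.<? L (t ∙ x ∙ t)))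
            ≡⟨ ≡.cong (λ b → does (L x ℕₚ.<? L (x ∙ t)) ∧ not b) (≡.cong₂ (λ m n → does (m ℕₚ.<? n)) (L-tx x) (≡.trans (L-cong (assoc t x t)) (L-tx (x ∙ t)))) ⟩
          does (L x ℕₚ.<? L (x ∙ t)) ∧ not (does (L x ℕₚ.<? L (x ∙ t)))
            ≡⟨ Boolₚ.∧-inverseʳ (does (L x ℕₚ.<? L (x ∙ t))) ⟩
          false
            ≡⟨ ≡.cong₂ (λ a b → a xor (b ∧ (does (power 5 x ≈? ε) ∧ not (does (x ≈? ε)))))
                 (dec-false (x ≈? ε) (λ x≈ε → tx≉xt (trans (∙-congˡ x≈ε) (trans (identityʳ t) (trans (sym (identityˡ t)) (∙-congʳ (sym x≈ε)))))))
                 (dec-false (commutes? x) tx≉xt) ⟨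
          does (x ≈? ε) xor Q x ∎
        ... | yes tx≈xt = begin
          r x ∧ not (r (t ∙ x))
            ≡⟨ ≡.cong₂ (λ a b → a ∧ not b) (r-commuting tx≈xt) (≡.trans (r-resp tx≈xt) (≡.trans (r-xt x) (≡.cong not (r-commuting tx≈xt)))) ⟩
          does (power 5 x ≈? ε) ∧ not (not (does (power 5 x ≈? ε)))
            ≡⟨ split (power 5 x ≈? ε) (x ≈? ε) ⟩
          does (x ≈? ε) xor (does (power 5 x ≈? ε) ∧ not (does (x ≈? ε)))
            ≡⟨ ≡.cong (λ b → does (x ≈? ε) xor (b ∧ (does (power 5 x ≈? ε) ∧ not (does (x ≈? ε))))) (dec-true (commutes? x) tx≈xt) ⟨
          does (x ≈? ε) xor Q x ∎
          where
          split : (d : Dec (power 5 x ≈ ε)) (d′ : Dec (x ≈ ε)) → does d ∧ not (not (does d)) ≡ does d′ xor (does d ∧ not (does d′))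
          split (yes _) (yes _) = ≡.refl
          split (yes _) (no _)  = ≡.refl
          split (no x⁵≉ε) (yes x≈ε) = ⊥-elim (x⁵≉ε (trans (power-cong 5 x≈ε) (power-ε 5)))
          split (no _) (no _)   = ≡.refl
        does-⇔ : ∀ {a b} {A : Set a} {B : Set b} (A? : Dec A) (B? : Dec B) → (A → B) → (B → A) → does A? ≡ does B?
        does-⇔ (yes a) B? f g = ≡.sym (dec-true B? (f a))
        does-⇔ (no ¬a) B? f g = ≡.sym (dec-false B? (λ b → ¬a (g b)))
        commutes-⁻¹ : ∀ {x} → Commutes x → Commutes (x ⁻¹)
        commutes-⁻¹ {x} tx≈xt = ∙-cancelˡ x _ _ (∙-cancelʳ x _ _ (begin′
          x ∙ (t ∙ x ⁻¹) ∙ x      ≈⟨ trans (assoc x _ x) (∙-congˡ (//-rightDividesˡ x t)) ⟩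
          x ∙ t                   ≈⟨ tx≈xt ⟨
          t ∙ x                   ≈⟨ ∙-congʳ (\\-leftDividesˡ x t) ⟨
          x ∙ (x ⁻¹ ∙ t) ∙ x      ∎′))
          where open SetoidReasoning setoid renaming (begin_ to begin′_; _∎ to _∎′)
        inv-ε : ∀ {x} → x ⁻¹ ≈ ε → x ≈ ε
        inv-ε x⁻¹≈ε = ⁻¹-injective (trans x⁻¹≈ε (sym ε⁻¹≈ε))
        ε-inv : ∀ {x} → x ≈ ε → x ⁻¹ ≈ ε
        ε-inv x≈ε = trans (⁻¹-cong x≈ε) ε⁻¹≈ε
        ∑Q≡0 : ∑ Q ≡ false
        ∑Q≡0 = ∑-paired
          (λ {x} {y} x≈y → ≡.cong₂ _∧_
            (≡.cong₂ (λ i j → does (i Finₚ.≟ j)) (index-cong (∙-congˡ x≈y)) (index-cong (∙-congʳ x≈y)))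
            (≡.cong₂ (λ i j → does (i Finₚ.≟ index ε) ∧ not (does (j Finₚ.≟ index ε))) (index-cong (power-cong 5 x≈y)) (index-cong x≈y)))
          _⁻¹ ⁻¹-cong ⁻¹-involutive
          (λ x → ≡.cong₂ _∧_
            (does-⇔ (commutes? (x ⁻¹)) (commutes? x)
              (λ comm → trans (∙-congˡ (sym (⁻¹-involutive x))) (trans (commutes-⁻¹ comm) (∙-congʳ (⁻¹-involutive x)))) commutes-⁻¹)
            (≡.cong₂ (λ a b → a ∧ not b)
              (does-⇔ (power 5 (x ⁻¹) ≈? ε) (power 5 x ≈? ε) (λ eq → inv-ε (trans (sym (power-⁻¹ 5 x)) eq)) (λ eq → trans (power-⁻¹ 5 x) (ε-inv eq)))
              (does-⇔ (x ⁻¹ ≈? ε) (x ≈? ε) inv-ε ε-inv)))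
          noFixed
          where
          noFixed : ∀ x → Q x ≡ true → ¬ (x ⁻¹ ≈ x)
          noFixed x Qx x⁻¹≈x =
            let x⁵∧x≉ε = Boolₚ.∧-conicalʳ (does (commutes? x)) _ Qx
                x⁵≈ε = witness (power 5 x ≈? ε) (Boolₚ.∧-conicalˡ (does (power 5 x ≈? ε)) _ x⁵∧x≉ε)
            in ¬witness (x ≈? ε) (Boolₚ.∧-conicalʳ (does (power 5 x ≈? ε)) _ x⁵∧x≉ε)
                 (power-5∧2 x⁵≈ε (trans (∙-congʳ (sym x⁻¹≈x)) (inverseˡ x)))
            where
            witness : ∀ {a} {A : Set a} (A? : Dec A) → does A? ≡ true → A
            witness (yes a) _ = a
            ¬witness : ∀ {a} {A : Set a} (A? : Dec A) → not (does A?) ≡ true → ¬ A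
            ¬witness (no ¬a) _ = ¬a

      χ-ε : χ ε ≡ false
      χ-ε = ≡.trans (χ-cong (sym (identityˡ ε))) (≡.trans (χ-∙ ε ε) (Boolₚ.xor-same (χ ε)))

      -- x⁵ is x times the square of x², and a homomorphism to a group of order 2 kills squares.
      χ-power5 : ∀ x → χ (power 5 x) ≡ χ x
      χ-power5 x = ≡.trans (χ-∙ x _) (≡.trans (≡.cong (χ x xor_) (≡.trans (χ-cong (power-+ x 2 2))
        (≡.trans (χ-∙ _ _) (Boolₚ.xor-same (χ (power 2 x)))))) (Boolₚ.xor-identityʳ (χ x)))

      x⁵≈ε⇒χ≡0 : ∀ {x} → power 5 x ≈ ε → χ x ≡ false
      x⁵≈ε⇒χ≡0 {x} x⁵≈ε = ≡.trans (≡.sym (χ-power5 x)) (≡.trans (χ-cong x⁵≈ε) χ-ε)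

      -- Otherwise x⁵ is an involution in the kernel. Then x⁵ t is a product of two involutions, so
      -- its fifth power is 1 and χ vanishes on it, contrary to χ t = 1.
      χ≡0⇒x⁵≈ε : ∀ {x} → χ x ≡ false → power 5 x ≈ ε
      χ≡0⇒x⁵≈ε {x} χx≡0 with power 5 x ≈? ε
      ... | yes eq   = eq
      ... | no x⁵≉ε = ⊥-elim (false≢true (begin
        false                          ≡⟨ x⁵≈ε⇒χ≡0 (dihedral (fifthPower² x) t² x⁵≉ε t≉ε) ⟨
        χ (power 5 x ∙ t)              ≡⟨ χ-∙ _ t ⟩
        χ (power 5 x) xor χ t          ≡⟨ ≡.cong₂ _xor_ (≡.trans (χ-power5 x) χx≡0) χ-t ⟩
        true                           ∎))
        where
        open ≡-Reasoning
        false≢true : false ≢ true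
        false≢true ()

      P : Subset order
      P = tabulate (λ i → not (χ (element i)))

      private
        toP : ∀ {x} → χ x ≡ false → _∈_ G x P
        toP {x} χx≡0 = Vecₚ.lookup⇒[]= (index x) P (≡.trans (Vecₚ.lookup∘tabulate _ (index x)) (≡.cong not (≡.trans (χ-cong (element-index x)) χx≡0)))

        fromP : ∀ {x} → _∈_ G x P → χ x ≡ false
        fromP {x} x∈P = ≡.trans (≡.sym (χ-cong (element-index x))) (Boolₚ.not-injective (≡.trans (≡.sym (Vecₚ.lookup∘tabulate _ (index x))) (Vecₚ.[]=⇒lookup x∈P)))

      P-exponent : HasExponent G 5 P
      P-exponent g g∈P = χ≡0⇒x⁵≈ε (fromP g∈P)

      χ-⁻¹ : ∀ x → χ (x ⁻¹) ≡ χ x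
      χ-⁻¹ x = xor-false (χ (x ⁻¹)) (χ x) (≡.trans (≡.sym (χ-∙ (x ⁻¹) x)) (≡.trans (χ-cong (inverseˡ x)) χ-ε))
        where
        xor-false : ∀ a b → a xor b ≡ false → a ≡ b
        xor-false false false eq = ≡.refl
        xor-false true  true  eq = ≡.refl

      P-isSylow : IsSylow G 5 P
      P-isSylow = record
        { isSubgroup = record
          { ε-closed  = toP χ-ε
          ; ∙-closed  = λ g∈P h∈P → toP (≡.trans (χ-∙ _ _) (≡.cong₂ _xor_ (fromP g∈P) (fromP h∈P)))
          ; ⁻¹-closed = λ g∈P → toP (≡.trans (χ-⁻¹ _) (fromP g∈P)) }
        ; isPGroup = λ g g∈P → 1 , P-exponent g g∈P
        -- Fifth powers preserve χ, so χ vanishes on elements of 5-power order and `P` contains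
        -- every 5-subgroup.
        ; maximal = λ Q _ Q-5group _ {i} i∈Q →
            let i∈Q′ = ≡.subst (Subset._∈ Q) (≡.sym (index-element i)) i∈Q
                k , eq = Q-5group (element i) i∈Q′
            in ≡.subst (Subset._∈ P) (index-element i) (toP (≡.trans (≡.sym (χ-power5^ k (element i))) (≡.trans (χ-cong eq) χ-ε)))
        }
        where
        χ-power5^ : ∀ k x → χ (power (5 ℕ.^ k) x) ≡ χ x
        χ-power5^ zero    x = χ-cong (identityʳ x)
        χ-power5^ (suc k) x = ≡.trans (χ-cong (sym (power-* x 5 (5 ℕ.^ k)))) (≡.trans (χ-power5 _) (χ-power5^ k x))

      P-index : HasIndex G P 2
      P-index = representative , λ g → coset g (χ g) ≡.refl
        where
        representative : Fin 2 → Carrier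
        representative zero    = ε
        representative (suc _) = t
        χ-representative : ∀ {i g b} → χ (representative i) ≡ b → χ (representative i ⁻¹ ∙ g) ≡ b xor χ g
        χ-representative {i} {g} eq = ≡.trans (χ-∙ _ g) (≡.cong (_xor χ g) (≡.trans (χ-⁻¹ _) eq))
        coset : ∀ g b → χ g ≡ b → ∃! _≡_ (λ i → _∈_ G (representative i ⁻¹ ∙ g) P)
        coset g false χg≡0 = zero , toP (≡.trans (χ-representative {zero} χ-ε) χg≡0) ,
          λ { {zero} _ → ≡.refl
            ; {suc zero} ∈P → ⊥-elim (absurd (≡.trans (≡.sym (fromP ∈P)) (≡.trans (χ-representative {suc zero} χ-t) (≡.cong not χg≡0)))) }
          where
          absurd : false ≢ true
          absurd ()
        coset g true χg≡1 = suc zero , toP (≡.trans (χ-representative {suc zero} χ-t) (≡.cong not χg≡1)) ,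
          λ { {zero} ∈P → ⊥-elim (absurd (≡.trans (≡.sym (fromP ∈P)) (≡.trans (χ-representative {zero} χ-ε) χg≡1)))
            ; {suc zero} _ → ≡.refl }
          where
          absurd : false ≢ true
          absurd ()

    -- The case is decided by searching G for an involution; if there is none, x⁵ is trivial because
    -- its square is.
    classification : (IsPGroup G 5 ⊤ × HasExponent G 5 ⊤) ⊎ (∃[ P ] (IsSylow G 5 P × HasExponent G 5 P × HasIndex G P 2))
    classification with Finₚ.any? (λ i → (element i ∙ element i ≈? ε) ×-dec ¬? (element i ≈? ε))
    ... | yes (i , t² , t≉ε) = inj₂ (P t² t≉ε , P-isSylow t² t≉ε , P-exponent t² t≉ε , P-index t² t≉ε)
    ... | no noInvolution = inj₁ ((λ g _ → 1 , exponent5 g) , λ g _ → exponent5 g)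
      where
      exponent5 : ∀ g → power 5 g ≈ ε
      exponent5 g with power 5 g ≈? ε
      ... | yes eq   = eq
      ... | no g⁵≉ε = ⊥-elim (noInvolution (index (power 5 g) ,
        trans (∙-cong (element-index _) (element-index _)) (fifthPower² g) , λ eq → g⁵≉ε (trans (sym (element-index _)) eq)))

-- The splitting field ℚ(ψ)

module GoldenField where
  open Rational using (fromℤ; fromℤ-*; fromℤ-+; fromℤ-injective; q*↧q≡↥q)
  private
    module ℚR = CommutativeRing ℚₚ.+-*-commutativeRing
    open Quadratic ℚₚ.+-*-commutativeRing (ℚ.- 1ℚ) 1ℚ
    module Q = CommutativeRing quadraticRing
    module ℚF = FieldProperties ℚ-field

  -- The equation makes the denominator divide p² and p divide the square of the denominator;
  -- coprimality leaves only p = 1 or -1 over 1, which fail.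
  p²≢pd+d² : ∀ p d → Coprime ∣ p ∣ (suc d) → p ℤ.* p ≢ p ℤ.* + suc d ℤ.+ + suc d ℤ.* + suc d
  p²≢pd+d² p d p⊥d eq = notOne p d ∣p∣≡1 d≡1 eq
    where
    open ≡-Reasoning
    open IntegerCoefficients ℤₚ.+-*-commutativeRing
    d∣p² : suc d ∣ ∣ p ∣ ℕ.* ∣ p ∣
    d∣p² = divides ∣ p ℤ.+ + suc d ∣ (begin
      ∣ p ∣ ℕ.* ∣ p ∣                              ≡⟨ ℤₚ.abs-* p p ⟨
      ∣ p ℤ.* p ∣                                  ≡⟨ ≡.cong ∣_∣ (≡.trans eq (≡.sym (ℤₚ.*-distribʳ-+ (+ suc d) p (+ suc d)))) ⟩
      ∣ (p ℤ.+ + suc d) ℤ.* + suc d ∣              ≡⟨ ℤₚ.abs-* (p ℤ.+ + suc d) (+ suc d) ⟩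
      ∣ p ℤ.+ + suc d ∣ ℕ.* suc d                  ∎)
    d≡1 : suc d ≡ 1
    d≡1 = p⊥d (coprime-divisor (Coprimality.sym p⊥d) d∣p² , Div.∣-refl)
    p∣d² : ∣ p ∣ ∣ suc d ℕ.* suc d
    p∣d² = divides ∣ p ℤ.- + suc d ∣ (begin
      suc d ℕ.* suc d                              ≡⟨⟩
      ∣ + suc d ℤ.* + suc d ∣
        ≡⟨ ≡.cong ∣_∣ (solve 2 (λ p d → d :* d := (p :* d :+ d :* d) :- p :* d) ≡.refl p (+ suc d)) ⟩
      ∣ (p ℤ.* + suc d ℤ.+ + suc d ℤ.* + suc d) ℤ.- p ℤ.* + suc d ∣   ≡⟨ ≡.cong (λ x → ∣ x ℤ.- p ℤ.* + suc d ∣) eq ⟨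
      ∣ p ℤ.* p ℤ.- p ℤ.* + suc d ∣
        ≡⟨ ≡.cong ∣_∣ (solve 2 (λ p d → p :* p :- p :* d := (p :- d) :* p) ≡.refl p (+ suc d)) ⟩
      ∣ (p ℤ.- + suc d) ℤ.* p ∣                    ≡⟨ ℤₚ.abs-* (p ℤ.- + suc d) p ⟩
      ∣ p ℤ.- + suc d ∣ ℕ.* ∣ p ∣                  ∎)
    ∣p∣≡1 : ∣ p ∣ ≡ 1
    ∣p∣≡1 = p⊥d (Div.∣-refl , coprime-divisor p⊥d p∣d²)
    notOne : ∀ p d → ∣ p ∣ ≡ 1 → suc d ≡ 1 → p ℤ.* p ≢ p ℤ.* + suc d ℤ.+ + suc d ℤ.* + suc d
    notOne (+ .1)    .0 ≡.refl ≡.refl ()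
    notOne -[1+ .0 ] .0 ≡.refl ≡.refl ()

  x²≢x+1 : ∀ x → x ℚ.* x ≢ x ℚ.+ 1ℚ
  x²≢x+1 x@(mkℚ p d p⊥d) x²≡x+1 = p²≢pd+d² p d (Coprimality.recompute p⊥d) (fromℤ-injective (begin
    fromℤ (p ℤ.* p)                          ≡⟨ fromℤ-* p p ⟩
    fromℤ p ℚ.* fromℤ p                      ≡⟨ ≡.cong₂ ℚ._*_ xd≡p xd≡p ⟨
    x ℚ.* D ℚ.* (x ℚ.* D)                    ≡⟨ Interchange.square x D ⟩
    x ℚ.* x ℚ.* (D ℚ.* D)                    ≡⟨ ≡.cong (ℚ._* (D ℚ.* D)) x²≡x+1 ⟩
    (x ℚ.+ 1ℚ) ℚ.* (D ℚ.* D)                 ≡⟨ Interchange.expand x D ⟩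
    x ℚ.* D ℚ.* D ℚ.+ D ℚ.* D                ≡⟨ ≡.cong (λ y → y ℚ.* D ℚ.+ D ℚ.* D) xd≡p ⟩
    fromℤ p ℚ.* D ℚ.+ D ℚ.* D                ≡⟨ ≡.cong₂ ℚ._+_ (fromℤ-* p (+ suc d)) (fromℤ-* (+ suc d) (+ suc d)) ⟨
    fromℤ (p ℤ.* + suc d) ℚ.+ fromℤ (+ suc d ℤ.* + suc d)   ≡⟨ fromℤ-+ (p ℤ.* + suc d) _ ⟨
    fromℤ (p ℤ.* + suc d ℤ.+ + suc d ℤ.* + suc d)           ∎))
    where
    open ≡-Reasoning
    D : ℚ
    D = fromℤ (+ suc d)
    xd≡p : x ℚ.* D ≡ fromℤ p
    xd≡p = q*↧q≡↥q x
    module Interchange where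
      open Rational using (solve; _:*_; _:+_; _:=_; con)
      square : ∀ x D → x ℚ.* D ℚ.* (x ℚ.* D) ≡ x ℚ.* x ℚ.* (D ℚ.* D)
      square = solve 2 (λ x D → x :* D :* (x :* D) := x :* x :* (D :* D)) ≡.refl
      expand : ∀ x D → (x ℚ.+ 1ℚ) ℚ.* (D ℚ.* D) ≡ x ℚ.* D ℚ.* D ℚ.+ D ℚ.* D
      expand = solve 2 (λ x D → (x :+ con (+ 1)) :* (D :* D) := x :* D :* D :+ D :* D) ≡.refl

  module Ratio {a ℓ} (R : CommutativeRing a ℓ) where
    open CommutativeRing R
    open IntegerCoefficients R using (solve; _:*_; _:+_; _:-_; :-_; _:=_; con)
    open SetoidReasoning setoid

    ratio : ∀ {a b c} → a * a + - 1# * (a * b) - 1# * (b * b) ≈ 0# → c * b ≈ 1# → a * c * (a * c) ≈ a * c + 1#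
    ratio {a} {b} {c} norm≈0 cb≈1 = begin
      a * c * (a * c)
        ≈⟨ solve 3 (λ a b c → a :* c :* (a :* c) :=
             c :* c :* (a :* a :+ (:- con (+ 1)) :* (a :* b) :- con (+ 1) :* (b :* b)) :+ (a :* c :* (c :* b) :+ (c :* b) :* (c :* b))) refl a b c ⟩
      c * c * (a * a + - 1# * (a * b) - 1# * (b * b)) + (a * c * (c * b) + (c * b) * (c * b))
        ≈⟨ +-cong (*-congˡ norm≈0) (+-cong (*-congˡ cb≈1) (*-cong cb≈1 cb≈1)) ⟩
      c * c * 0# + (a * c * 1# + 1# * 1#)
        ≈⟨ solve 2 (λ a c → c :* c :* con (+ 0) :+ (a :* c :* con (+ 1) :+ con (+ 1) :* con (+ 1)) := a :* c :+ con (+ 1)) refl a c ⟩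
      a * c + 1# ∎

    norm-0 : ∀ {a b} → a * a + - 1# * (a * b) - 1# * (b * b) ≈ 0# → b ≈ 0# → a * a ≈ 0#
    norm-0 {a} {b} norm≈0 b≈0 = begin
      a * a
        ≈⟨ solve 2 (λ a b → a :* a := (a :* a :+ (:- con (+ 1)) :* (a :* b) :- con (+ 1) :* (b :* b)) :+ (a :+ b) :* b) refl a b ⟩
      (a * a + - 1# * (a * b) - 1# * (b * b)) + (a + b) * b   ≈⟨ +-cong norm≈0 (*-congˡ b≈0) ⟩
      0# + (a + b) * 0#                                        ≈⟨ solve 2 (λ a b → con (+ 0) :+ (a :+ b) :* con (+ 0) := con (+ 0)) refl a b ⟩
      0#                                                       ∎

  open Ratio ℚₚ.+-*-commutativeRing

  -- A zero of the norm form with b ≠ 0 would make a / b a rational root of X² - X - 1. This is what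
  -- makes the quadratic ring a field.
  norm≡0⇒≡0 : ∀ a b → a ℚ.* a ℚ.+ ℚ.- 1ℚ ℚ.* (a ℚ.* b) ℚ.- 1ℚ ℚ.* (b ℚ.* b) ≡ 0ℚ → a ≡ 0ℚ × b ≡ 0ℚ
  norm≡0⇒≡0 a b norm≡0 with b ℚₚ.≟ 0ℚ
  ... | yes b≡0 = [ (λ a≡0 → a≡0) , (λ a≡0 → a≡0) ]′ (ℚF.x*y≈0⇒x≈0∨y≈0 {a} {a} (norm-0 {a} {b} norm≡0 b≡0)) , b≡0
  ... | no  b≢0 with c , cb≡1 , _ ← Field.inverse ℚ-field b b≢0 = ⊥-elim (x²≢x+1 (a ℚ.* c) (ratio {a} {b} {c} norm≡0 cb≡1))

  goldenField : Field
  goldenField = record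
    { commutativeRing = quadraticRing
    ; _≟_ = ×-decidable ℚₚ._≟_ ℚₚ._≟_
    ; 0≉1 = λ (0≡1 , _) → Field.0≉1 ℚ-field 0≡1
    ; inverse = inverse
    }
    where
    open SetoidReasoning Q.setoid
    inverse : ∀ x → ¬ (x Q.≈ Q.0#) → ∃[ y ] (y Q.* x Q.≈ Q.1#) × (x Q.* y Q.≈ Q.1#)
    inverse (a , b) x≉0 = y , Q.trans (Q.*-comm y x) xy≈1 , xy≈1
      where
      x x̄ y : Q.Carrier
      N : ℚ
      x = a , b
      x̄ = a ℚ.+ ℚ.- 1ℚ ℚ.* b , ℚ.- b
      N = a ℚ.* a ℚ.+ ℚ.- 1ℚ ℚ.* (a ℚ.* b) ℚ.- 1ℚ ℚ.* (b ℚ.* b)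
      N⁻¹ = Field.inverse ℚ-field N (λ N≡0 → x≉0 (norm≡0⇒≡0 a b N≡0))
      y = x̄ Q.* embed (proj₁ N⁻¹)
      xy≈1 : x Q.* y Q.≈ Q.1#
      xy≈1 = begin
        x Q.* (x̄ Q.* embed (proj₁ N⁻¹))      ≈⟨ Q.*-assoc x x̄ (embed (proj₁ N⁻¹)) ⟨
        x Q.* x̄ Q.* embed (proj₁ N⁻¹)        ≈⟨ Q.*-congʳ {embed (proj₁ N⁻¹)} {x Q.* x̄} {embed N} (conjugate a b) ⟩
        embed N Q.* embed (proj₁ N⁻¹)        ≈⟨ embed-* N (proj₁ N⁻¹) ⟨
        embed (N ℚ.* proj₁ N⁻¹)              ≈⟨ proj₂ (proj₂ N⁻¹) , ≡.refl ⟩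
        Q.1#                                 ∎

  ψ : Q.Carrier
  ψ = generator

  ψ²+ψ≈1 : ψ Q.* ψ Q.+ ψ Q.≈ Q.1#
  ψ²+ψ≈1 = ≡.refl , ≡.refl

  extension : Extension ℚ-field
  extension = record
    { top = goldenField
    ; ι = embed
    ; isRingHomomorphism = record
      { isSemiringHomomorphism = record
        { isNearSemiringHomomorphism = record
          { +-isMonoidHomomorphism = record
            { isMagmaHomomorphism = record
              { isRelHomomorphism = record { cong = λ a≡b → a≡b , ≡.refl }
              ; homo = embed-+ }
            ; ε-homo = ≡.refl , ≡.refl }
          ; *-homo = embed-* }
        ; 1#-homo = ≡.refl , ≡.refl }
      ; -‿homo = λ a → ≡.refl , ≡.refl } }

  degree2 : HasDegree extension 2
  degree2 = basis , record
    { spanning = λ (a , b) → (λ { zero → a ; (suc _) → b }) , decompose a b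
    ; independent = λ a a≈0 → λ
        { zero       → proj₁ (Q.trans (decompose (a zero) (a (suc zero))) a≈0)
        ; (suc zero) → proj₂ (Q.trans (decompose (a zero) (a (suc zero))) a≈0) }
    }
    where
    basis : Fin 2 → Q.Carrier
    basis zero    = Q.1#
    basis (suc _) = ψ

  module _ {P : Q.Carrier → Set} (intermediate : IsIntermediateField extension P) (Pψ : P ψ) where
    open IsIntermediateField intermediate
    containsψ⇒everything : ∀ x → P x
    containsψ⇒everything (a , b) = respects (Q.sym (Q.trans (decompose a b) (Q.+-cong {x = embed a Q.* Q.1#} {y = embed a} (Q.*-identityʳ (embed a)) (Q.+-identityʳ (embed b Q.* ψ)))))
      (+-closed (base a) (*-closed (base b) Pψ))

module _ {n} (Γ : Graph n) where
  open GoldenField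

  -- The walks of period 10 through all vertices confine the eigenvalues to ℚ(ψ). The single walk, a
  -- simple cycle of length 5 or a multiple of it, makes ψ an eigenvalue, so no smaller field
  -- suffices.
  walks⇒2Integral : WalksOfPeriod Γ 10 → ∀ m {x} → IsWalk Γ x → 0 ℕ.< m ℕ.* 5 → x (m ℕ.* 5) ≡ x 0 → x (suc (m ℕ.* 5)) ≡ x 1 →
    (∀ k → suc k ℕ.< m ℕ.* 5 → x (suc k) ≢ x 0) → Is2Integral Γ
  walks⇒2Integral walks m walk 0<5m period₀ period₁ injective₀ = extension ,
    record { containsEigenvalues = eigenvalues
           ; smallest = λ P intermediate eigenvalues∈P → containsψ⇒everything intermediate (eigenvalues∈P ψ ψ-eigenvalue) } ,
    degree2
    where
    ψ-eigenvalue : IsEigenvalue Γ goldenField ψ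
    ψ-eigenvalue = WalkProperties.rootOfUnity⇒eigenvalue Γ goldenField ψ walk 0<5m period₀ period₁ injective₀
      (RootsOfUnity.golden⇒trace (Field.commutativeRing goldenField) ψ m ψ²+ψ≈1)
    eigenvalues : (L : Extension goldenField) → ∀ μ → IsEigenvalue Γ (Extension.top L) μ → ExtensionProperties.InBase L μ
    eigenvalues L μ eigenvalue with c , c₀≉0 , rec , periodic ← walkSequence Γ (Extension.top L) eigenvalue walks =
      conclude (x*y≈0⇒x≈0∨y≈0 product≈0)
      where
      open ExtensionProperties L
      open Field top hiding (zero)
      open IntegerCoefficients commutativeRing
      open FieldProperties top
      open SetoidReasoning setoid
      open RootsOfUnity commutativeRing μ using (w₅)

      next : ∀ k → c (2 ℕ.+ k) ≈ μ * c (suc k) - c k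
      next k = trans (solve 2 (λ a b → b := (a :+ b) :- a) refl (c k) (c (2 ℕ.+ k))) (+-congʳ (rec k))

      previous : ∀ k → c k ≈ μ * c (suc k) - c (2 ℕ.+ k)
      previous k = trans (solve 2 (λ a b → a := (a :+ b) :- b) refl (c k) (c (2 ℕ.+ k))) (+-congʳ (rec k))

      fourSteps : Carrier → Carrier → Carrier
      fourSteps a b =
        let a₂ = μ * b - a
            a₃ = μ * a₂ - b
            a₄ = μ * a₃ - a₂
        in μ * a₄ - a₃

      fourSteps≈ : ∀ {a b a₂ a₃ a₄ a₅} → a₂ ≈ μ * b - a → a₃ ≈ μ * a₂ - b → a₄ ≈ μ * a₃ - a₂ → a₅ ≈ μ * a₄ - a₃ → a₅ ≈ fourSteps a b
      fourSteps≈ e₂ e₃ e₄ e₅ =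
        let e₃′ = trans e₃ (+-congʳ (*-congˡ e₂))
            e₄′ = trans e₄ (+-cong (*-congˡ e₃′) (-‿cong e₂))
        in trans e₅ (+-cong (*-congˡ e₄′) (-‿cong e₃′))

      -- Every fifth term of the sequence obeys the recurrence with ζ⁵ + ζ⁻⁵ in place of μ = ζ +
      -- ζ⁻¹.
      w₅-recurrence : ∀ k → c k + c (10 ℕ.+ k) ≈ w₅ * c (5 ℕ.+ k)
      w₅-recurrence k = begin
        c k + c (10 ℕ.+ k)
          ≈⟨ +-cong (fourSteps≈ (previous (3 ℕ.+ k)) (previous (2 ℕ.+ k)) (previous (1 ℕ.+ k)) (previous k))
                    (fourSteps≈ (next (5 ℕ.+ k)) (next (6 ℕ.+ k)) (next (7 ℕ.+ k)) (next (8 ℕ.+ k))) ⟩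
        fourSteps (c (5 ℕ.+ k)) (c (4 ℕ.+ k)) + fourSteps (c (5 ℕ.+ k)) (c (6 ℕ.+ k))
          ≈⟨ solve 4 (λ μ a b b′ →
               let f = λ b → let a₂ = μ :* b :- a; a₃ = μ :* a₂ :- b; a₄ = μ :* a₃ :- a₂ in μ :* a₄ :- a₃ in
               f b :+ f b′ := (μ :* (μ :* (μ :* μ)) :- con (+ 3) :* (μ :* μ) :+ con (+ 1)) :* (b :+ b′)
                 :- con (+ 2) :* ((μ :* (μ :* μ) :- con (+ 2) :* μ) :* a)) refl μ (c (5 ℕ.+ k)) (c (4 ℕ.+ k)) (c (6 ℕ.+ k)) ⟩
        (μ * (μ * (μ * μ)) - fromℤ (+ 3) * (μ * μ) + 1#) * (c (4 ℕ.+ k) + c (6 ℕ.+ k)) - fromℤ (+ 2) * ((μ * (μ * μ) - fromℤ (+ 2) * μ) * c (5 ℕ.+ k))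
          ≈⟨ +-congʳ (*-congˡ (rec (4 ℕ.+ k))) ⟩
        (μ * (μ * (μ * μ)) - fromℤ (+ 3) * (μ * μ) + 1#) * (μ * c (5 ℕ.+ k)) - fromℤ (+ 2) * ((μ * (μ * μ) - fromℤ (+ 2) * μ) * c (5 ℕ.+ k))
          ≈⟨ solve 2 (λ μ a → (μ :* (μ :* (μ :* μ)) :- con (+ 3) :* (μ :* μ) :+ con (+ 1)) :* (μ :* a)
                 :- con (+ 2) :* ((μ :* (μ :* μ) :- con (+ 2) :* μ) :* a)
               := (μ :* (μ :* (μ :* (μ :* μ))) :- con (+ 5) :* (μ :* (μ :* μ)) :+ con (+ 5) :* μ) :* a) refl μ (c (5 ℕ.+ k)) ⟩
        w₅ * c (5 ℕ.+ k) ∎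

      twice : ∀ k → w₅ * c (5 ℕ.+ k) ≈ fromℤ (+ 2) * c k
      twice k = trans (sym (w₅-recurrence k)) (trans (+-congˡ (periodic k)) (solve 1 (λ a → a :+ a := con (+ 2) :* a) refl (c k)))

      q q′ : Carrier
      q  = μ * μ + μ - 1#
      q′ = μ * μ - μ - 1#

      -- On a sequence of period 10 the shift by five is an involution, which gives w₅² = 4; and w₅²
      -- - 4 factors as (μ - 2) (μ + 2) q² q′².
      product≈0 : (((μ - fromℤ (+ 2)) * (q * q)) * ((μ - fromℤ -[1+ 1 ]) * (q′ * q′))) * c 0 ≈ 0#
      product≈0 = begin
        (((μ - fromℤ (+ 2)) * (q * q)) * ((μ - fromℤ -[1+ 1 ]) * (q′ * q′))) * c 0
          ≈⟨ *-congʳ (solve 1 (λ μ →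
               let w = μ :* (μ :* (μ :* (μ :* μ))) :- con (+ 5) :* (μ :* (μ :* μ)) :+ con (+ 5) :* μ
                   q = μ :* μ :+ μ :- con (+ 1)
                   q′ = μ :* μ :- μ :- con (+ 1)
               in ((μ :- con (+ 2)) :* (q :* q)) :* ((μ :- con -[1+ 1 ]) :* (q′ :* q′)) := w :* w :- con (+ 4)) refl μ) ⟩
        (w₅ * w₅ - fromℤ (+ 4)) * c 0
          ≈⟨ solve 2 (λ w a → (w :* w :- con (+ 4)) :* a := w :* (w :* a) :- con (+ 4) :* a) refl w₅ (c 0) ⟩
        w₅ * (w₅ * c 0) - fromℤ (+ 4) * c 0
          ≈⟨ +-congʳ (*-congˡ (trans (*-congˡ (sym (periodic 0))) (twice 5))) ⟩
        w₅ * (fromℤ (+ 2) * c 5) - fromℤ (+ 4) * c 0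
          ≈⟨ +-congʳ (trans (solve 2 (λ w a → w :* (con (+ 2) :* a) := con (+ 2) :* (w :* a)) refl w₅ (c 5)) (*-congˡ (twice 0))) ⟩
        fromℤ (+ 2) * (fromℤ (+ 2) * c 0) - fromℤ (+ 4) * c 0
          ≈⟨ solve 1 (λ a → con (+ 2) :* (con (+ 2) :* a) :- con (+ 4) :* a := con (+ 0)) refl (c 0) ⟩
        0# ∎

      ιψ²+ιψ≈1 : ι ψ * ι ψ + ι ψ ≈ 1#
      ιψ²+ιψ≈1 = trans (+-congʳ (sym (ι-* ψ ψ))) (trans (sym (ι-+ _ ψ)) (trans (ι-cong ψ²+ψ≈1) ι-1))

      module K = Field goldenField

      ι-1+ψ : ι (K.1# K.+ ψ) ≈ 1# + ι ψ
      ι-1+ψ = trans (ι-+ K.1# ψ) (+-congʳ ι-1)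

      -- The roots of X² + X - 1 are ψ and its conjugate -1 - ψ; those of `q′` are their negatives.
      root-q : q ≈ 0# → InBase μ
      root-q q≈0 = [ (λ eq → ψ , sym (x-y≈0⇒x≈y eq))
                   , (λ eq → K.- (K.1# K.+ ψ) , trans (ι-neg (K.1# K.+ ψ)) (trans (-‿cong ι-1+ψ) (sym (x-y≈0⇒x≈y eq)))) ]′
        (x*y≈0⇒x≈0∨y≈0 (begin
          (μ - ι ψ) * (μ - - (1# + ι ψ))
            ≈⟨ solve 2 (λ μ p → (μ :- p) :* (μ :- (:- (con (+ 1) :+ p))) := (μ :* μ :+ μ :- con (+ 1)) :- ((p :* p :+ p) :- con (+ 1))) refl μ (ι ψ) ⟩
          q - ((ι ψ * ι ψ + ι ψ) - 1#)    ≈⟨ +-cong q≈0 (-‿cong (trans (+-congʳ ιψ²+ιψ≈1) (-‿inverseʳ 1#))) ⟩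
          0# - 0#                         ≈⟨ -‿inverseʳ 0# ⟩
          0#                              ∎))

      root-q′ : q′ ≈ 0# → InBase μ
      root-q′ q′≈0 = [ (λ eq → K.- ψ , trans (ι-neg ψ) (sym (x-y≈0⇒x≈y eq)))
                     , (λ eq → K.1# K.+ ψ , trans ι-1+ψ (sym (x-y≈0⇒x≈y eq))) ]′
        (x*y≈0⇒x≈0∨y≈0 (begin
          (μ - - ι ψ) * (μ - (1# + ι ψ))
            ≈⟨ solve 2 (λ μ p → (μ :- (:- p)) :* (μ :- (con (+ 1) :+ p)) := (μ :* μ :- μ :- con (+ 1)) :- ((p :* p :+ p) :- con (+ 1))) refl μ (ι ψ) ⟩
          q′ - ((ι ψ * ι ψ + ι ψ) - 1#)   ≈⟨ +-cong q′≈0 (-‿cong (trans (+-congʳ ιψ²+ιψ≈1) (-‿inverseʳ 1#))) ⟩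
          0# - 0#                         ≈⟨ -‿inverseʳ 0# ⟩
          0#                              ∎))

      conclude : ((μ - fromℤ (+ 2)) * (q * q)) * ((μ - fromℤ -[1+ 1 ]) * (q′ * q′)) ≈ 0# ⊎ c 0 ≈ 0# → InBase μ
      conclude (inj₂ c₀≈0) = ⊥-elim (c₀≉0 c₀≈0)
      conclude (inj₁ eq) with x*y≈0⇒x≈0∨y≈0 eq
      ... | inj₁ eq′ = [ integerRoot L (+ 2) , (λ q²≈0 → [ root-q , root-q ]′ (x*y≈0⇒x≈0∨y≈0 q²≈0)) ]′ (x*y≈0⇒x≈0∨y≈0 eq′)
      ... | inj₂ eq′ = [ integerRoot L -[1+ 1 ] , (λ q²≈0 → [ root-q′ , root-q′ ]′ (x*y≈0⇒x≈0∨y≈0 q²≈0)) ]′ (x*y≈0⇒x≈0∨y≈0 eq′)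

-- Groups of exponent dividing 10

∣p∣≡1⇒singleton : ∀ {n} (p : Subset n) → Subset.∣ p ∣ ≡ 1 → ∃[ i ] (∀ k → k Subset.∈ p ⇔ k ≡ i)
∣p∣≡1⇒singleton (outside ∷ p) eq =
  let i , i-only = ∣p∣≡1⇒singleton p eq
  in suc i , λ { zero    → mk⇔ (λ ()) (λ ())
               ; (suc k) → mk⇔ (λ { (there k∈p) → ≡.cong suc (Equivalence.to (i-only k) k∈p) })
                               (λ { ≡.refl → there (Equivalence.from (i-only i) ≡.refl) }) }
∣p∣≡1⇒singleton (inside ∷ p) eq = zero , λ
  { zero    → mk⇔ (λ _ → ≡.refl) (λ _ → here)
  ; (suc k) → mk⇔ (λ { (there k∈p) → ⊥-elim (empty p (ℕₚ.suc-injective eq) k∈p) }) (λ ()) }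
  where
  empty : ∀ {n} (p : Subset n) → Subset.∣ p ∣ ≡ 0 → ∀ {k} → ¬ (k Subset.∈ p)
  empty (outside ∷ p) eq (there k∈p) = empty p eq k∈p

∣p∣≡2⇒pair : ∀ {n} (p : Subset n) → Subset.∣ p ∣ ≡ 2 →
  ∃₂ λ i j → i ≢ j × (∀ k → k Subset.∈ p ⇔ (k ≡ i ⊎ k ≡ j))
∣p∣≡2⇒pair (outside ∷ p) eq =
  let i , j , i≢j , members = ∣p∣≡2⇒pair p eq
  in suc i , suc j , i≢j ∘ Finₚ.suc-injective , λ
    { zero    → mk⇔ (λ ()) [ (λ ()) , (λ ()) ]′
    ; (suc k) → mk⇔
        (λ { (there k∈p) → [ inj₁ ∘ ≡.cong suc , inj₂ ∘ ≡.cong suc ]′ (Equivalence.to (members k) k∈p) })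
        (λ k≡ → there (Equivalence.from (members k) ([ inj₁ ∘ Finₚ.suc-injective , inj₂ ∘ Finₚ.suc-injective ]′ k≡))) }
∣p∣≡2⇒pair (inside ∷ p) eq =
  let j , j-only = ∣p∣≡1⇒singleton p (ℕₚ.suc-injective eq)
  in zero , suc j , (λ ()) , λ
    { zero    → mk⇔ (λ _ → inj₁ ≡.refl) (λ _ → here)
    ; (suc k) → mk⇔ (λ { (there k∈p) → inj₂ (≡.cong suc (Equivalence.to (j-only k) k∈p)) })
        [ (λ ()) , (λ k≡j → there (Equivalence.from (j-only k) (Finₚ.suc-injective k≡j))) ]′ }

module Converse {c ℓ : Level} (G : FiniteGroup c ℓ) where
  open GroupTheory G hiding (exponent10)
  open Transfer G using (power-commutes; power-∙; power-5-involution)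
  open SetoidReasoning setoid

  module _
    (exponent10 : ∀ x → power 10 x ≈ ε)
    (dihedral : ∀ {s t} → s ∙ s ≈ ε → t ∙ t ≈ ε → ¬ (s ≈ ε) → ¬ (t ≈ ε) → power 5 (s ∙ t) ≈ ε)
    {S : Subset order} (conn : IsConnectionSet G S) where

    private Γ = Cay G S conn

    inversePair : ∀ {s t} → IsPair S s t → t ≈ s ⁻¹ → Is2Integral Γ
    inversePair {s} {t} isPair t≈s⁻¹ = walks⇒2Integral Γ
      (λ i → cyclicWalk s (element i) , walk (element i) , ≡.trans (index-cong (identityˡ _)) (index-element i) ,
        cyclicWalk-periodic {10} (exponent10 s) (element i))
      (proj₁ order₅) (walk ε) (proj₁ (proj₂ order₅))
      (≡.trans (≡.cong (cyclicWalk s ε) (≡.sym (ℕₚ.+-identityʳ (proj₁ order₅ ℕ.* 5)))) (periodic 0))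
      (≡.trans (≡.cong (cyclicWalk s ε) (ℕₚ.+-comm 1 (proj₁ order₅ ℕ.* 5))) (periodic 1))
      (λ k k< eq → proj₂ (proj₂ (proj₂ order₅)) k k< (∙-cancelʳ ε _ _ (index-injective eq)))
      where
      open IsPair isPair
      walk = cyclicWalk-isWalk isPair t≈s⁻¹ conn
      s²≉ε : ¬ (s ∙ s ≈ ε)
      s²≉ε s² = s≉t (trans (inverseˡ-unique s s s²) (sym t≈s⁻¹))
      s²≉ε′ : ¬ (power 2 s ≈ ε)
      s²≉ε′ eq = s²≉ε (trans (∙-congˡ (sym (identityʳ s))) eq)
      -- The exact order of `s` is 5 or 10. The gcd of a smaller exponent with it divides 2 or, in
      -- the second case, possibly 5, whereas s² and there also s⁵ are nontrivial.
      order₅ : ∃[ m ] 0 ℕ.< m ℕ.* 5 × power (m ℕ.* 5) s ≈ ε × (∀ k → suc k ℕ.< m ℕ.* 5 → ¬ (power (suc k) s ≈ ε))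
      order₅ with power 5 s ≈? ε
      ... | yes s⁵≈ε = 1 , ℕ.z<s , s⁵≈ε , λ { k (ℕ.s≤s k<4) sᵏ≈ε → s²≉ε′ (power-∣ (power-gcd {suc k} {5} sᵏ≈ε s⁵≈ε)
          (≡.subst (λ k → gcd (suc k) 5 ∣ 2) (Finₚ.toℕ-fromℕ< k<4) (divisors (Fin.fromℕ< k<4)))) }
        where
        divisors : ∀ (k : Fin 4) → gcd (suc (Fin.toℕ k)) 5 ∣ 2
        divisors = from-yes (Finₚ.all? {n = 4} (λ k → gcd (suc (Fin.toℕ k)) 5 Div.∣? 2))
      ... | no s⁵≉ε = 2 , ℕ.z<s , exponent10 s , λ { k (ℕ.s≤s k<9) sᵏ≈ε →
          let s^gcd≈ε = power-gcd {suc k} {10} sᵏ≈ε (exponent10 s)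
          in [ (λ ∣2 → s²≉ε′ (power-∣ s^gcd≈ε ∣2)) , (λ ∣5 → s⁵≉ε (power-∣ s^gcd≈ε ∣5)) ]′
               (≡.subst (λ k → (gcd (suc k) 10 ∣ 2) ⊎ (gcd (suc k) 10 ∣ 5)) (Finₚ.toℕ-fromℕ< k<9) (divisors (Fin.fromℕ< k<9))) }
        where
        divisors : ∀ (k : Fin 9) → (gcd (suc (Fin.toℕ k)) 10 ∣ 2) ⊎ (gcd (suc (Fin.toℕ k)) 10 ∣ 5)
        divisors = from-yes (Finₚ.all? {n = 9} (λ k → (gcd (suc (Fin.toℕ k)) 10 Div.∣? 2) ⊎-dec (gcd (suc (Fin.toℕ k)) 10 Div.∣? 5)))
      periodic = cyclicWalk-periodic {proj₁ order₅ ℕ.* 5} (proj₁ (proj₂ (proj₂ order₅))) ε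

    -- t s is nontrivial with fifth power 1, so `s` and `t` behave as reflections of a regular
    -- pentagon: the alternating walk from ε first returns after 10 steps, which is the multiple m =
    -- 2 of 5.
    involutionPair : ∀ {s t} → IsPair S s t → s ∙ s ≈ ε → t ∙ t ≈ ε → ¬ (s ≈ ε) → ¬ (t ≈ ε) → Is2Integral Γ
    involutionPair {s} {t} isPair s² t² s≉ε t≉ε = walks⇒2Integral Γ
      (λ i → (λ k → index (alternating s t (element i) k)) , walk (element i) , index-element i , alternating-periodic 5 x⁵≈ε (element i))
      2 (walk ε) ℕ.z<s (alternating-periodic 5 x⁵≈ε ε 0) (alternating-periodic 5 x⁵≈ε ε 1)
      (λ k k<10 eq → injective₀ (suc k) (double (suc k)) ℕ.z<s k<10 (index-injective eq))
      where
      open IsPair isPair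
      walk = alternatingWalk-isWalk isPair s² t² conn
      x : Carrier
      x = t ∙ s
      x⁵≈ε : power 5 x ≈ ε
      x⁵≈ε = dihedral t² s² t≉ε s≉ε
      x≉ε : ¬ (x ≈ ε)
      x≉ε x≈ε = s≉t (trans (inverseʳ-unique t s x≈ε) (sym (inverseʳ-unique t t t²)))
      divisors : ∀ (k : Fin 4) → gcd (suc (Fin.toℕ k)) 5 ∣ 1
      divisors = from-yes (Finₚ.all? {n = 4} (λ k → gcd (suc (Fin.toℕ k)) 5 Div.∣? 1))
      even≉ : ∀ m → suc m ℕ.< 5 → ¬ (power (suc m) x ≈ ε)
      even≉ m (ℕ.s≤s m<4) eq = x≉ε (trans (sym (identityʳ x)) (power-∣ (power-gcd {suc m} {5} eq x⁵≈ε)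
        (≡.subst (λ k → gcd (suc k) 5 ∣ 1) (Finₚ.toℕ-fromℕ< m<4) (divisors (Fin.fromℕ< m<4)))))
      -- s would be a power of x, hence of order dividing 5.
      odd≉ : ∀ m → ¬ (s ∙ power m x ≈ ε)
      odd≉ m eq = s≉ε (power-5∧2 (begin
        power 5 s              ≈⟨ power-cong 5 (trans (inverseˡ-unique s s s²) (sym (inverseʳ-unique s _ eq))) ⟩
        power 5 (power m x)    ≈⟨ power-comm 5 m x ⟩
        power m (power 5 x)    ≈⟨ power-cong m x⁵≈ε ⟩
        power m ε              ≈⟨ power-ε m ⟩
        ε                      ∎) s²)
      m+m≡m*2 : ∀ m → m ℕ.+ m ≡ m ℕ.* 2
      m+m≡m*2 m = ≡.trans (≡.cong (m ℕ.+_) (≡.sym (ℕₚ.+-identityʳ m))) (ℕₚ.*-comm 2 m)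
      injective₀ : ∀ k → (∃[ m ] (k ≡ m ℕ.+ m ⊎ k ≡ suc (m ℕ.+ m))) → 0 ℕ.< k → k ℕ.< 10 → ¬ (alternating s t ε k ≈ ε)
      injective₀ _ (zero , inj₁ ≡.refl) () _ _
      injective₀ _ (suc m , inj₁ ≡.refl) _ k<10 eq = even≉ m (ℕₚ.*-cancelʳ-< 2 (suc m) 5 (≡.subst (ℕ._< 10) (m+m≡m*2 (suc m)) k<10)) (begin
        power (suc m) x                            ≈⟨ identityʳ _ ⟨
        power (suc m) x ∙ ε                        ≈⟨ alternating-+ s t ε (suc m) 0 ⟨
        alternating s t ε (suc m ℕ.* 2 ℕ.+ 0)      ≡⟨ ≡.cong (alternating s t ε) (≡.trans (ℕₚ.+-identityʳ _) (≡.sym (m+m≡m*2 (suc m)))) ⟩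
        alternating s t ε (suc m ℕ.+ suc m)        ≈⟨ eq ⟩
        ε                                          ∎)
      injective₀ _ (m , inj₂ ≡.refl) _ k<10 eq = odd≉ m (begin
        s ∙ power m x                              ≈⟨ ∙-congˡ (identityʳ _) ⟨
        s ∙ (power m x ∙ ε)                        ≈⟨ alternating-+ s t ε m 1 ⟨
        alternating s t ε (m ℕ.* 2 ℕ.+ 1)          ≡⟨ ≡.cong (alternating s t ε) (≡.trans (ℕₚ.+-comm _ 1) (≡.cong suc (≡.sym (m+m≡m*2 m)))) ⟩
        alternating s t ε (suc (m ℕ.+ m))          ≈⟨ eq ⟩
        ε                                          ∎)

    pair⇒2Integral : Subset.∣ S ∣ ≡ 2 → Is2Integral Γ
    pair⇒2Integral ∣S∣≡2 with i , j , i≢j , members ← ∣p∣≡2⇒pair S ∣S∣≡2 = byInverse (memberOf (Equivalence.to (S≡S⁻¹ s) s∈S))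
      where
      open IsConnectionSet conn
      s t : Carrier
      s = element i
      t = element j
      isPair : IsPair S s t
      isPair = record
        { s≉t = λ s≈t → i≢j (≡.trans (≡.sym (index-element i)) (≡.trans (index-cong s≈t) (index-element j)))
        ; members = λ g → mk⇔
            (λ g∈S → [ (λ eq → inj₁ (trans (sym (element-index g)) (reflexive (≡.cong element eq))))
                     , (λ eq → inj₂ (trans (sym (element-index g)) (reflexive (≡.cong element eq)))) ]′ (Equivalence.to (members (index g)) g∈S))
            [ (λ eq → Equivalence.from (members (index g)) (inj₁ (≡.trans (index-cong eq) (index-element i))))
            , (λ eq → Equivalence.from (members (index g)) (inj₂ (≡.trans (index-cong eq) (index-element j)))) ]′ }
      memberOf : ∀ {g} → _∈_ G g S → g ≈ s ⊎ g ≈ t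
      memberOf {g} = Equivalence.to (IsPair.members isPair g)
      s∈S : _∈_ G s S
      s∈S = Equivalence.from (IsPair.members isPair s) (inj₁ refl)
      t∈S : _∈_ G t S
      t∈S = Equivalence.from (IsPair.members isPair t) (inj₂ refl)
      nontrivial : ∀ {g} → _∈_ G g S → ¬ (g ≈ ε)
      nontrivial g∈S g≈ε = 1∉S (≡.subst (Subset._∈ S) (index-cong g≈ε) g∈S)
      square : ∀ {g} → g ⁻¹ ≈ g → g ∙ g ≈ ε
      square g⁻¹≈g = trans (∙-congʳ (sym g⁻¹≈g)) (inverseˡ _)
      byInverse : s ⁻¹ ≈ s ⊎ s ⁻¹ ≈ t → Is2Integral Γ
      byInverse (inj₂ s⁻¹≈t) = inversePair isPair (sym s⁻¹≈t)
      byInverse (inj₁ s⁻¹≈s) with memberOf (Equivalence.to (S≡S⁻¹ t) t∈S)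
      ... | inj₁ t⁻¹≈s = ⊥-elim (IsPair.s≉t isPair (⁻¹-injective (trans s⁻¹≈s (sym t⁻¹≈s))))
      ... | inj₂ t⁻¹≈t = involutionPair isPair (square s⁻¹≈s) (square t⁻¹≈t) (nontrivial s∈S) (nontrivial t∈S)

  exponent5⇒𝓑₂ : HasExponent G 5 ⊤ → 𝓑 G 2
  exponent5⇒𝓑₂ exponent5 S conn 2≤∣S∣ ∣S∣≤2 = pair⇒2Integral
    (λ x → power-∣ {5} {10} (x⁵≈ε x) (divides 2 ≡.refl))
    (λ s² _ s≉ε _ → ⊥-elim (s≉ε (power-5∧2 (x⁵≈ε _) s²)))
    conn (ℕₚ.≤-antisym ∣S∣≤2 2≤∣S∣)
    where
    x⁵≈ε : ∀ x → power 5 x ≈ ε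
    x⁵≈ε x = exponent5 x Subsetₚ.∈⊤

  module _ {P : Subset order} (isSubgroup : IsSubgroup G P) (exponent5 : HasExponent G 5 P) (index2 : HasIndex G P 2) where
    open IsSubgroup isSubgroup

    private
      ∈P-cong : ∀ {x y} → x ≈ y → _∈_ G x P → _∈_ G y P
      ∈P-cong x≈y = ≡.subst (Subset._∈ P) (index-cong x≈y)

      representative = proj₁ index2

      coset : Carrier → Fin 2
      coset g = proj₁ (proj₂ index2 g)

      inCoset : ∀ g → _∈_ G (representative (coset g) ⁻¹ ∙ g) P
      inCoset g = proj₁ (proj₂ (proj₂ index2 g))

      quotient∈P : ∀ {g h} → coset g ≡ coset h → _∈_ G (g ⁻¹ ∙ h) P
      quotient∈P {g} {h} eq = ∈P-cong (begin
        (r ⁻¹ ∙ g) ⁻¹ ∙ (r ⁻¹ ∙ h)      ≈⟨ ∙-congʳ (trans (⁻¹-anti-homo-∙ _ g) (∙-congˡ (⁻¹-involutive r))) ⟩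
        g ⁻¹ ∙ r ∙ (r ⁻¹ ∙ h)           ≈⟨ assoc _ r _ ⟩
        g ⁻¹ ∙ (r ∙ (r ⁻¹ ∙ h))         ≈⟨ ∙-congˡ (\\-leftDividesˡ r h) ⟩
        g ⁻¹ ∙ h                        ∎)
        (∙-closed (⁻¹-closed (inCoset g)) (≡.subst (λ i → _∈_ G (representative i ⁻¹ ∙ h) P) (≡.sym eq) (inCoset h)))
        where r = representative (coset g)

      coset-ε : ∀ {g} → ¬ (_∈_ G g P) → coset ε ≢ coset g
      coset-ε {g} g∉P eq = g∉P (∈P-cong (trans (∙-congʳ ε⁻¹≈ε) (identityˡ g)) (quotient∈P eq))

      Fin2 : ∀ {i j k : Fin 2} → i ≢ j → i ≢ k → j ≡ k
      Fin2 {zero}     {zero}     i≢j _ = ⊥-elim (i≢j ≡.refl)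
      Fin2 {zero}     {suc zero} {zero}     _ i≢k = ⊥-elim (i≢k ≡.refl)
      Fin2 {zero}     {suc zero} {suc zero} _ _ = ≡.refl
      Fin2 {suc zero} {suc zero} i≢j _ = ⊥-elim (i≢j ≡.refl)
      Fin2 {suc zero} {zero}     {suc zero} _ i≢k = ⊥-elim (i≢k ≡.refl)
      Fin2 {suc zero} {zero}     {zero}     _ _ = ≡.refl

      -- Both g⁻¹ and h lie in the only coset other than `P`, so their quotient g h lies in `P`.
      product∈P : ∀ {g h} → ¬ (_∈_ G g P) → ¬ (_∈_ G h P) → _∈_ G (g ∙ h) P
      product∈P {g} {h} g∉P h∉P = ∈P-cong (∙-congʳ (⁻¹-involutive g)) (quotient∈P {g ⁻¹} {h}
        (Fin2 (coset-ε (λ g⁻¹∈P → g∉P (∈P-cong (⁻¹-involutive g) (⁻¹-closed g⁻¹∈P)))) (coset-ε h∉P)))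

    index2⇒𝓑₂ : 𝓑 G 2
    index2⇒𝓑₂ S conn 2≤∣S∣ ∣S∣≤2 = pair⇒2Integral exponent10 dihedral conn (ℕₚ.≤-antisym ∣S∣≤2 2≤∣S∣)
      where
      exponent10 : ∀ x → power 10 x ≈ ε
      exponent10 x with index x Subsetₚ.∈? P
      ... | yes x∈P = power-∣ {5} {10} (exponent5 x x∈P) (divides 2 ≡.refl)
      ... | no  x∉P = begin
        power 10 x           ≈⟨ power-* x 5 2 ⟨
        power 5 (power 2 x)  ≈⟨ power-cong 5 (∙-congˡ (identityʳ x)) ⟩
        power 5 (x ∙ x)      ≈⟨ exponent5 (x ∙ x) (product∈P x∉P x∉P) ⟩
        ε                    ∎
      dihedral : ∀ {s t} → s ∙ s ≈ ε → t ∙ t ≈ ε → ¬ (s ≈ ε) → ¬ (t ≈ ε) → power 5 (s ∙ t) ≈ ε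
      dihedral {s} {t} s² t² s≉ε t≉ε = exponent5 (s ∙ t) (product∈P
        (λ s∈P → s≉ε (power-5∧2 (exponent5 s s∈P) s²)) (λ t∈P → t≉ε (power-5∧2 (exponent5 t t∈P) t²)))

theorem6p5 : {c ℓ : Level} (G : FiniteGroup c ℓ) →
    𝓑 G 2 ⇔
    ((IsPGroup G 5 ⊤ × HasExponent G 5 ⊤)
    ⊎ (∃[ P ] (IsSylow G 5 P × HasExponent G 5 P × HasIndex G P 2)))
theorem6p5 G = mk⇔
  (λ G∈𝓑₂ → Transfer.Structure.classification G
    (GroupTheory.exponent10 G G∈𝓑₂) (GroupTheory.involutions-commute⇒≈ G G∈𝓑₂))
  [ (λ (_ , exponent5) → Converse.exponent5⇒𝓑₂ G exponent5)
  , (λ (_ , isSylow , exponent5 , index2) → Converse.index2⇒𝓑₂ G (IsSylow.isSubgroup isSylow) exponent5 index2) ]′
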